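{- A finite group is isomorphic to the vertex-stabilizer (in the full automorphism group) of a finite connected tetravalent half-arc-transitive graph if and only if it is a non-trivial concentric group.
   Context: All graphs are finite, simple, undirected. A graph is half-arc-transitive if its automorphism group is transitive on vertices and on edges but not on arcs. A group $H$ is concentric if $H=\langle a_1,\dots,a_n\rangle$ for some elements $a_1,\dots,a_n$ such that $|\langle a_i,\dots,a_j\rangle|=2^{j-i+1}$ for all $1\leq i<j\leq n$ and there exists an isomorphism $\phi:\langle a_1,\dots,a_{n-1}\rangle\to\langle a_2,\dots,a_n\rangle$ with $a_i^\phi=a_{i+1}$ for $i=1,\dots,n-1$.
   Formalization: In the definition of concentric, the order condition |⟨a_i,…,a_j⟩| = 2^(j−i+1) is required for 1 ≤ i ≤ j ≤ n, not only i < j, so each a_i is an involution; with i < j only, Z_3 (n = 1) and Z_4 (n = 2) would be concentric and the claim would be false. -}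

module Defs where

open import Algebra.Bundles using (Group; RawGroup)
open import Algebra.Morphism.Structures using (IsGroupMonomorphism; IsGroupIsomorphism)
import Algebra.Morphism.GroupMonomorphism as GroupMonomorphism
open import Data.Fin.Base using (Fin)
open import Data.Fin.Permutation as Perm using (Permutation′; _⟨$⟩ʳ_; _⟨$⟩ˡ_; _∘ₚ_)
open import Data.List.Base using (length; filter; allFin)
open import Data.Nat.Base using (ℕ; suc; _+_; _∸_; _^_; _≤_)
open import Data.Product.Base using (Σ; ∃; _×_; _,_; proj₁; proj₂)
open import Data.Sum.Base using (_⊎_)
open import Function.Base using (_∘_)
open import Function.Bundles using (Inverse; Equivalence; _⇔_; mk⇔)
open import Level using (_⊔_; 0ℓ)
open import Relation.Binary.Construct.Closure.ReflexiveTransitive using (Star)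
open import Relation.Binary.Core using (Rel)
open import Relation.Binary.Definitions using (Decidable; Symmetric)
open import Relation.Binary.PropositionalEquality using (_≡_; refl; sym; trans; cong; subst₂; setoid)
open import Relation.Nullary.Negation.Core using (¬_)
open import Relation.Unary using (Pred; _∈_)

_≅_ : ∀ {a b c d} → Group a b → Group c d → Set (a ⊔ b ⊔ c ⊔ d)
G ≅ H = ∃ λ (f : Group.Carrier G → Group.Carrier H) →
  IsGroupIsomorphism (Group.rawGroup G) (Group.rawGroup H) f

HasOrder : ∀ {c ℓ} → Group c ℓ → ℕ → Set (c ⊔ ℓ)
HasOrder G k = Inverse (Group.setoid G) (setoid (Fin k))

Finite : ∀ {c ℓ} → Group c ℓ → Set (c ⊔ ℓ)
Finite G = ∃ λ k → HasOrder G k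

Trivial : ∀ {c ℓ} → Group c ℓ → Set (c ⊔ ℓ)
Trivial G = ∀ x → x ≈ ε
  where open Group G

module _ {c ℓ} (G : Group c ℓ) where
  open Group G hiding (refl; sym; trans)

  record IsSubgroup {p} (P : Pred Carrier p) : Set (c ⊔ p) where
    field
      ε-closed  : ε ∈ P
      ∙-closed  : ∀ {x y} → x ∈ P → y ∈ P → x ∙ y ∈ P
      ⁻¹-closed : ∀ {x} → x ∈ P → x ⁻¹ ∈ P

  subgroup : ∀ {p} (P : Pred Carrier p) → IsSubgroup P → Group (c ⊔ p) ℓ
  subgroup P isSubgroup = record
    { isGroup = GroupMonomorphism.isGroup inclusion isGroup }
    where
    open IsSubgroup isSubgroup

    raw : RawGroup _ _
    raw = record
      { Carrier = Σ Carrier P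
      ; _≈_     = λ x y → proj₁ x ≈ proj₁ y
      ; _∙_     = λ x y → proj₁ x ∙ proj₁ y , ∙-closed (proj₂ x) (proj₂ y)
      ; ε       = ε , ε-closed
      ; _⁻¹     = λ x → proj₁ x ⁻¹ , ⁻¹-closed (proj₂ x)
      }

    inclusion : IsGroupMonomorphism raw rawGroup proj₁
    inclusion = record
      { isGroupHomomorphism = record
        { isMonoidHomomorphism = record
          { isMagmaHomomorphism = record
            { isRelHomomorphism = record { cong = λ x≈y → x≈y }
            ; homo = λ _ _ → Group.refl G
            }
          ; ε-homo = Group.refl G
          }
        ; ⁻¹-homo = λ _ → Group.refl G
        }
      ; injective = λ x≈y → x≈y
      }

  data Generated {p} (S : Pred Carrier p) : Pred Carrier (c ⊔ ℓ ⊔ p) where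
    gen  : ∀ {x} → x ∈ S → x ∈ Generated S
    ε′   : ε ∈ Generated S
    _∙′_ : ∀ {x y} → x ∈ Generated S → y ∈ Generated S → x ∙ y ∈ Generated S
    inv  : ∀ {x} → x ∈ Generated S → x ⁻¹ ∈ Generated S
    resp : ∀ {x y} → x ≈ y → x ∈ Generated S → y ∈ Generated S

  ⟨_⟩ : ∀ {p} → Pred Carrier p → Group (c ⊔ ℓ ⊔ p) ℓ
  ⟨ S ⟩ = subgroup (Generated S) record
    { ε-closed = ε′ ; ∙-closed = _∙′_ ; ⁻¹-closed = inv }

  -- {aᵢ, …, aⱼ}, which is empty when j < i.
  Segment : (ℕ → Carrier) → ℕ → ℕ → Pred Carrier ℓ
  Segment a i j x = ∃ λ k → i ≤ k × k ≤ j × x ≈ a k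

  -- The sequence a₁, …, aₙ is given by a function on ℕ, of which only the
  -- values at 1, …, n are used.  The order condition includes i = j, so that
  -- each aᵢ is an involution: with i < j only, every cyclic group (n = 1) and
  -- the cyclic group of order 4 (n = 2, a₁ = a₂) would qualify.
  record IsConcentricSequence (n : ℕ) (a : ℕ → Carrier) : Set (c ⊔ ℓ) where
    field
      generates : ∀ x → x ∈ Generated (Segment a 1 n)
      order     : ∀ i j → 1 ≤ i → i ≤ j → j ≤ n →
                  HasOrder ⟨ Segment a i j ⟩ (2 ^ (j ∸ i + 1))
      shift     : ⟨ Segment a 1 (n ∸ 1) ⟩ ≅ ⟨ Segment a 2 n ⟩
      shift-gen : ∀ i (1≤i : 1 ≤ i) (i≤n-1 : i ≤ n ∸ 1) →
                  proj₁ (proj₁ shift (a i , gen (i , 1≤i , i≤n-1 , Group.refl G)))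
                    ≈ a (suc i)

  Concentric : Set (c ⊔ ℓ)
  Concentric = ∃ λ n → ∃ λ a → IsConcentricSequence n a

record Graph : Set₁ where
  infix 4 _~_ _~?_
  field
    size   : ℕ
    _~_    : Rel (Fin size) 0ℓ
    _~?_   : Decidable _~_
    ~-sym  : Symmetric _~_
    ~-irr  : ∀ {v} → ¬ (v ~ v)

  Vertex : Set
  Vertex = Fin size

  degree : Vertex → ℕ
  degree v = length (filter (v ~?_) (allFin size))

module _ (Γ : Graph) where
  open Graph Γ

  Connected : Set
  Connected = ∀ u v → Star _~_ u v

  Tetravalent : Set
  Tetravalent = ∀ v → degree v ≡ 4

  record Automorphism : Set where
    field
      perm     : Permutation′ size
      preserve : ∀ u v → (u ~ v) ⇔ (perm ⟨$⟩ʳ u ~ perm ⟨$⟩ʳ v)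

  open Automorphism

  infixl 8 _^^_
  _^^_ : Vertex → Automorphism → Vertex
  v ^^ α = perm α ⟨$⟩ʳ v

  -- Automorphisms act on the right: v ^^ (α ∙ β) = (v ^^ α) ^^ β.
  Aut : Group 0ℓ 0ℓ
  Aut = record
    { Carrier = Automorphism
    ; _≈_     = λ α β → ∀ v → v ^^ α ≡ v ^^ β
    ; _∙_     = λ α β → record
        { perm     = perm α ∘ₚ perm β
        ; preserve = λ u v → mk⇔
            (to (preserve β _ _) ∘ to (preserve α u v))
            (from (preserve α u v) ∘ from (preserve β _ _))
        }
    ; ε       = record { perm = Perm.id ; preserve = λ _ _ → mk⇔ (λ e → e) (λ e → e) }
    ; _⁻¹     = λ α → record
        { perm     = Perm.flip (perm α)
        ; preserve = λ u v → mk⇔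
            (λ e → from (preserve α _ _)
              (subst₂ _~_ (sym (Perm.inverseʳ (perm α))) (sym (Perm.inverseʳ (perm α))) e))
            (λ e → subst₂ _~_ (Perm.inverseʳ (perm α)) (Perm.inverseʳ (perm α))
              (to (preserve α _ _) e))
        }
    ; isGroup = record
        { isMonoid = record
          { isSemigroup = record
            { isMagma = record
              { isEquivalence = record
                { refl  = λ _ → refl
                ; sym   = λ p v → sym (p v)
                ; trans = λ p q v → trans (p v) (q v)
                }
              ; ∙-cong = λ {α} {α′} {β} p q v →
                  trans (cong (_^^ β) (p v)) (q (v ^^ α′))
              }
            ; assoc = λ _ _ _ _ → refl
            }
          ; identity = (λ _ _ → refl) , (λ _ _ → refl)
          }
        ; inverse = (λ α _ → Perm.inverseʳ (perm α)) , (λ α _ → Perm.inverseˡ (perm α))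
        ; ⁻¹-cong = λ {α} {β} p v → trans
            (sym (Perm.inverseˡ (perm β)))
            (cong (perm β ⟨$⟩ˡ_)
              (trans (sym (p (perm α ⟨$⟩ˡ v))) (Perm.inverseʳ (perm α))))
        }
    }
    where open Equivalence using (to; from)

  Stabilizer : Vertex → Group 0ℓ 0ℓ
  Stabilizer v = subgroup Aut (λ α → v ^^ α ≡ v) record
    { ε-closed  = refl
    ; ∙-closed  = λ {_} {β} p q → trans (cong (_^^ β) p) q
    ; ⁻¹-closed = λ {α} p →
        trans (cong (perm α ⟨$⟩ˡ_) (sym p)) (Perm.inverseˡ (perm α))
    }

  VertexTransitive : Set
  VertexTransitive = ∀ u v → ∃ λ α → u ^^ α ≡ v

  -- The edges {u, v} and {x, y} are unordered pairs.
  EdgeTransitive : Set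
  EdgeTransitive = ∀ {u v x y} → u ~ v → x ~ y →
    ∃ λ α → (u ^^ α ≡ x × v ^^ α ≡ y) ⊎ (u ^^ α ≡ y × v ^^ α ≡ x)

  ArcTransitive : Set
  ArcTransitive = ∀ {u v x y} → u ~ v → x ~ y →
    ∃ λ α → u ^^ α ≡ x × v ^^ α ≡ y

  HalfArcTransitive : Set
  HalfArcTransitive = VertexTransitive × EdgeTransitive × ¬ ArcTransitive

{-# OPTIONS --safe #-}

-- (⇒) Orient the edges by the orbit of one arc; in- and out-degrees are 2 by double counting.  Let g move v to an
-- out-neighbour and v_i = v^(g^i).  Let n be least such that no automorphism fixes v_0, …, v_n and moves v_{n+1}.
-- Then the group is transitive on directed n-arcs and, by strong connectivity, the stabilizer of an n-arc is trivial.
-- If a fixes v_0, …, v_{n-1} and moves v_n, then a_k = g^(k-1) a g^(1-k) is a concentric sequence: ⟨a_i, …, a_j⟩ is the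
-- stabilizer of v_{1-i}, …, v_{n-j}, whose order doubles with each vertex dropped, and conjugation by g is the shift.
--
-- (⇐) Extend the shift K → K′ between the two subgroups of index 2 to a bijection τ of H.  On X = H × ℤ/2 the map t given
-- by τ, toggling the bit outside K, and the right translations R_h generate a finite graph with vertices ℤ/3 × Sym(X)
-- modulo right translations and arcs (s, f) → (s + 1, f R_h t).  Left multiplication by permutations is transitive on
-- its arcs with vertex stabilizer H, but there may be further automorphisms.  They are removed by passing to abelian covers.
-- In a cover that remembers edge crossings modulo 1 + M!, the lifts of cycles are rigid geodesics; since cycles separate
-- vertices, this forces every automorphism to respect the fibres.  A second cover also remembers, modulo 3, crossings
-- between the classes of equivalence relations encoding the given automorphisms g_i: two points of the first cover
-- are equivalent if a digit weight, transported by g_i, agrees on them.  If α descends to no g_i, then for each i there is a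
-- combination of cycles invisible to the i-th relation but not to its image under α.  The iterated commutator of the
-- corresponding translations is trivial on one side of the conjugation by α and not on the other.

module Submission where

open import Defs
open import Algebra.Bundles using (Group)
open import Algebra.Morphism.Structures using (IsGroupIsomorphism)
import Algebra.Morphism.Construct.Composition as Composition
import Algebra.Properties.Group as GroupProperties
open import Data.Empty using (⊥; ⊥-elim)
open import Data.Fin.Base as Fin using (Fin; zero; suc; toℕ; fromℕ<)
open import Data.Fin.Permutation as Perm using (_⟨$⟩ʳ_; _⟨$⟩ˡ_)
import Data.Fin.Properties as Finₚ
open import Data.Integer.Base as ℤ using (ℤ; +_; -[1+_]; ∣_∣) renaming (_+_ to _+ᶻ_; _*_ to _*ᶻ_; _-_ to _-ᶻ_; -_ to neg)
open import Data.Integer.Divisibility.Signed using (divides; ∣m∣n⇒∣m+n; ∣m∣n⇒∣m-n; ∣m⇒∣-m; ∣n⇒∣m*n; ∣ᵤ⇒∣; ∣⇒∣ᵤ) renaming (_∣_ to _∣ᶻ_; _∣?_ to _∣ᶻ?_)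
import Data.Integer.DivMod as ℤᵈ
import Data.Integer.Properties as ℤₚ
open import Data.Integer.Solver using (module +-*-Solver)
open import Data.List.Base as List using (List; []; _∷_)
open import Data.List.Relation.Unary.Any as Any using (Any; here)
import Data.List.Relation.Unary.Any.Properties as Anyₚ
open import Data.Nat.Base as ℕ using (ℕ; zero; suc; _+_; _*_; _∸_; _^_; _≤_; _<_; z≤n; s≤s; NonZero; _!)
open import Data.Nat.Divisibility as ℕᵈ using (_∣_)
import Data.Nat.DivMod as ℕᵐ
import Data.Nat.Properties as ℕₚ
open import Data.Product.Base using (Σ; Σ-syntax; _×_; _,_; proj₁; proj₂)
open import Data.Sum.Base using (_⊎_; inj₁; inj₂; [_,_]′)
open import Function.Base using (_∘_; id)
open import Function.Bundles using (_⇔_; mk⇔; Equivalence; Inverse)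
open import Level using (0ℓ; _⊔_) renaming (suc to lsuc)
open import Relation.Binary.Construct.Closure.ReflexiveTransitive using (Star; _◅_; _◅◅_) renaming (ε to done)
open import Relation.Binary.Definitions using (tri<; tri≈; tri>)
open import Relation.Binary.PropositionalEquality using (_≡_; _≢_; refl; sym; trans; cong; cong₂; subst; subst₂; module ≡-Reasoning)
open import Relation.Nullary.Decidable using (decidable-stable; True; toWitness; fromWitness; Dec; yes; no; _×-dec_; _⊎-dec_; ¬?; map′)
open import Relation.Nullary.Negation.Core using (¬_)
open +-*-Solver using (solve; _:+_; _:*_; :-_; _:-_; _:=_; con)

-- Finite searches

-- By `t-ρ`, the map `t` and the translations satisfy the relations of the HNN extension of H whose
-- stable letter carries K to K′; the bottom graph is a coset graph of a finite permutation quotient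
-- of that extension. The ℤ/3 layers orient it and keep in- and out-neighbours apart. In fact there
-- are three covers. At a bottom vertex one only has two cycles that share no edge there; a
-- preliminary plain cover turns this into the separation of vertices by cycles on which the other
-- two rely. The moduli are chosen together. Modulo 1 + M! every nonzero integer of size at most M
-- is invertible, and bounded heights compare as integers. For M ≥ 3 this modulus is 1 modulo 3, so
-- the two kinds of memory have coprime orders; and modulo 3, unlike modulo 2, the values 1 and -1
-- differ. The obstacle is that an automorphism of the last cover respects the fibres but need not
-- carry memories to memories. What survives conjugation is group theory: commutators and orders. A
-- translation invisible to all relations has order dividing 1 + M!, one with a memory that is
-- nonzero modulo 3 does not.

least : (P : ℕ → Set) → (∀ i → Dec (P i)) → ∀ n → P n → Σ[ m ∈ ℕ ] P m × (∀ i → i < m → ¬ P i)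
least P P? zero p = 0 , p , λ _ ()
least P P? (suc n) p with P? 0
... | yes p₀ = 0 , p₀ , λ _ ()
... | no ¬p₀ with least (P ∘ suc) (P? ∘ suc) n p
...   | m , pm , min = suc m , pm , λ where
  zero _ → ¬p₀
  (suc i) (s≤s i<m) → min i i<m

leastFin : ∀ {n} (P : Fin n → Set) → (∀ i → Dec (P i)) → ∀ i → P i →
  Σ[ j ∈ Fin n ] P j × (∀ l → l Fin.< j → ¬ P l)
leastFin {suc n} P P? i p with P? zero
... | yes p₀ = zero , p₀ , λ _ ()
leastFin {suc n} P P? zero p | no ¬p₀ = ⊥-elim (¬p₀ p)
leastFin {suc n} P P? (suc i) p | no ¬p₀ with leastFin (P ∘ suc) (P? ∘ suc) i p
... | j , pj , min = suc j , pj , λ where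
  zero _ → ¬p₀
  (suc l) (s≤s l<j) → min l l<j

upperBound : ∀ {n} (f : Fin n → ℕ) → Σ[ M ∈ ℕ ] (∀ i → f i ≤ M)
upperBound {zero} f = 0 , λ ()
upperBound {suc n} f with upperBound (f ∘ suc)
... | M , b = f zero + M , λ where
  zero → ℕₚ.m≤m+n (f zero) M
  (suc i) → ℕₚ.≤-trans (b i) (ℕₚ.m≤n+m M (f zero))

record Subset {n} (P : Fin n → Set) : Set where
  field
    size  : ℕ
    emb   : Fin size → Fin n
    inj   : ∀ {i j} → emb i ≡ emb j → i ≡ j
    sound : ∀ i → P (emb i)
    index : ∀ j → P j → Σ[ i ∈ Fin size ] emb i ≡ j

subset : ∀ {n} (P : Fin n → Set) → (∀ i → Dec (P i)) → Subset P
subset {zero} P P? = record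
  { size = 0 ; emb = λ () ; inj = λ { {()} } ; sound = λ () ; index = λ () }
subset {suc n} P P? with subset (P ∘ suc) (P? ∘ suc) | P? zero
... | S | no ¬p = record
  { size = S.size ; emb = suc ∘ S.emb ; inj = S.inj ∘ Finₚ.suc-injective ; sound = S.sound
  ; index = λ where
      zero p → ⊥-elim (¬p p)
      (suc j) p → proj₁ (S.index j p) , cong suc (proj₂ (S.index j p)) }
  where module S = Subset S
... | S | yes p₀ = record
  { size = suc S.size
  ; emb = λ { zero → zero ; (suc i) → suc (S.emb i) }
  ; inj = λ { {zero} {zero} _ → refl ; {suc i} {suc j} e → cong suc (S.inj (Finₚ.suc-injective e)) }
  ; sound = λ { zero → p₀ ; (suc i) → S.sound i }
  ; index = λ where
      zero p → zero , refl
      (suc j) p → suc (proj₁ (S.index j p)) , cong suc (proj₂ (S.index j p)) }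
  where module S = Subset S

Exactly : ∀ {n} → (Fin n → Set) → ℕ → Set
Exactly {n} P d = Σ[ f ∈ (Fin d → Fin n) ] (∀ {i j} → f i ≡ f j → i ≡ j) × (∀ i → P (f i)) × (∀ x → P x → Σ[ i ∈ Fin d ] f i ≡ x)

exactly-≤ : ∀ {n} {P Q : Fin n → Set} {d e} → Exactly P d → Exactly Q e → (∀ {x} → P x → Q x) → d ≤ e
exactly-≤ (f , f-inj , f∈ , _) (g , _ , _ , g-all) P⊆Q = Finₚ.injective⇒≤ {f = λ i → proj₁ (g-all (f i) (P⊆Q (f∈ i)))}
  (λ {i} {j} e → f-inj (trans (sym (proj₂ (g-all (f i) _))) (trans (cong g e) (proj₂ (g-all (f j) _)))))

exactly : ∀ {n} {P : Fin n → Set} (P? : ∀ x → Dec (P x)) → Exactly P (Subset.size (subset P P?))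
exactly {P = P} P? = S.emb , S.inj , S.sound , S.index
  where module S = Subset (subset P P?)

Enumerates : {A : Set} → (A → A → Set) → List A → Set
Enumerates _≈_ xs = ∀ a → Any (a ≈_) xs

-- The relation is a parameter because functions are compared pointwise; nesting the lemma then
-- lists functions of several arguments up to pointwise equivalence.
enumerate-Π : ∀ n {A : Fin n → Set} (_≈_ : ∀ {i} → A i → A i → Set) →
  (∀ i → Σ[ xs ∈ List (A i) ] Enumerates _≈_ xs) →
  Σ[ fs ∈ List (∀ i → A i) ] Enumerates (λ f g → ∀ i → f i ≈ g i) fs
enumerate-Π zero _≈_ e = (λ ()) ∷ [] , λ _ → here (λ ())
enumerate-Π (suc n) {A} _≈_ e = List.concatMap branch (proj₁ (e zero)) , covers
  where
  tails = enumerate-Π n {A ∘ suc} _≈_ (e ∘ suc)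
  cons : A zero → (∀ i → A (suc i)) → ∀ i → A i
  cons a f zero = a
  cons a f (suc i) = f i
  branch = λ a → List.map (cons a) (proj₁ tails)
  covers : Enumerates (λ f g → ∀ i → f i ≈ g i) (List.concatMap branch (proj₁ (e zero)))
  covers f = Anyₚ.concatMap⁺ branch (Any.map inner (proj₂ (e zero) (f zero)))
    where
    inner : ∀ {a} → f zero ≈ a → Any (λ g → ∀ i → f i ≈ g i) (branch a)
    inner f₀≈a = Anyₚ.map⁺ (Any.map (λ p → λ { zero → f₀≈a ; (suc i) → p i }) (proj₂ tails (f ∘ suc)))

enumerate-× : {A B : Set} (_≈_ : A → A → Set) (_≈′_ : B → B → Set) {xs : List A} {ys : List B} →
  Enumerates _≈_ xs → Enumerates _≈′_ ys →
  Enumerates (λ p q → (proj₁ p ≈ proj₁ q) × (proj₂ p ≈′ proj₂ q)) (List.cartesianProduct xs ys)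
enumerate-× _ _ {xs} {ys} ex ey (a , b) = Anyₚ.cartesianProduct⁺ (ex a) (ey b)

enumerate-Fin : ∀ n → Enumerates {Fin n} _≡_ (List.allFin n)
enumerate-Fin n i = Anyₚ.tabulate⁺ i refl

-- Reachability is decided by allowing more and more vertices as intermediate stops.

module Reachability {n} (A : Fin n → Fin n → Set) (A? : ∀ i j → Dec (A i j)) where
  Via : ∀ m → m ≤ n → Fin n → Fin n → Set
  Via zero _ i j = i ≡ j ⊎ A i j
  Via (suc m) m<n i j = Via m (ℕₚ.<⇒≤ m<n) i j ⊎
    (Via m (ℕₚ.<⇒≤ m<n) i (fromℕ< m<n) × Via m (ℕₚ.<⇒≤ m<n) (fromℕ< m<n) j)

  via? : ∀ m m≤n i j → Dec (Via m m≤n i j)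
  via? zero _ i j = (i Finₚ.≟ j) ⊎-dec A? i j
  via? (suc m) m<n i j = via? m _ i j ⊎-dec (via? m _ i (fromℕ< m<n) ×-dec via? m _ (fromℕ< m<n) j)

  via⇒star : ∀ m m≤n {i j} → Via m m≤n i j → Star A i j
  via⇒star zero _ (inj₁ refl) = done
  via⇒star zero _ (inj₂ a) = a ◅ done
  via⇒star (suc m) _ (inj₁ p) = via⇒star m _ p
  via⇒star (suc m) _ (inj₂ (p , q)) = via⇒star m _ p ◅◅ via⇒star m _ q

  via-refl : ∀ m m≤n {i} → Via m m≤n i i
  via-refl zero _ = inj₁ refl
  via-refl (suc m) _ = inj₁ (via-refl m _)

  via-step : ∀ m m≤n {i j} → A i j → Via m m≤n i j
  via-step zero _ a = inj₂ a
  via-step (suc m) _ a = inj₁ (via-step m _ a)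

  -- If `l` is the newest stop, each walk is cut at its visit to `l`. Otherwise detours through the
  -- newest stop are kept, and two of them merge into one.
  via-trans : ∀ m m≤n {i j} l → toℕ l < m → Via m m≤n i l → Via m m≤n l j → Via m m≤n i j
  via-trans (suc m) m<n {i} {j} l (s≤s l≤m) p q with ℕₚ.m≤n⇒m<n∨m≡n l≤m
  ... | inj₁ l<m = go p q
    where
    go : Via (suc m) m<n i l → Via (suc m) m<n l j → Via (suc m) m<n i j
    go (inj₁ p) (inj₁ q) = inj₁ (via-trans m _ l l<m p q)
    go (inj₁ p) (inj₂ (q , q′)) = inj₂ (via-trans m _ l l<m p q , q′)
    go (inj₂ (p , p′)) (inj₁ q) = inj₂ (p , via-trans m _ l l<m p′ q)
    go (inj₂ (p , _)) (inj₂ (_ , q)) = inj₂ (p , q)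
  ... | inj₂ l≡m = inj₂ (subst (Via m _ i) l≡ (left p) , subst (λ l → Via m _ l j) l≡ (right q))
    where
    l≡ : l ≡ fromℕ< m<n
    l≡ = Finₚ.toℕ-injective (trans l≡m (sym (Finₚ.toℕ-fromℕ< m<n)))
    left : Via (suc m) m<n i l → Via m (ℕₚ.<⇒≤ m<n) i l
    left (inj₁ p) = p
    left (inj₂ (p , _)) = subst (Via m _ i) (sym l≡) p
    right : Via (suc m) m<n l j → Via m (ℕₚ.<⇒≤ m<n) l j
    right (inj₁ q) = q
    right (inj₂ (_ , q)) = subst (λ l → Via m _ l j) (sym l≡) q

  star⇒via : ∀ {i j} → Star A i j → Via n ℕₚ.≤-refl i j
  star⇒via done = via-refl n _
  star⇒via (_◅_ {j = l} a s) = via-trans n _ l (Finₚ.toℕ<n l) (via-step n _ a) (star⇒via s)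

  reach? : ∀ i j → Dec (Star A i j)
  reach? i j = map′ (via⇒star n ℕₚ.≤-refl) star⇒via (via? n ℕₚ.≤-refl i j)

-- The connected component of a graph on a finite setoid

module Component {C : Set} (_≈_ _⌢_ : C → C → Set)
  (≈-refl : ∀ {x} → x ≈ x) (≈-sym : ∀ {x y} → x ≈ y → y ≈ x)
  (≈-trans : ∀ {x y z} → x ≈ y → y ≈ z → x ≈ z) (_≈?_ : ∀ x y → Dec (x ≈ y))
  (_⌢?_ : ∀ x y → Dec (x ⌢ y)) (⌢-sym : ∀ {x y} → x ⌢ y → y ⌢ x) (⌢-irr : ∀ {x} → ¬ (x ⌢ x))
  (⌢-resp : ∀ {x y y′} → y ≈ y′ → x ⌢ y → x ⌢ y′)
  (xs : List C) (covers : Enumerates _≈_ xs) (x₀ : C) where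

  private
    at : Fin (List.length xs) → C
    at = List.lookup xs

    -- The first listed member of a class is its canonical representative, so distinct vertices of
    -- the component are inequivalent.
    IsFirst : Fin (List.length xs) → Set
    IsFirst i = ∀ j → j Fin.< i → ¬ (at j ≈ at i)

    isFirst? : ∀ i → Dec (IsFirst i)
    isFirst? i = Finₚ.all? λ j → →-dec′ (j Finₚ.<? i) (¬? (at j ≈? at i))
      where
      →-dec′ : {P Q : Set} → Dec P → Dec Q → Dec (P → Q)
      →-dec′ _ (yes q) = yes λ _ → q
      →-dec′ (no ¬p) (no _) = yes λ p → ⊥-elim (¬p p)
      →-dec′ (yes p) (no ¬q) = no λ f → ¬q (f p)

    module Q = Subset (subset IsFirst isFirst?)

    rep₁ : Fin Q.size → C
    rep₁ = at ∘ Q.emb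

    rep₁-inj : ∀ {i j} → rep₁ i ≈ rep₁ j → i ≡ j
    rep₁-inj {i} {j} e with Finₚ.<-cmp (Q.emb i) (Q.emb j)
    ... | tri< lt _ _ = ⊥-elim (Q.sound j _ lt e)
    ... | tri≈ _ eq _ = Q.inj eq
    ... | tri> _ _ gt = ⊥-elim (Q.sound i _ gt (≈-sym e))

    code₁ : ∀ x → Σ[ i ∈ Fin Q.size ] x ≈ rep₁ i
    code₁ x with leastFin (λ i → x ≈ at i) (λ i → x ≈? at i) (Any.index (covers x)) (Anyₚ.lookup-index (covers x))
    ... | j , x≈ , min with Q.index j (λ l l<j e → min l l<j (≈-trans x≈ (≈-sym e)))
    ...   | i , refl = i , x≈

    A : Fin Q.size → Fin Q.size → Set
    A i j = rep₁ i ⌢ rep₁ j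

    A? : ∀ i j → Dec (A i j)
    A? i j = rep₁ i ⌢? rep₁ j

    i₀ = proj₁ (code₁ x₀)
    module R = Subset (subset (Star A i₀) (Reachability.reach? A A? i₀))

  rep : Fin R.size → C
  rep = rep₁ ∘ R.emb

  rep-inj : ∀ {i j} → rep i ≈ rep j → i ≡ j
  rep-inj e = R.inj (rep₁-inj e)

  component : Graph
  component = record
    { size = R.size ; _~_ = λ i j → rep i ⌢ rep j ; _~?_ = λ i j → rep i ⌢? rep j
    ; ~-sym = ⌢-sym ; ~-irr = ⌢-irr }

  ~⇒⌢ : ∀ {i j} → Graph._~_ component i j → rep i ⌢ rep j
  ~⇒⌢ a = a

  ⌢⇒~ : ∀ {i j} → rep i ⌢ rep j → Graph._~_ component i j
  ⌢⇒~ a = a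

  root : Fin R.size
  root = proj₁ (R.index i₀ done)

  rep-root : rep root ≈ x₀
  rep-root = subst (λ i → rep₁ i ≈ x₀) (sym (proj₂ (R.index i₀ done))) (≈-sym (proj₂ (code₁ x₀)))

  neighbour : ∀ i {y} → rep i ⌢ y → Σ[ j ∈ Fin R.size ] rep j ≈ y
  neighbour i {y} i⌢y = let (j , y≈j) = code₁ y ; (j′ , e) = R.index j (R.sound i ◅◅ (⌢-resp y≈j i⌢y ◅ done)) in
    j′ , subst (λ k → rep₁ k ≈ y) (sym e) (≈-sym y≈j)

  private
    extend : ∀ {i j} i′ → R.emb i′ ≡ i → Star (Graph._~_ component) root i′ → Star A i j →
      ∀ j′ → R.emb j′ ≡ j → Star (Graph._~_ component) root j′
    extend i′ refl s done j′ e = subst (Star _ root) (sym (R.inj e)) s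
    extend i′ refl s (_◅_ {j = l} a as) j′ e = let (l′ , e′) = R.index l (R.sound i′ ◅◅ (a ◅ done)) in
      extend l′ e′ (s ◅◅ (subst (λ k → rep i′ ⌢ rep₁ k) (sym e′) a ◅ done)) as j′ e

  component-connected : Connected component
  component-connected u v = reverse⋆ (from-root u) ◅◅ from-root v
    where
    from-root : ∀ v → Star (Graph._~_ component) root v
    from-root v = extend root (proj₂ (R.index i₀ done)) done (R.sound v) v refl
    reverse⋆ : ∀ {u v} → Star (Graph._~_ component) u v → Star (Graph._~_ component) v u
    reverse⋆ done = done
    reverse⋆ (a ◅ s) = reverse⋆ s ◅◅ (⌢-sym a ◅ done)

-- Congruences

record Cong (q : ℕ) (x y : ℤ) : Set where
  constructor by
  field difference : + q ∣ᶻ x -ᶻ y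

open Cong

+ᶻ-cancelʳ : ∀ c {a b} → a +ᶻ c ≡ b +ᶻ c → a ≡ b
+ᶻ-cancelʳ c {a} {b} e = trans (solve 2 (λ a c → a := (a :+ c) :- c) refl a c)
  (trans (cong (_-ᶻ c) e) (solve 2 (λ b c → (b :+ c) :- c := b) refl b c))

module _ {q : ℕ} where
  cong-by : ∀ {x y d} → + q ∣ᶻ d → x -ᶻ y ≡ d → Cong q x y
  cong-by q∣d e = by (subst (+ q ∣ᶻ_) (sym e) q∣d)

  c-reflexive : ∀ {x y} → x ≡ y → Cong q x y
  c-reflexive {x} refl = by (divides (+ 0) (ℤₚ.+-inverseʳ x))

  c-refl : ∀ {x} → Cong q x x
  c-refl = c-reflexive refl

  c-sym : ∀ {x y} → Cong q x y → Cong q y x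
  c-sym {x} {y} e = cong-by (∣m⇒∣-m (difference e)) (solve 2 (λ x y → y :- x := :- (x :- y)) refl x y)

  c-trans : ∀ {x y z} → Cong q x y → Cong q y z → Cong q x z
  c-trans {x} {y} {z} e f = cong-by (∣m∣n⇒∣m+n (difference e) (difference f))
    (solve 3 (λ x y z → x :- z := (x :- y) :+ (y :- z)) refl x y z)

  c-+ : ∀ {x y x′ y′} → Cong q x y → Cong q x′ y′ → Cong q (x +ᶻ x′) (y +ᶻ y′)
  c-+ {x} {y} {x′} {y′} e f = cong-by (∣m∣n⇒∣m+n (difference e) (difference f))
    (solve 4 (λ x y x′ y′ → (x :+ x′) :- (y :+ y′) := (x :- y) :+ (x′ :- y′)) refl x y x′ y′)

  c-neg : ∀ {x y} → Cong q x y → Cong q (neg x) (neg y)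
  c-neg {x} {y} e = cong-by (∣m⇒∣-m (difference e)) (solve 2 (λ x y → :- x :- :- y := :- (x :- y)) refl x y)

  c-- : ∀ {x y x′ y′} → Cong q x y → Cong q x′ y′ → Cong q (x -ᶻ x′) (y -ᶻ y′)
  c-- e f = c-+ e (c-neg f)

  c-+ˡ : ∀ x {y y′} → Cong q y y′ → Cong q (x +ᶻ y) (x +ᶻ y′)
  c-+ˡ x = c-+ (c-refl {x})

  c-+ʳ : ∀ x {y y′} → Cong q y y′ → Cong q (y +ᶻ x) (y′ +ᶻ x)
  c-+ʳ x e = c-+ e (c-refl {x})

  c-move : ∀ x y {d} → Cong q (x -ᶻ y) d → Cong q x (y +ᶻ d)
  c-move x y e = c-trans (c-reflexive (solve 2 (λ x y → x := y :+ (x :- y)) refl x y)) (c-+ˡ y e)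

  c-unmove : ∀ x y {d} → Cong q x (y +ᶻ d) → Cong q (x -ᶻ y) d
  c-unmove x y {d} e = c-trans (c-+ʳ (neg y) e) (c-reflexive (solve 2 (λ y d → (y :+ d) :- y := d) refl y d))

  c-*ˡ : ∀ k {x y} → Cong q x y → Cong q (k *ᶻ x) (k *ᶻ y)
  c-*ˡ k {x} {y} e = cong-by (∣n⇒∣m*n k (difference e)) (solve 3 (λ k x y → k :* x :- k :* y := k :* (x :- y)) refl k x y)

  c-multiple : ∀ k → Cong q (+ q *ᶻ k) (+ 0)
  c-multiple k = by (divides k (solve 2 (λ q k → q :* k :- con (+ 0) := k :* q) refl (+ q) k))

  -- This is the passage from heights modulo `q` back to integers: a nonzero multiple of `q` has
  -- size at least `q`.
  c-small : ∀ {x y} → Cong q x y → ∣ x -ᶻ y ∣ < q → x ≡ y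
  c-small {x} {y} (by e) lt with x -ᶻ y in eq
  ... | + zero = ℤₚ.i-j≡0⇒i≡j x y eq
  ... | + suc n = ⊥-elim (ℕₚ.<⇒≱ lt (ℕᵈ.∣⇒≤ (∣⇒∣ᵤ e)))
  ... | -[1+ n ] = ⊥-elim (ℕₚ.<⇒≱ lt (ℕᵈ.∣⇒≤ (∣⇒∣ᵤ e)))

  c? : ∀ x y → Dec (Cong q x y)
  c? x y = map′ by difference (+ q ∣ᶻ? x -ᶻ y)

-- Modulo 1 + M! all integers of absolute value 1, …, M are invertible.

big : ℕ → ℕ
big M = suc (M !)

cofactor : ∀ M s → 1 ≤ ∣ s ∣ → ∣ s ∣ ≤ M → Σ[ c ∈ ℤ ] + (M !) ≡ c *ᶻ s
cofactor M s 1≤s s≤M with ∣ᵤ⇒∣ {s} {+ (M !)} (∣! ∣ s ∣ 1≤s s≤M)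
  where
  ∣! : ∀ m → 1 ≤ m → m ≤ M → m ∣ M !
  ∣! (suc n) _ m≤M = ℕᵈ.∣-trans (ℕᵈ.m∣m*n (n !)) (ℕᵈ.m≤n⇒m!∣n! m≤M)
... | divides c e = c , e

-- With M! = c s one has x = (1 + M!) x - c (s x), so -c inverts s.
big-cancel : ∀ M s {x} → 1 ≤ ∣ s ∣ → ∣ s ∣ ≤ M → Cong (big M) (s *ᶻ x) (+ 0) → Cong (big M) x (+ 0)
big-cancel M s {x} 1≤s s≤M d with cofactor M s 1≤s s≤M
... | c , e = cong-by (∣m∣n⇒∣m-n (difference (c-multiple {big M} x)) (∣n⇒∣m*n c (difference d)))
  (trans (solve 2 (λ x m → x :- con (+ 0) := ((con (+ 1) :+ m) :* x :- con (+ 0)) :- m :* x) refl x (+ (M !)))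
  (trans (cong (λ m → ((+ big M) *ᶻ x -ᶻ + 0) -ᶻ m *ᶻ x) e)
    (solve 4 (λ x c s q → (q :* x :- con (+ 0)) :- (c :* s) :* x := (q :* x :- con (+ 0)) :- c :* (s :* x :- con (+ 0))) refl x c s (+ big M))))

natural-residue : ∀ q .{{_ : NonZero q}} l → Σ[ N ∈ ℕ ] Cong q (+ N) l
natural-residue q l = l ℤᵈ.%ℕ q , c-sym (by (divides (l ℤᵈ./ℕ q)
  (trans (cong (_-ᶻ + (l ℤᵈ.%ℕ q)) (ℤᵈ.a≡a%ℕn+[a/ℕn]*n l q))
    (solve 2 (λ a b → (a :+ b) :- a := b) refl (+ (l ℤᵈ.%ℕ q)) ((l ℤᵈ./ℕ q) *ᶻ + q)))))

big-solve : ∀ M s l → 1 ≤ ∣ s ∣ → ∣ s ∣ ≤ M → Σ[ N ∈ ℕ ] Cong (big M) (+ N *ᶻ s) l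
big-solve M s l 1≤s s≤M with cofactor M s 1≤s s≤M
... | c , e with natural-residue (big M) (neg (l *ᶻ c))
...   | N , N≡ = N , c-trans
  (cong-by (∣n⇒∣m*n s (difference N≡)) (solve 3 (λ n s d → n :* s :- d :* s := s :* (n :- d)) refl (+ N) s (neg (l *ᶻ c))))
  (by (divides (neg l)
    (trans (solve 3 (λ l c s → :- (l :* c) :* s :- l := :- l :* (con (+ 1) :+ c :* s)) refl l c s)
      (cong (λ m → neg l *ᶻ (+ 1 +ᶻ m)) (sym e)))))

-- For M ≥ 3 the modulus 1 + M! is 1 modulo 3, hence invertible for the memories of the relations.
big-cancel-3 : ∀ M {x} → 3 ≤ M → Cong 3 (+ big M *ᶻ x) (+ 0) → Cong 3 x (+ 0)
big-cancel-3 M {x} 3≤M d with cofactor M (+ 3) (s≤s z≤n) 3≤M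
... | c , e = cong-by (∣m∣n⇒∣m-n (difference d) (divides (c *ᶻ x) refl))
  (trans (solve 2 (λ x m → x :- con (+ 0) := ((con (+ 1) :+ m) :* x :- con (+ 0)) :- m :* x) refl x (+ (M !)))
  (cong (λ y → (+ big M *ᶻ x -ᶻ + 0) -ᶻ y) (trans (cong (_*ᶻ x) e) (solve 3 (λ c x t → (c :* t) :* x := (c :* x) :* t) refl c x (+ 3)))))

big-> : ∀ M → M < big M
big-> M = s≤s (n≤n! M)
  where
  n≤n! : ∀ n → n ≤ n !
  n≤n! zero = z≤n
  n≤n! (suc n) = ℕₚ.m≤m*n (suc n) (n !) {{ℕ.>-nonZero (ℕₚ.1≤n! n)}}

-- Sums over an initial segment of ℕ

Sum : ℕ → (ℕ → ℤ) → ℤ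
Sum zero f = + 0
Sum (suc n) f = Sum n f +ᶻ f n

Sum-cong : ∀ n {f g} → (∀ i → i < n → f i ≡ g i) → Sum n f ≡ Sum n g
Sum-cong zero e = refl
Sum-cong (suc n) e = cong₂ _+ᶻ_ (Sum-cong n λ i i<n → e i (ℕₚ.m≤n⇒m≤1+n i<n)) (e n ℕₚ.≤-refl)

Sum-++ : ∀ m n f → Sum (m + n) f ≡ Sum m f +ᶻ Sum n (λ i → f (m + i))
Sum-++ m zero f = trans (cong (λ k → Sum k f) (ℕₚ.+-identityʳ m)) (sym (ℤₚ.+-identityʳ _))
Sum-++ m (suc n) f = trans (cong (λ k → Sum k f) (ℕₚ.+-suc m n))
  (trans (cong (_+ᶻ f (m + n)) (Sum-++ m n f)) (ℤₚ.+-assoc (Sum m f) _ _))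

Sum-one : ∀ n → Sum n (λ _ → + 1) ≡ + n
Sum-one zero = refl
Sum-one (suc n) = trans (cong (_+ᶻ + 1) (Sum-one n)) (cong +_ (ℕₚ.+-comm n 1))

Sum-zero : ∀ n {f} → (∀ i → i < n → f i ≡ + 0) → Sum n f ≡ + 0
Sum-zero zero e = refl
Sum-zero (suc n) e = cong₂ _+ᶻ_ (Sum-zero n λ i i<n → e i (ℕₚ.m≤n⇒m≤1+n i<n)) (e n ℕₚ.≤-refl)

Sum-bound : ∀ n f B → (∀ i → ∣ f i ∣ ≤ B) → ∣ Sum n f ∣ ≤ n * B
Sum-bound zero f B b = z≤n
Sum-bound (suc n) f B b = ℕₚ.≤-trans (ℤₚ.∣i+j∣≤∣i∣+∣j∣ (Sum n f) (f n))
  (subst (_≤ B + n * B) (ℕₚ.+-comm ∣ f n ∣ ∣ Sum n f ∣) (ℕₚ.+-mono-≤ (b n) (Sum-bound n f B b)))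

Sum-rotate : ∀ k f → (∀ i → f (i + k) ≡ f i) → ∀ s → Sum k (λ i → f (s + i)) ≡ Sum k f
Sum-rotate k f per zero = refl
Sum-rotate k f per (suc s) = trans (step f per s) (Sum-rotate k f per s)
  where
  shift : ∀ k g → Sum k (g ∘ suc) +ᶻ g 0 ≡ Sum (suc k) g
  shift zero g = refl
  shift (suc k) g = trans (solve 3 (λ a b c → (a :+ b) :+ c := (a :+ c) :+ b) refl (Sum k (g ∘ suc)) (g (suc k)) (g 0))
    (cong (_+ᶻ g (suc k)) (shift k g))
  step : ∀ f → (∀ i → f (i + k) ≡ f i) → ∀ s → Sum k (λ i → f (suc s + i)) ≡ Sum k (λ i → f (s + i))
  step f per s = +ᶻ-cancelʳ (f (s + 0))
    (trans (cong (_+ᶻ f (s + 0)) (Sum-cong k λ i _ → cong f (sym (ℕₚ.+-suc s i))))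
    (trans (shift k (λ i → f (s + i))) (cong (Sum k (λ i → f (s + i)) +ᶻ_) (trans (per s) (cong f (sym (ℕₚ.+-identityʳ s)))))))

Sum-periods : ∀ k f → (∀ i → f (i + k) ≡ f i) → ∀ a → Sum (a * k) f ≡ + a *ᶻ Sum k f
Sum-periods k f per zero = sym (ℤₚ.*-zeroˡ (Sum k f))
Sum-periods k f per (suc a) = trans (Sum-++ k (a * k) f)
  (trans (cong (Sum k f +ᶻ_) (trans (Sum-cong (a * k) λ i _ → trans (cong f (ℕₚ.+-comm k i)) (per i)) (Sum-periods k f per a)))
  (trans (solve 2 (λ a s → s :+ a :* s := (con (+ 1) :+ a) :* s) refl (+ a) (Sum k f)) refl))

-- Sums over Fin and the pairing of matrices

∑ : ∀ {n} → (Fin n → ℤ) → ℤ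
∑ {zero} f = + 0
∑ {suc n} f = f zero +ᶻ ∑ (f ∘ suc)

∑-cong : ∀ {n} {f g : Fin n → ℤ} → (∀ i → f i ≡ g i) → ∑ f ≡ ∑ g
∑-cong {zero} e = refl
∑-cong {suc n} e = cong₂ _+ᶻ_ (e zero) (∑-cong (e ∘ suc))

∑-zero : ∀ {n} {f : Fin n → ℤ} → (∀ i → f i ≡ + 0) → ∑ f ≡ + 0
∑-zero {zero} e = refl
∑-zero {suc n} e = cong₂ _+ᶻ_ (e zero) (∑-zero (e ∘ suc))

∑-+ : ∀ {n} (f g : Fin n → ℤ) → ∑ (λ i → f i +ᶻ g i) ≡ ∑ f +ᶻ ∑ g
∑-+ {zero} f g = refl
∑-+ {suc n} f g = trans (cong (f zero +ᶻ g zero +ᶻ_) (∑-+ (f ∘ suc) (g ∘ suc)))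
  (solve 4 (λ a b c d → (a :+ b) :+ (c :+ d) := (a :+ c) :+ (b :+ d)) refl (f zero) (g zero) (∑ (f ∘ suc)) (∑ (g ∘ suc)))

∑-* : ∀ {n} k (f : Fin n → ℤ) → ∑ (λ i → k *ᶻ f i) ≡ k *ᶻ ∑ f
∑-* {zero} k f = sym (ℤₚ.*-zeroʳ k)
∑-* {suc n} k f = trans (cong (k *ᶻ f zero +ᶻ_) (∑-* k (f ∘ suc))) (sym (ℤₚ.*-distribˡ-+ k (f zero) _))

∑-mod : ∀ {n q} {f g : Fin n → ℤ} → (∀ i → Cong q (f i) (g i)) → Cong q (∑ f) (∑ g)
∑-mod {zero} e = c-refl
∑-mod {suc n} {q} e = c-+ (e zero) (∑-mod {n} {q} (e ∘ suc))

ι : {P : Set} → Dec P → ℤ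
ι (yes _) = + 1
ι (no _) = + 0

ι-yes : {P : Set} (d : Dec P) → P → ι d ≡ + 1
ι-yes (yes _) p = refl
ι-yes (no ¬p) p = ⊥-elim (¬p p)

ι-no : {P : Set} (d : Dec P) → ¬ P → ι d ≡ + 0
ι-no (yes p) ¬p = ⊥-elim (¬p p)
ι-no (no _) ¬p = refl

ι-⇔ : {P Q : Set} (d : Dec P) (e : Dec Q) → (P → Q) → (Q → P) → ι d ≡ ι e
ι-⇔ (yes p) e f g = sym (ι-yes e (f p))
ι-⇔ (no ¬p) e f g = sym (ι-no e (¬p ∘ g))

∑-δ : ∀ {n} (u : Fin n) (f : Fin n → ℤ) → ∑ (λ i → f i *ᶻ ι (u Finₚ.≟ i)) ≡ f u
∑-δ zero f = trans (cong₂ _+ᶻ_ (ℤₚ.*-identityʳ (f zero)) (∑-zero λ i → ℤₚ.*-zeroʳ (f (suc i)))) (ℤₚ.+-identityʳ (f zero))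
∑-δ (suc u) f = trans (cong₂ _+ᶻ_ (ℤₚ.*-zeroʳ (f zero))
    (trans (∑-cong λ i → cong (f (suc i) *ᶻ_) (ι-⇔ (suc u Finₚ.≟ suc i) (u Finₚ.≟ i) Finₚ.suc-injective (cong suc))) (∑-δ u (f ∘ suc))))
  (ℤₚ.+-identityˡ (f (suc u)))

Matrix : ℕ → Set
Matrix n = Fin n → Fin n → ℤ

⟪_,_⟫ : ∀ {n} → Matrix n → Matrix n → ℤ
⟪ w , x ⟫ = ∑ λ a → ∑ λ b → w a b *ᶻ x a b

⟪⟫-cong : ∀ {n} (w : Matrix n) {x y} → (∀ a b → x a b ≡ y a b) → ⟪ w , x ⟫ ≡ ⟪ w , y ⟫
⟪⟫-cong w e = ∑-cong λ a → ∑-cong λ b → cong (w a b *ᶻ_) (e a b)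

⟪⟫-+ : ∀ {n} (w x y : Matrix n) → ⟪ w , (λ a b → x a b +ᶻ y a b) ⟫ ≡ ⟪ w , x ⟫ +ᶻ ⟪ w , y ⟫
⟪⟫-+ w x y = trans
  (∑-cong λ a → trans (∑-cong λ b → ℤₚ.*-distribˡ-+ (w a b) (x a b) (y a b)) (∑-+ (λ b → w a b *ᶻ x a b) (λ b → w a b *ᶻ y a b)))
  (∑-+ (λ a → ∑ λ b → w a b *ᶻ x a b) (λ a → ∑ λ b → w a b *ᶻ y a b))

⟪⟫-* : ∀ {n} k (w x : Matrix n) → ⟪ w , (λ a b → k *ᶻ x a b) ⟫ ≡ k *ᶻ ⟪ w , x ⟫
⟪⟫-* k w x = trans
  (∑-cong λ a → trans (∑-cong λ b → solve 3 (λ w k x → w :* (k :* x) := k :* (w :* x)) refl (w a b) k (x a b)) (∑-* k (λ b → w a b *ᶻ x a b)))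
  (∑-* k (λ a → ∑ λ b → w a b *ᶻ x a b))

⟪⟫-- : ∀ {n} (w x y : Matrix n) → ⟪ w , (λ a b → x a b -ᶻ y a b) ⟫ ≡ ⟪ w , x ⟫ -ᶻ ⟪ w , y ⟫
⟪⟫-- w x y = trans (⟪⟫-cong w λ a b → cong (x a b +ᶻ_) (sym (ℤₚ.-1*i≡-i (y a b))))
  (trans (⟪⟫-+ w x (λ a b → ℤ.-1ℤ *ᶻ y a b))
    (cong (⟪ w , x ⟫ +ᶻ_) (trans (⟪⟫-* ℤ.-1ℤ w y) (ℤₚ.-1*i≡-i _))))

⟪⟫-mod : ∀ {n q} (w : Matrix n) {x y} → (∀ a b → Cong q (x a b) (y a b)) → Cong q ⟪ w , x ⟫ ⟪ w , y ⟫
⟪⟫-mod {n} {q} w e = ∑-mod {n} {q} λ a → ∑-mod {n} {q} λ b → c-*ˡ (w a b) (e a b)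

-- One traversal of the edge from `u` to `v` as an antisymmetric matrix. Pairings with it see only
-- the antisymmetric part of a weight.
dart : ∀ {n} → Fin n → Fin n → Matrix n
dart u v a b = ι (u Finₚ.≟ a) *ᶻ ι (v Finₚ.≟ b) -ᶻ ι (v Finₚ.≟ a) *ᶻ ι (u Finₚ.≟ b)

⟪⟫-dart : ∀ {n} (w : Matrix n) u v → ⟪ w , dart u v ⟫ ≡ w u v -ᶻ w v u
⟪⟫-dart w u v = trans (⟪⟫-- w (δ u v) (δ v u)) (cong₂ _-ᶻ_ (single u v) (single v u))
  where
  δ = λ u v a b → ι (u Finₚ.≟ a) *ᶻ ι (v Finₚ.≟ b)
  single : ∀ u v → ⟪ w , δ u v ⟫ ≡ w u v
  single u v = trans
    (∑-cong λ a → trans (∑-cong λ b → solve 3 (λ w x y → w :* (x :* y) := x :* (w :* y)) refl (w a b) (ι (u Finₚ.≟ a)) (ι (v Finₚ.≟ b)))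
      (trans (∑-* (ι (u Finₚ.≟ a)) (λ b → w a b *ᶻ ι (v Finₚ.≟ b)))
        (trans (cong (ι (u Finₚ.≟ a) *ᶻ_) (∑-δ v (w a))) (ℤₚ.*-comm (ι (u Finₚ.≟ a)) (w a v)))))
    (∑-δ u (λ a → w a v))

∣ι*ι∣≤1 : {P Q P′ Q′ : Set} (a : Dec P) (b : Dec Q) (c : Dec P′) (d : Dec Q′) → ∣ ι a *ᶻ ι b -ᶻ ι c *ᶻ ι d ∣ ≤ 1
∣ι*ι∣≤1 (yes _) (yes _) (yes _) (yes _) = z≤n
∣ι*ι∣≤1 (yes _) (yes _) (yes _) (no _) = s≤s z≤n
∣ι*ι∣≤1 (yes _) (yes _) (no _) (yes _) = s≤s z≤n
∣ι*ι∣≤1 (yes _) (yes _) (no _) (no _) = s≤s z≤n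
∣ι*ι∣≤1 (yes _) (no _) (yes _) (yes _) = s≤s z≤n
∣ι*ι∣≤1 (yes _) (no _) (yes _) (no _) = z≤n
∣ι*ι∣≤1 (yes _) (no _) (no _) (yes _) = z≤n
∣ι*ι∣≤1 (yes _) (no _) (no _) (no _) = z≤n
∣ι*ι∣≤1 (no _) (yes _) (yes _) (yes _) = s≤s z≤n
∣ι*ι∣≤1 (no _) (yes _) (yes _) (no _) = z≤n
∣ι*ι∣≤1 (no _) (yes _) (no _) (yes _) = z≤n
∣ι*ι∣≤1 (no _) (yes _) (no _) (no _) = z≤n
∣ι*ι∣≤1 (no _) (no _) (yes _) (yes _) = s≤s z≤n
∣ι*ι∣≤1 (no _) (no _) (yes _) (no _) = z≤n
∣ι*ι∣≤1 (no _) (no _) (no _) (yes _) = z≤n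
∣ι*ι∣≤1 (no _) (no _) (no _) (no _) = z≤n

∣dart∣≤1 : ∀ {n} (u v a b : Fin n) → ∣ dart u v a b ∣ ≤ 1
∣dart∣≤1 u v a b = ∣ι*ι∣≤1 (u Finₚ.≟ a) (v Finₚ.≟ b) (v Finₚ.≟ a) (u Finₚ.≟ b)

-- Digit weights

∣i-j∣≤ : ∀ i j → ∣ i -ᶻ j ∣ ≤ ∣ i ∣ + ∣ j ∣
∣i-j∣≤ i j = subst (λ m → ∣ i -ᶻ j ∣ ≤ ∣ i ∣ + m) (ℤₚ.∣-i∣≡∣i∣ j) (ℤₚ.∣i+j∣≤∣i∣+∣j∣ i (neg j))

∑-bound : ∀ {n} (w : Fin n → ℤ) h → Σ[ S ∈ ℕ ] (∀ (x : Fin n → ℤ) → (∀ i → ∣ x i ∣ ≤ h) → ∣ ∑ (λ i → w i *ᶻ x i) ∣ ≤ S)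
∑-bound {zero} w h = 0 , λ _ _ → z≤n
∑-bound {suc n} w h with ∑-bound (w ∘ suc) h
... | S , b = ∣ w zero ∣ * h + S , λ x hx → ℕₚ.≤-trans (ℤₚ.∣i+j∣≤∣i∣+∣j∣ (w zero *ᶻ x zero) _)
  (ℕₚ.+-mono-≤ (subst (_≤ ∣ w zero ∣ * h) (sym (ℤₚ.abs-* (w zero) (x zero))) (ℕₚ.*-monoʳ-≤ ∣ w zero ∣ (hx zero))) (b (x ∘ suc) (hx ∘ suc)))

-- Balanced digits: the weights are powers of 2h + 1, and two digits of size at most h that agree
-- modulo this base are equal.
digits : ∀ n h → Σ[ w ∈ (Fin n → ℤ) ] (∀ (x y : Fin n → ℤ) → (∀ i → ∣ x i ∣ ≤ h) → (∀ i → ∣ y i ∣ ≤ h) →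
  ∑ (λ i → w i *ᶻ x i) ≡ ∑ (λ i → w i *ᶻ y i) → ∀ i → x i ≡ y i)
digits zero h = (λ ()) , λ _ _ _ _ _ ()
digits (suc n) h with digits n h
... | w , sep = w′ , sep′
  where
  b = suc (h + h)
  w′ : Fin (suc n) → ℤ
  w′ zero = + 1
  w′ (suc i) = + b *ᶻ w i
  expand : ∀ x → ∑ (λ i → w′ i *ᶻ x i) ≡ x zero +ᶻ + b *ᶻ ∑ (λ i → w i *ᶻ x (suc i))
  expand x = cong₂ _+ᶻ_ (ℤₚ.*-identityˡ (x zero))
    (trans (∑-cong λ i → ℤₚ.*-assoc (+ b) (w i) (x (suc i))) (∑-* (+ b) (λ i → w i *ᶻ x (suc i))))
  sep′ : ∀ x y → (∀ i → ∣ x i ∣ ≤ h) → (∀ i → ∣ y i ∣ ≤ h) →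
    ∑ (λ i → w′ i *ᶻ x i) ≡ ∑ (λ i → w′ i *ᶻ y i) → ∀ i → x i ≡ y i
  sep′ x y hx hy e = λ { zero → head ; (suc i) → sep (x ∘ suc) (y ∘ suc) (hx ∘ suc) (hy ∘ suc) tail i }
    where
    X = ∑ (λ i → w i *ᶻ x (suc i))
    Y = ∑ (λ i → w i *ᶻ y (suc i))
    e′ : x zero +ᶻ + b *ᶻ X ≡ y zero +ᶻ + b *ᶻ Y
    e′ = trans (sym (expand x)) (trans e (expand y))
    head : x zero ≡ y zero
    head = c-small {b} (by (divides (Y -ᶻ X)
      (trans (solve 4 (λ x y s b → x :- y := (x :+ b :* s) :- y :- b :* s) refl (x zero) (y zero) X (+ b))
      (trans (cong (λ l → l -ᶻ y zero -ᶻ + b *ᶻ X) e′)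
        (solve 4 (λ y s t b → (y :+ b :* t) :- y :- b :* s := (t :- s) :* b) refl (y zero) X Y (+ b))))))
      (s≤s (ℕₚ.≤-trans (∣i-j∣≤ (x zero) (y zero)) (ℕₚ.+-mono-≤ (hx zero) (hy zero))))
    tail : X ≡ Y
    tail = ℤₚ.*-cancelˡ-≡ (+ b) X Y (+ᶻ-cancelʳ (y zero) (trans (ℤₚ.+-comm (+ b *ᶻ X) (y zero)) (trans (cong (_+ᶻ + b *ᶻ X) (sym head)) (trans e′ (ℤₚ.+-comm (y zero) (+ b *ᶻ Y))))))

-- Each row is compressed to one integer; the bound on these integers then fixes the base in which
-- the rows are combined.
matrix-digits : ∀ n h → Σ[ w ∈ Matrix n ] Σ[ S ∈ ℕ ]
  (∀ (x : Matrix n) → (∀ a b → ∣ x a b ∣ ≤ h) → ∣ ⟪ w , x ⟫ ∣ ≤ S) ×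
  (∀ (x y : Matrix n) → (∀ a b → ∣ x a b ∣ ≤ h) → (∀ a b → ∣ y a b ∣ ≤ h) → ⟪ w , x ⟫ ≡ ⟪ w , y ⟫ → ∀ a b → x a b ≡ y a b)
matrix-digits n h = w , proj₁ outer , bound , sep
  where
  v = proj₁ (digits n h)
  inner = ∑-bound v h
  u = proj₁ (digits n (proj₁ inner))
  outer = ∑-bound u (proj₁ inner)
  w : Matrix n
  w a b = u a *ᶻ v b
  row : Matrix n → Fin n → ℤ
  row x a = ∑ λ b → v b *ᶻ x a b
  expand : ∀ x → ⟪ w , x ⟫ ≡ ∑ (λ a → u a *ᶻ row x a)
  expand x = ∑-cong λ a → trans (∑-cong λ b → ℤₚ.*-assoc (u a) (v b) (x a b)) (∑-* (u a) (λ b → v b *ᶻ x a b))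
  bound : ∀ x → (∀ a b → ∣ x a b ∣ ≤ h) → ∣ ⟪ w , x ⟫ ∣ ≤ proj₁ outer
  bound x hx = subst (λ z → ∣ z ∣ ≤ proj₁ outer) (sym (expand x)) (proj₂ outer (row x) λ a → proj₂ inner (x a) (hx a))
  sep : ∀ x y → (∀ a b → ∣ x a b ∣ ≤ h) → (∀ a b → ∣ y a b ∣ ≤ h) → ⟪ w , x ⟫ ≡ ⟪ w , y ⟫ → ∀ a b → x a b ≡ y a b
  sep x y hx hy e a = proj₂ (digits n h) (x a) (y a) (hx a) (hy a)
    (proj₂ (digits n (proj₁ inner)) (row x) (row y) (λ a → proj₂ inner (x a) (hx a)) (λ a → proj₂ inner (y a) (hy a))
      (trans (sym (expand x)) (trans e (expand y))) a)

-- The ratio of neighbouring terms is constant, so a change in the first step forces a change of at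
-- least 1 in the same direction in every step. The terms would become unbounded or drop below 1.
geometric : (A : ℕ → ℕ) (S : ℕ) → (∀ j → 1 ≤ A j) → (∀ j → A j ≤ S) →
  (∀ j → A j * A (suc (suc j)) ≡ A (suc j) * A (suc j)) → A 0 ≡ A 1
geometric A S pos bnd geo with ℕₚ.<-cmp (A 0) (A 1)
... | tri≈ _ e _ = e
... | tri< lt _ _ = ⊥-elim (ℕₚ.<⇒≱ (ℕₚ.≤-trans (s≤s (bnd (suc S))) (ℕₚ.n≤1+n (suc S))) (grow (suc S)))
  where
  up : ∀ j → A j < A (suc j)
  up zero = lt
  up (suc j) = ℕₚ.*-cancelˡ-< (A j) _ _ (subst (A j * A (suc j) <_) (sym (geo j)) (ℕₚ.*-monoˡ-< (A (suc j)) {{ℕ.>-nonZero (pos (suc j))}} (up j)))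
  grow : ∀ j → suc j ≤ A j
  grow zero = pos 0
  grow (suc j) = ℕₚ.≤-trans (s≤s (grow j)) (up j)
... | tri> _ _ gt = ⊥-elim (ℕₚ.1+n≰n (ℕₚ.≤-trans (ℕₚ.+-monoˡ-≤ (A 0) (pos (A 0))) (total (A 0))))
  where
  down : ∀ j → A (suc j) < A j
  down zero = gt
  down (suc j) = ℕₚ.*-cancelˡ-< (A j) _ _ (subst (_< A j * A (suc j)) (sym (geo j)) (ℕₚ.*-monoˡ-< (A (suc j)) {{ℕ.>-nonZero (pos (suc j))}} (down j)))
  total : ∀ j → A j + j ≤ A 0
  total zero = ℕₚ.≤-reflexive (ℕₚ.+-identityʳ (A 0))
  total (suc j) = ℕₚ.≤-trans (ℕₚ.≤-reflexive (ℕₚ.+-suc (A (suc j)) j)) (ℕₚ.≤-trans (ℕₚ.+-monoˡ-≤ j (down j)) (total j))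

-- Walks and cycles

data Path (Γ : Graph) : ℕ → Graph.Vertex Γ → Graph.Vertex Γ → Set where
  stop : ∀ {u} → Path Γ 0 u u
  _∷_  : ∀ {n u v w} → Graph._~_ Γ u v → Path Γ n v w → Path Γ (suc n) u w

module _ {Γ : Graph} where
  open Graph Γ

  _+++_ : ∀ {m n u v w} → Path Γ m u v → Path Γ n v w → Path Γ (m + n) u w
  stop +++ q = q
  (a ∷ p) +++ q = a ∷ (p +++ q)

  reverse-path : ∀ {n u v} → Path Γ n u v → Path Γ n v u
  reverse-path {n} {u} {v} p = subst (λ n → Path Γ n v u) (ℕₚ.+-identityʳ n) (go p stop)
    where
    go : ∀ {m n u v w} → Path Γ m u v → Path Γ n u w → Path Γ (m + n) v w
    go stop acc = acc
    go {suc m} {n} {v = v} {w} (a ∷ p) acc = subst (λ l → Path Γ l v w) (ℕₚ.+-suc m n) (go p (~-sym a ∷ acc))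

  map-path : (α : Automorphism Γ) → ∀ {n u v} → Path Γ n u v → Path Γ n (_^^_ Γ u α) (_^^_ Γ v α)
  map-path α stop = stop
  map-path α (a ∷ p) = Equivalence.to (Automorphism.preserve α _ _) a ∷ map-path α p

  star-path : ∀ {u v} → Star _~_ u v → Σ[ n ∈ ℕ ] Path Γ n u v
  star-path done = 0 , stop
  star-path (a ◅ s) = suc (proj₁ (star-path s)) , a ∷ proj₂ (star-path s)

  bounded-paths : Connected Γ → Σ[ D ∈ ℕ ] (∀ u v → Σ[ n ∈ ℕ ] n ≤ D × Path Γ n u v)
  bounded-paths conn = proj₁ outer , λ u v → _ ,
      ℕₚ.≤-trans (proj₂ (inner u) v) (proj₂ outer u) , proj₂ (star-path (conn u v))
    where
    inner = λ u → upperBound (λ v → proj₁ (star-path (conn u v)))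
    outer = upperBound (λ u → proj₁ (inner u))

module _ (Γ : Graph) where
  open Graph Γ

  -- A simple closed walk of length suc κ, run through periodically.
  record Cycle (κ : ℕ) : Set where
    field
      at    : ℕ → Vertex
      adj   : ∀ i → at i ~ at (suc i)
      per   : ∀ i → at (i + suc κ) ≡ at i
      det   : ∀ {i j} → at i ≡ at j → at (suc i) ≡ at (suc j)
      norev : ∀ {i j} → at i ≡ at (suc j) → ¬ at (suc i) ≡ at j
      inj   : ∀ {i j} → i < suc κ → j < suc κ → at i ≡ at j → i ≡ j

    per* : ∀ a i → at (i + a * suc κ) ≡ at i
    per* zero i = cong at (ℕₚ.+-identityʳ i)
    per* (suc a) i = trans (cong at (trans (cong (ℕ._+_ i) (ℕₚ.+-comm (suc κ) (a * suc κ))) (sym (ℕₚ.+-assoc i _ _)))) (trans (per (i + a * suc κ)) (per* a i))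

    reduce : ∀ i → Σ[ j ∈ Fin (suc κ) ] at (toℕ j) ≡ at i
    reduce i = fromℕ< (ℕᵐ.m%n<n i (suc κ)) , trans (cong at (Finₚ.toℕ-fromℕ< _))
      (trans (sym (per* (i ℕᵐ./ suc κ) (i ℕᵐ.% suc κ))) (cong at (sym (ℕᵐ.m≡m%n+[m/n]*n i (suc κ)))))

  Avoids : ∀ {κ} → Cycle κ → Vertex → Vertex → Set
  Avoids c u v = ∀ i → ¬ (at i ≡ u × at (suc i) ≡ v) × ¬ (at i ≡ v × at (suc i) ≡ u)
    where open Cycle c

  -- The two avoided edges are those of `c` at `v`, so `c′` passes through `v` along other edges.
  -- This local condition is what the bottom graph offers; `separating` derives the global one from
  -- it, in a cover.
  Crossing : ℕ → Set
  Crossing κ = ∀ v → Σ[ c ∈ Cycle κ ] Σ[ c′ ∈ Cycle κ ] Cycle.at c 0 ≡ v × Cycle.at c′ 0 ≡ v ×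
    Avoids c′ (Cycle.at c 0) (Cycle.at c 1) × Avoids c′ (Cycle.at c κ) (Cycle.at c 0)

  Separating : ℕ → Set
  Separating κ = ∀ v w → v ≢ w → Σ[ c ∈ Cycle κ ] Cycle.at c 0 ≡ v × (∀ i → Cycle.at c i ≢ w)

  ^^-inj : ∀ (α : Automorphism Γ) {u v} → _^^_ Γ u α ≡ _^^_ Γ v α → u ≡ v
  ^^-inj α e = trans (sym (Perm.inverseˡ (Automorphism.perm α))) (trans (cong (Automorphism.perm α ⟨$⟩ˡ_) e) (Perm.inverseˡ (Automorphism.perm α)))

  map-cycle : ∀ {κ} → Automorphism Γ → Cycle κ → Cycle κ
  map-cycle α c = record
    { at = λ i → _^^_ Γ (at i) α
    ; adj = λ i → Equivalence.to (Automorphism.preserve α _ _) (adj i)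
    ; per = λ i → cong (λ v → _^^_ Γ v α) (per i)
    ; det = λ e → cong (λ v → _^^_ Γ v α) (det (^^-inj α e))
    ; norev = λ e f → norev (^^-inj α e) (^^-inj α f)
    ; inj = λ i< j< e → inj i< j< (^^-inj α e) }
    where open Cycle c

  automorphism : (f g : Vertex → Vertex) → (∀ v → g (f v) ≡ v) → (∀ v → f (g v) ≡ v) →
    (∀ {u v} → u ~ v → f u ~ f v) → (∀ {u v} → u ~ v → g u ~ g v) → Automorphism Γ
  automorphism f g gf fg f~ g~ = record
    { perm = Perm.permutation f g fg gf
    ; preserve = λ u v → mk⇔ f~ (λ e → subst₂ _~_ (gf u) (gf v) (g~ e)) }

residues : ∀ q .{{_ : NonZero q}} → Σ[ xs ∈ List ℤ ] Enumerates (Cong q) xs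
residues q = List.map +_ (List.upTo q) , λ l → Anyₚ.map⁺ (Anyₚ.applyUpTo⁺ id
  (by (divides (l ℤᵈ./ℕ q) (trans (cong (_-ᶻ + (l ℤᵈ.%ℕ q)) (ℤᵈ.a≡a%ℕn+[a/ℕn]*n l q))
    (solve 2 (λ a b → (a :+ b) :- a := b) refl (+ (l ℤᵈ.%ℕ q)) ((l ℤᵈ./ℕ q) *ᶻ + q))))) (ℤᵈ.n%ℕd<d l q))

-- Abelian covers.  A vertex of the cover is a vertex of the base together with a memory: for
-- each of the relations equality, E₀, E₁, … it records the net number of times a walk has crossed each
-- pair of classes, modulo 1 + M! for equality and modulo 3 for the others.

module Cover (Δ : Graph) (R : ℕ) (E : Fin R → Graph.Vertex Δ → Graph.Vertex Δ → Set)
  (E? : ∀ i u v → Dec (E i u v)) (M : ℕ) (o : Graph.Vertex Δ) where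

  open Graph Δ using () renaming (Vertex to V; size to N; _~_ to _~₀_; _~?_ to _~₀?_)

  modulus : Fin (suc R) → ℕ
  modulus zero = big M
  modulus (suc _) = 3

  Same : Fin (suc R) → V → V → Set
  Same zero u v = u ≡ v
  Same (suc i) u v = E i u v

  same? : ∀ r u v → Dec (Same r u v)
  same? zero u v = u Finₚ.≟ v
  same? (suc i) u v = E? i u v

  Memory : Set
  Memory = Fin (suc R) → V → V → ℤ

  infix 4 _≋_
  infixl 6 _⊞_ _⊟_

  _≋_ : Memory → Memory → Set
  x ≋ y = ∀ r a b → Cong (modulus r) (x r a b) (y r a b)

  _⊞_ _⊟_ : Memory → Memory → Memory
  (x ⊞ y) r a b = x r a b +ᶻ y r a b
  (x ⊟ y) r a b = x r a b -ᶻ y r a b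

  ≋-refl : ∀ {x} → x ≋ x
  ≋-refl r a b = c-refl

  ≋-sym : ∀ {x y} → x ≋ y → y ≋ x
  ≋-sym e r a b = c-sym (e r a b)

  ≋-trans : ∀ {x y z} → x ≋ y → y ≋ z → x ≋ z
  ≋-trans e f r a b = c-trans (e r a b) (f r a b)

  -- Classes are addressed through their members, so the entry at `a`, `b` is the net crossing from
  -- the class of `a` to that of `b`. Antisymmetry in `u` and `v` makes adjacency in the cover
  -- symmetric.
  ν : V → V → Memory
  ν u v r a b = ι (same? r u a) *ᶻ ι (same? r v b) -ᶻ ι (same? r v a) *ᶻ ι (same? r u b)

  ν-anti : ∀ u v r a b → ν u v r a b ≡ neg (ν v u r a b)
  ν-anti u v r a b = solve 2 (λ x y → x :- y := :- (y :- x)) refl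
    (ι (same? r u a) *ᶻ ι (same? r v b)) (ι (same? r v a) *ᶻ ι (same? r u b))

  Raw : Set
  Raw = V × Memory

  private
    _≈_ _⌢_ : Raw → Raw → Set
    (u , x) ≈ (v , y) = u ≡ v × x ≋ y
    (u , x) ⌢ (v , y) = (u ~₀ v) × (y ≋ x ⊞ ν u v)

    ≋? : ∀ x y → Dec (x ≋ y)
    ≋? x y = Finₚ.all? λ r → Finₚ.all? λ a → Finₚ.all? λ b → c? (x r a b) (y r a b)

    ⌢-sym : ∀ {x y} → x ⌢ y → y ⌢ x
    ⌢-sym {u , x} {v , y} (a , e) = Graph.~-sym Δ a , λ r i j → c-trans
      (c-reflexive (trans (solve 2 (λ x n → x := (x :+ n) :- n) refl (x r i j) (ν u v r i j)) (cong (λ n → x r i j +ᶻ ν u v r i j +ᶻ n) (sym (ν-anti v u r i j)))))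
      (c-+ʳ (ν v u r i j) (c-sym (e r i j)))

    memories : Σ[ xs ∈ List Memory ] Enumerates _≋_ xs
    memories = enumerate-Π (suc R) (λ {r} f g → ∀ a b → Cong (modulus r) (f a b) (g a b)) λ r →
      enumerate-Π N (λ f g → ∀ b → Cong (modulus r) (f b) (g b)) λ a →
      enumerate-Π N (Cong (modulus r)) λ b → values r
      where
      values : ∀ r → Σ[ xs ∈ List ℤ ] Enumerates (Cong (modulus r)) xs
      values zero = residues (big M)
      values (suc _) = residues 3

    module K = Component {Raw} _≈_ _⌢_ (λ {x} → refl , ≋-refl {proj₂ x})
      (λ {x} {y} e → sym (proj₁ e) , ≋-sym {proj₂ x} {proj₂ y} (proj₂ e))
      (λ {x} {y} {z} e f → trans (proj₁ e) (proj₁ f) , ≋-trans {proj₂ x} {proj₂ y} {proj₂ z} (proj₂ e) (proj₂ f))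
      (λ x y → (proj₁ x Finₚ.≟ proj₁ y) ×-dec ≋? (proj₂ x) (proj₂ y))
      (λ x y → (proj₁ x ~₀? proj₁ y) ×-dec ≋? (proj₂ y) (proj₂ x ⊞ ν (proj₁ x) (proj₁ y)))
      (λ {x} {y} → ⌢-sym {x} {y}) (λ a → Graph.~-irr Δ (proj₁ a))
      (λ {x} {y} {y′} e a → subst (proj₁ x ~₀_) (proj₁ e) (proj₁ a) ,
        ≋-trans {proj₂ y′} {proj₂ y} (≋-sym {proj₂ y} {proj₂ y′} (proj₂ e))
          (subst (λ v → proj₂ y ≋ proj₂ x ⊞ ν (proj₁ x) v) (proj₁ e) (proj₂ a)))
      (List.cartesianProduct (List.allFin N) (proj₁ memories))
      (enumerate-× _≡_ _≋_ (enumerate-Fin N) (proj₂ memories)) (o , λ _ _ _ → + 0)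

  private
    record Interface : Set₁ where
      field
        cover           : Graph
        cover-connected : Connected cover
        root            : Graph.Vertex cover
        p               : Graph.Vertex cover → V
        m               : Graph.Vertex cover → Memory
        p-root          : p root ≡ o
        m-root          : m root ≋ (λ _ _ _ → + 0)
        ~-p             : ∀ {z z′} → Graph._~_ cover z z′ → p z ~₀ p z′
        ~-m             : ∀ {z z′} → Graph._~_ cover z z′ → m z′ ≋ m z ⊞ ν (p z) (p z′)
        uniq            : ∀ {z z′} → p z ≡ p z′ → m z ≋ m z′ → z ≡ z′
        lift            : ∀ z {v} → p z ~₀ v → Σ[ z′ ∈ Graph.Vertex cover ] p z′ ≡ v × Graph._~_ cover z z′

  opaque
    private
      interface : Interface
      interface = record
        { cover = K.component ; cover-connected = K.component-connected ; root = K.root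
        ; p = λ z → proj₁ (K.rep z) ; m = λ z → proj₂ (K.rep z)
        ; p-root = proj₁ K.rep-root ; m-root = proj₂ K.rep-root ; ~-p = proj₁ ; ~-m = proj₂
        ; uniq = λ e f → K.rep-inj (e , f)
        ; lift = λ z {v} a → lift-from z v a (K.neighbour z {v , proj₂ (K.rep z) ⊞ ν (proj₁ (K.rep z)) v} (a , ≋-refl {proj₂ (K.rep z) ⊞ ν (proj₁ (K.rep z)) v})) }
        where
        lift-from : ∀ z v → proj₁ (K.rep z) ~₀ v →
          Σ[ z′ ∈ _ ] (K.rep z′ ≈ (v , proj₂ (K.rep z) ⊞ ν (proj₁ (K.rep z)) v)) →
          Σ[ z′ ∈ _ ] proj₁ (K.rep z′) ≡ v × (K.rep z ⌢ K.rep z′)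
        lift-from z v a (z′ , e , f) = z′ , e , subst (proj₁ (K.rep z) ~₀_) (sym e) a ,
          subst (λ v → proj₂ (K.rep z′) ≋ proj₂ (K.rep z) ⊞ ν (proj₁ (K.rep z)) v) (sym e) f

  open Interface interface public
  open Graph cover using () renaming (Vertex to V̂; _~_ to _~̂_; ~-sym to ~̂-sym) public

  lift-unique : ∀ {z z₁ z₂} → z ~̂ z₁ → z ~̂ z₂ → p z₁ ≡ p z₂ → z₁ ≡ z₂
  lift-unique {z} {z₁} {z₂} a₁ a₂ e = uniq e (≋-trans {m z₁} (~-m {z} {z₁} a₁)
    (subst (λ v → m z ⊞ ν (p z) v ≋ m z₂) (sym e) (≋-sym {m z₂} (~-m {z} {z₂} a₂))))

  opaque
    lift-walk : (u : ℕ → V) → (∀ i → u i ~₀ u (suc i)) → ∀ z → p z ≡ u 0 →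
      Σ[ ω ∈ (ℕ → V̂) ] ω 0 ≡ z × (∀ i → p (ω i) ≡ u i) × (∀ i → ω i ~̂ ω (suc i))
    lift-walk u a z e = proj₁ ∘ go , refl , proj₂ ∘ go , λ i → proj₂ (proj₂ (next i))
      where
      go : ∀ i → Σ[ z ∈ V̂ ] p z ≡ u i
      next : ∀ i → Σ[ z′ ∈ V̂ ] p z′ ≡ u (suc i) × proj₁ (go i) ~̂ z′
      next i = lift (proj₁ (go i)) (subst (_~₀ u (suc i)) (sym (proj₂ (go i))) (a i))
      go zero = z , e
      go (suc i) = proj₁ (next i) , proj₁ (proj₂ (next i))

  lift-path : ∀ {n u v} → Path Δ n u v → ∀ z → p z ≡ u → Σ[ z′ ∈ V̂ ] p z′ ≡ v × Path cover n z z′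
  lift-path stop z e = z , e , stop
  lift-path (a ∷ s) z refl with lift z a
  ... | z₁ , e₁ , a₁ with lift-path s z₁ e₁
  ...   | z′ , e′ , s′ = z′ , e′ , a₁ ∷ s′

  p-surjective : Connected Δ → ∀ u → Σ[ z ∈ V̂ ] p z ≡ u
  p-surjective conn u with lift-path (proj₂ (star-path (conn (p root) u))) root refl
  ... | z , e , _ = z , e

  -- Unique lifting: a neighbour in the cover is determined by its projection, so two maps with the
  -- same projection keep agreeing along every walk.
  agree : (f g : V̂ → V̂) → (∀ {z z′} → z ~̂ z′ → f z ~̂ f z′) → (∀ {z z′} → z ~̂ z′ → g z ~̂ g z′) →
    (∀ z → p (f z) ≡ p (g z)) → ∀ z → f z ≡ g z → ∀ z′ → f z′ ≡ g z′
  agree f g f~ g~ pf z e z′ = go (cover-connected z z′) e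
    where
    go : ∀ {z} → Star _~̂_ z z′ → f z ≡ g z → f z′ ≡ g z′
    go done e = e
    go {z} (_◅_ {j = y} a s) e = go s (lift-unique {f z} {f y} {g y} (f~ {z} {y} a) (subst (_~̂ g y) (sym e) (g~ {z} {y} a)) (pf y))

  -- Lifting automorphisms to a cover

  Covers : Automorphism cover → Automorphism Δ → Set
  Covers α g = ∀ z → p (_^^_ cover z α) ≡ _^^_ Δ (p z) g

  covers-unique : ∀ α β g h → Covers α g → Covers β h → Group._≈_ (Aut Δ) g h →
    ∀ z → _^^_ cover z α ≡ _^^_ cover z β → Group._≈_ (Aut cover) α β
  covers-unique α β g h α↓ β↓ g≈h z e = agree (λ z → _^^_ cover z α) (λ z → _^^_ cover z β)
    (Equivalence.to (Automorphism.preserve α _ _)) (Equivalence.to (Automorphism.preserve β _ _))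
    (λ z → trans (α↓ z) (trans (g≈h (p z)) (sym (β↓ z)))) z e

  -- `ρ` pulls the relation `i` back along `g`; this makes the memory of the image of a step a mere
  -- reindexing, `push`, of the memory of the step.
  Compatible : Automorphism Δ → Set
  Compatible g = Σ[ ρ ∈ (Fin R → Fin R) ] (∀ i u v → E i (_^^_ Δ u g) (_^^_ Δ v g) ⇔ E (ρ i) u v)

  extend : (Fin R → Fin R) → Fin (suc R) → Fin (suc R)
  extend ρ zero = zero
  extend ρ (suc i) = suc (ρ i)

  push : (g : Automorphism Δ) → (Fin R → Fin R) → Memory → Memory
  push g ρ x r a b = x (extend ρ r) (Automorphism.perm g ⟨$⟩ˡ a) (Automorphism.perm g ⟨$⟩ˡ b)

  push-cong : ∀ g ρ {x y} → x ≋ y → push g ρ x ≋ push g ρ y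
  push-cong g ρ e zero a b = e zero _ _
  push-cong g ρ e (suc i) a b = e (suc (ρ i)) _ _

  push-ν : ∀ g (k : Compatible g) u v r a b → ν (_^^_ Δ u g) (_^^_ Δ v g) r a b ≡ push g (proj₁ k) (ν u v) r a b
  push-ν g (ρ , κ) u v r a b = cong₂ _-ᶻ_ (cong₂ _*ᶻ_ (move r u a) (move r v b)) (cong₂ _*ᶻ_ (move r v a) (move r u b))
    where
    π = Automorphism.perm g
    move : ∀ r u a → ι (same? r (_^^_ Δ u g) a) ≡ ι (same? (extend ρ r) u (π ⟨$⟩ˡ a))
    move zero u a = ι-⇔ (same? zero (π ⟨$⟩ʳ u) a) (same? zero u (π ⟨$⟩ˡ a))
      (λ e → trans (sym (Perm.inverseˡ π)) (cong (π ⟨$⟩ˡ_) e)) (λ e → trans (cong (π ⟨$⟩ʳ_) e) (Perm.inverseʳ π))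
    move (suc i) u a = ι-⇔ (E? i (π ⟨$⟩ʳ u) a) (E? (ρ i) u (π ⟨$⟩ˡ a))
      (λ e → Equivalence.to (κ i _ _) (subst (E i (π ⟨$⟩ʳ u)) (sym (Perm.inverseʳ π)) e))
      (λ e → subst (E i (π ⟨$⟩ʳ u)) (Perm.inverseʳ π) (Equivalence.from (κ i _ _) e))

  module _ (g : Automorphism Δ) (k : Compatible g) where
    private
      ρ = proj₁ k
      infixl 8 _·g
      _·g : V → V
      u ·g = _^^_ Δ u g

    push-step : ∀ {z z′ ẑ ẑ′} → z ~̂ z′ → ẑ ~̂ ẑ′ → p ẑ ≡ p z ·g → p ẑ′ ≡ p z′ ·g →
      m ẑ′ ⊟ push g ρ (m z′) ≋ m ẑ ⊟ push g ρ (m z)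
    push-step {z} {z′} {ẑ} {ẑ′} a â e e′ r i j = c-trans
      (c-- (~-m {ẑ} {ẑ′} â r i j) (push-cong g ρ {m z′} {m z ⊞ ν (p z) (p z′)} (~-m {z} {z′} a) r i j))
      (c-reflexive (trans (cong (λ n → (m ẑ r i j +ᶻ n) -ᶻ (X +ᶻ Y)) (trans (cong₂ (λ u v → ν u v r i j) e e′) (push-ν g k (p z) (p z′) r i j)))
        (solve 3 (λ a x y → (a :+ y) :- (x :+ y) := a :- x) refl (m ẑ r i j) X Y)))
      where
      X = push g ρ (m z) r i j
      Y = push g ρ (ν (p z) (p z′)) r i j

    -- Along a walk and its image the memories change in step, so a lift of `g` acts on memories as
    -- `push` followed by a fixed translation.
    affine : ∀ α → Covers α g → ∀ z z′ → m (_^^_ cover z′ α) ⊟ push g ρ (m z′) ≋ m (_^^_ cover z α) ⊟ push g ρ (m z)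
    affine α α↓ z z′ = go (cover-connected z z′)
      where
      go : ∀ {z} → Star _~̂_ z z′ → m (_^^_ cover z′ α) ⊟ push g ρ (m z′) ≋ m (_^^_ cover z α) ⊟ push g ρ (m z)
      go done = ≋-refl {m (_^^_ cover z′ α) ⊟ push g ρ (m z′)}
      go {z} (_◅_ {j = y} a s) = ≋-trans {m (_^^_ cover z′ α) ⊟ push g ρ (m z′)} {m (_^^_ cover y α) ⊟ push g ρ (m y)}
        (go s) (push-step {z} {y} {_^^_ cover z α} {_^^_ cover y α} a (Equivalence.to (Automorphism.preserve α z y) a) (α↓ z) (α↓ y))

    -- The image of `z` is found along some walk from `z₁`. The offset carried along pins it down,
    -- so the choice of the walk does not matter (`f-≡`).
    transport : ∀ z₁ z₂ → p z₂ ≡ p z₁ ·g → ∀ z →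
      Σ[ ẑ ∈ V̂ ] p ẑ ≡ p z ·g × (m ẑ ⊟ push g ρ (m z) ≋ m z₂ ⊟ push g ρ (m z₁))
    transport z₁ z₂ e z = go (cover-connected z₁ z) z₂ e (≋-refl {m z₂ ⊟ push g ρ (m z₁)})
      where
      go : ∀ {y} → Star _~̂_ y z → ∀ ŷ → p ŷ ≡ p y ·g → m ŷ ⊟ push g ρ (m y) ≋ m z₂ ⊟ push g ρ (m z₁) →
        Σ[ ẑ ∈ V̂ ] p ẑ ≡ p z ·g × (m ẑ ⊟ push g ρ (m z) ≋ m z₂ ⊟ push g ρ (m z₁))
      go done ŷ e f = ŷ , e , f
      go {y} (_◅_ {j = y′} a s) ŷ e f with lift ŷ {p y′ ·g} (subst (_~₀ p y′ ·g) (sym e) (Equivalence.to (Automorphism.preserve g _ _) (~-p {y} {y′} a)))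
      ... | ŷ′ , e′ , â = go s ŷ′ e′ (≋-trans {m ŷ′ ⊟ push g ρ (m y′)} {m ŷ ⊟ push g ρ (m y)} (push-step {y} {y′} {ŷ} {ŷ′} a â e e′) f)

  private
    module Move (g : Automorphism Δ) (k : Compatible g) (z₁ z₂ : V̂) (e : p z₂ ≡ _^^_ Δ (p z₁) g) where
      c : Memory
      c = m z₂ ⊟ push g (proj₁ k) (m z₁)

      f : V̂ → V̂
      f z = proj₁ (transport g k z₁ z₂ e z)

      f-p : ∀ z → p (f z) ≡ _^^_ Δ (p z) g
      f-p z = proj₁ (proj₂ (transport g k z₁ z₂ e z))

      f-m : ∀ z → m (f z) ⊟ push g (proj₁ k) (m z) ≋ c
      f-m z = proj₂ (proj₂ (transport g k z₁ z₂ e z))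

      f-m′ : ∀ z → m (f z) ≋ push g (proj₁ k) (m z) ⊞ c
      f-m′ z r i j = c-move (m (f z) r i j) (push g (proj₁ k) (m z) r i j) (f-m z r i j)

      f-≡ : ∀ z ẑ → p ẑ ≡ _^^_ Δ (p z) g → m ẑ ⊟ push g (proj₁ k) (m z) ≋ c → f z ≡ ẑ
      f-≡ z ẑ e′ h = uniq (trans (f-p z) (sym e′)) λ r i j → c-trans (f-m′ z r i j)
        (c-sym (c-move (m ẑ r i j) (push g (proj₁ k) (m z) r i j) (h r i j)))

      f-at : f z₁ ≡ z₂
      f-at = f-≡ z₁ z₂ e (≋-refl {c})

      f-~ : ∀ {z z′} → z ~̂ z′ → f z ~̂ f z′
      f-~ {z} {z′} a with lift (f z) {_^^_ Δ (p z′) g} (subst (_~₀ _^^_ Δ (p z′) g) (sym (f-p z)) (Equivalence.to (Automorphism.preserve g _ _) (~-p {z} {z′} a)))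
      ... | ẑ′ , e′ , â = subst (f z ~̂_) (sym (f-≡ z′ ẑ′ e′ (≋-trans {m ẑ′ ⊟ push g (proj₁ k) (m z′)} {m (f z) ⊟ push g (proj₁ k) (m z)} (push-step g k {z} {z′} {f z} {ẑ′} a â (f-p z) e′) (f-m z)))) â

  opaque
    lift-automorphism : ∀ g → Compatible g → Compatible (Group._⁻¹ (Aut Δ) g) → ∀ z₁ z₂ → p z₂ ≡ _^^_ Δ (p z₁) g →
      Σ[ α ∈ Automorphism cover ] Covers α g × _^^_ cover z₁ α ≡ z₂
    lift-automorphism g k k⁻ z₁ z₂ e = automorphism cover F.f G.f
        (agree (G.f ∘ F.f) id (λ {z} {z′} a → G.f-~ {F.f z} {F.f z′} (F.f-~ {z} {z′} a)) id (λ z → trans (G.f-p (F.f z)) (trans (cong (Automorphism.perm g ⟨$⟩ˡ_) (F.f-p z)) (Perm.inverseˡ (Automorphism.perm g)))) z₁ (trans (cong G.f F.f-at) G.f-at))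
        (agree (F.f ∘ G.f) id (λ {z} {z′} a → F.f-~ {G.f z} {G.f z′} (G.f-~ {z} {z′} a)) id (λ z → trans (F.f-p (G.f z)) (trans (cong (Automorphism.perm g ⟨$⟩ʳ_) (G.f-p z)) (Perm.inverseʳ (Automorphism.perm g)))) z₂ (trans (cong F.f G.f-at) F.f-at))
        (λ {z} {z′} → F.f-~ {z} {z′}) (λ {z} {z′} → G.f-~ {z} {z′}) , F.f-p , F.f-at
      where
      module F = Move g k z₁ z₂ e
      module G = Move (Group._⁻¹ (Aut Δ) g) k⁻ z₂ z₁ (trans (sym (Perm.inverseˡ (Automorphism.perm g))) (cong (Automorphism.perm g ⟨$⟩ˡ_) (sym e)))

  identity-compatible : Compatible (Group.ε (Aut Δ))
  identity-compatible = id , λ i u v → mk⇔ id id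

  opaque
    deck : ∀ z z′ → p z ≡ p z′ → Σ[ τ ∈ Automorphism cover ] Covers τ (Group.ε (Aut Δ)) × _^^_ cover z τ ≡ z′
    deck z z′ e = lift-automorphism (Group.ε (Aut Δ)) identity-compatible (id , λ i u v → mk⇔ id id) z z′ (sym e)

  Shifts : Automorphism cover → Memory → Set
  Shifts τ μ = ∀ z → p (_^^_ cover z τ) ≡ p z × (m (_^^_ cover z τ) ≋ m z ⊞ μ)

  deck-shifts : ∀ τ → Covers τ (Group.ε (Aut Δ)) → ∀ z → Shifts τ (m (_^^_ cover z τ) ⊟ m z)
  deck-shifts τ τ↓ z z′ = τ↓ z′ , λ r a b → c-move (m (_^^_ cover z′ τ) r a b) (m z′ r a b)
    (c-trans (c-reflexive (cong (m (_^^_ cover z′ τ) r a b -ᶻ_) (sym (plain r a b z′))))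
      (c-trans (affine (Group.ε (Aut Δ)) identity-compatible τ τ↓ z z′ r a b) (c-reflexive (cong (m (_^^_ cover z τ) r a b -ᶻ_) (plain r a b z)))))
    where
    plain : ∀ r a b z → push (Group.ε (Aut Δ)) id (m z) r a b ≡ m z r a b
    plain zero a b z = refl
    plain (suc i) a b z = refl

-- Pigeonholing and thresholds for walks in covers

flat-step : (f : ℕ → ℕ) → (∀ t → f t ≤ f (suc t)) → ∀ j → f j < f 0 + j → Σ[ t ∈ ℕ ] t < j × f t ≡ f (suc t)
flat-step f mono zero lt = ⊥-elim (ℕₚ.<-irrefl (sym (ℕₚ.+-identityʳ (f 0))) lt)
flat-step f mono (suc j) lt with f j ℕₚ.≟ f (suc j)
... | yes e = j , ℕₚ.≤-refl , e
... | no ne with flat-step f mono j (ℕₚ.≤-pred (ℕₚ.≤-trans (s≤s (ℕₚ.≤∧≢⇒< (mono j) ne)) (subst (f (suc j) <_) (ℕₚ.+-suc (f 0) j) lt)))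
...   | t , t<j , e = t , ℕₚ.m≤n⇒m≤1+n t<j , e

steps-of : (P : ℕ → Set) → ∀ κ d → (∀ i → i ≤ suc κ → P i) → (∀ i → i ≤ d → P i → P (suc κ + i)) → ∀ i → i ≤ d + suc κ → P i
steps-of P κ d base step i = go (suc i) i ℕₚ.≤-refl
  where
  k = suc κ
  go : ∀ l i → i < l → i ≤ d + k → P i
  go (suc l) i (s≤s i≤l) i≤ with ℕₚ.≤-total i k
  ... | inj₁ i≤k = base i i≤k
  ... | inj₂ k≤i = subst P (ℕₚ.m+[n∸m]≡n k≤i) (step (i ∸ k)
    (ℕₚ.≤-trans (ℕₚ.∸-monoˡ-≤ k i≤) (ℕₚ.≤-reflexive (ℕₚ.m+n∸n≡m d k)))
    (go l (i ∸ k) (ℕₚ.<-≤-trans (ℕₚ.∸-monoʳ-< {i} {k} {0} (s≤s z≤n) k≤i) i≤l) (ℕₚ.≤-trans (ℕₚ.m∸n≤m i k) i≤)))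

module Threshold (Δ : Graph) (conn : Connected Δ) (κ : ℕ) where
  private
    k = suc κ

  opaque
    diameter : ℕ
    diameter = proj₁ (bounded-paths {Δ} conn)

    ways : ∀ u v → Σ[ n ∈ ℕ ] n ≤ diameter × Path Δ n u v
    ways = proj₂ (bounded-paths {Δ} conn)

    -- The cost of going to the fibre of a given point, following there a translate of a path of
    -- length at most 2 `diameter` + 1, and coming back.
    reach : ℕ
    reach = (diameter + (diameter + suc diameter)) + diameter

    reach-≥ : ∀ {l₁ l} → l₁ ≤ diameter → l ≤ diameter + suc diameter → (l₁ + l) + l₁ ≤ reach
    reach-≥ l₁≤ l≤ = ℕₚ.+-mono-≤ (ℕₚ.+-mono-≤ l₁≤ l≤) l₁≤

    -- A displacement of at most `reach` causes at most 2 `reach` gaps, so among this many blocks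
    -- one has no gap.
    blocks : ℕ
    blocks = suc (reach + reach)

    blocks-> : reach + reach < blocks
    blocks-> = ℕₚ.≤-refl

    -- The walk in `stable` has length 2 `blocks` k. With both ends displaced by `reach`, the two
    -- height differences compared in `off-bound` together stay below any modulus beyond this
    -- number.
    enough : ℕ
    enough = ((blocks * k + blocks * k) + reach) + ((blocks * k + blocks * k) + reach)

    enough-≥ : ((blocks * k + blocks * k) + reach) + ((blocks * k + blocks * k) + reach) ≤ enough
    enough-≥ = ℕₚ.≤-refl

-- Automorphisms of covers respect the fibres

module Projection (Δ : Graph) (R : ℕ) (E : Fin R → Graph.Vertex Δ → Graph.Vertex Δ → Set)
  (E? : ∀ i u v → Dec (E i u v)) (M : ℕ) (o : Graph.Vertex Δ) (κ : ℕ) where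

  open Cover Δ R E E? M o
  open Graph Δ using () renaming (Vertex to V; size to N; _~_ to _~₀_)

  private
    q = big M
    k = suc κ

  infixl 8 _·_
  _·_ : V̂ → Automorphism cover → V̂
  z · α = _^^_ cover z α

  ·-~ : ∀ (α : Automorphism cover) {z z′} → z ~̂ z′ → z · α ~̂ z′ · α
  ·-~ α = Equivalence.to (Automorphism.preserve α _ _)

  _⁻ : Automorphism cover → Automorphism cover
  _⁻ = Group._⁻¹ (Aut cover)

  ·-⁻ : ∀ α z → z · α · α ⁻ ≡ z
  ·-⁻ α z = Perm.inverseˡ (Automorphism.perm α)

  ⁻-· : ∀ α z → z · α ⁻ · α ≡ z
  ⁻-· α z = Perm.inverseʳ (Automorphism.perm α)

  module Height (w : Matrix N) where
    ψ : V → V → ℤ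
    ψ u v = w u v -ᶻ w v u

    height : V̂ → ℤ
    height z = ⟪ w , m z zero ⟫

    step-height : ∀ {z z′} → z ~̂ z′ → Cong q (height z′) (height z +ᶻ ψ (p z) (p z′))
    step-height {z} {z′} a = c-trans (⟪⟫-mod w (λ i j → ~-m {z} {z′} a zero i j))
      (c-reflexive (trans (⟪⟫-+ w (m z zero) (dart (p z) (p z′))) (cong (height z +ᶻ_) (⟪⟫-dart w (p z) (p z′)))))

    walk-height : (ω : ℕ → V̂) → (∀ i → ω i ~̂ ω (suc i)) → ∀ n →
      Cong q (height (ω n)) (height (ω 0) +ᶻ Sum n (λ i → ψ (p (ω i)) (p (ω (suc i)))))
    walk-height ω a zero = c-reflexive (sym (ℤₚ.+-identityʳ _))
    walk-height ω a (suc n) = c-trans (step-height {ω n} {ω (suc n)} (a n))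
      (c-trans (c-+ʳ (ψ (p (ω n)) (p (ω (suc n)))) (walk-height ω a n)) (c-reflexive (ℤₚ.+-assoc (height (ω 0)) _ _)))

    path-height : (∀ u v → ∣ ψ u v ∣ ≤ 1) → ∀ {n z z′} → Path cover n z z′ →
      Σ[ e ∈ ℤ ] ∣ e ∣ ≤ n × Cong q (height z′) (height z +ᶻ e)
    path-height b {z = z} stop = + 0 , z≤n , c-reflexive (sym (ℤₚ.+-identityʳ (height z)))
    path-height b {suc n} {z} {z′} (_∷_ {v = y} a s) with path-height b s
    ... | e , e≤ , h = ψ (p z) (p y) +ᶻ e , ℕₚ.≤-trans (ℤₚ.∣i+j∣≤∣i∣+∣j∣ (ψ (p z) (p y)) e) (ℕₚ.+-mono-≤ (b (p z) (p y)) e≤) ,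
      c-trans h (c-trans (c-+ʳ e (step-height {z} {y} a)) (c-reflexive (ℤₚ.+-assoc (height z) _ e)))

  walk-memory : (ω : ℕ → V̂) → (∀ i → ω i ~̂ ω (suc i)) → ∀ n →
    m (ω n) ≋ m (ω 0) ⊞ (λ r a b → Sum n (λ i → ν (p (ω i)) (p (ω (suc i))) r a b))
  walk-memory ω a zero r i j = c-reflexive (sym (ℤₚ.+-identityʳ _))
  walk-memory ω a (suc n) r i j = c-trans (~-m {ω n} {ω (suc n)} (a n) r i j)
    (c-trans (c-+ʳ (ν (p (ω n)) (p (ω (suc n))) r i j) (walk-memory ω a n r i j)) (c-reflexive (ℤₚ.+-assoc (m (ω 0) r i j) _ _)))

  shift-walk : {A : ℕ → ℕ → Set} → ∀ s → (∀ i → A i (suc i)) → ∀ i → A (s + i) (s + suc i)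
  shift-walk {A} s a i = subst (A (s + i)) (sym (ℕₚ.+-suc s i)) (a (s + i))

  module Along (c : Cycle Δ κ) where
    open Cycle c

    On : V → V → Set
    On u v = Σ[ i ∈ Fin k ] at (toℕ i) ≡ u × at (suc (toℕ i)) ≡ v

    on? : ∀ u v → Dec (On u v)
    on? u v = Finₚ.any? λ i → (at (toℕ i) Finₚ.≟ u) ×-dec (at (suc (toℕ i)) Finₚ.≟ v)

    on-at : ∀ i → On (at i) (at (suc i))
    on-at i = proj₁ (reduce i) , proj₂ (reduce i) , det (proj₂ (reduce i))

    on-next : ∀ i {v} → On (at i) v → v ≡ at (suc i)
    on-next i (j , e , f) = trans (sym f) (det e)

    on-rev : ∀ {u v} → On u v → ¬ On v u
    on-rev (i , a , b) (j , c , d) = norev (trans a (sym d)) (trans b (sym c))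

    open Height (λ u v → ι (on? u v))

    -- The deficit against a step along the cycle: 0 on the cycle, 1 off it, 2 against its
    -- direction.
    gap : V → V → ℕ
    gap u v = ∣ + 1 -ᶻ ψ u v ∣

    private
      cases : ∀ {P Q : Set} (d : Dec P) (e : Dec Q) → (P → ¬ Q) → let x = ι d -ᶻ ι e in
        (+ ∣ + 1 -ᶻ x ∣ ≡ + 1 -ᶻ x) × (∣ x ∣ ≤ 1) × (∣ + 1 -ᶻ x ∣ ≡ 0 → P) × (P → x ≡ + 1)
      cases (yes p) (yes q) f = ⊥-elim (f p q)
      cases (yes p) (no _) f = refl , s≤s z≤n , (λ _ → p) , λ _ → refl
      cases (no ¬p) (yes _) f = refl , s≤s z≤n , (λ ()) , λ p → ⊥-elim (¬p p)
      cases (no ¬p) (no _) f = refl , z≤n , (λ ()) , λ p → ⊥-elim (¬p p)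

      ψ-cases = λ u v → cases (on? u v) (on? v u) on-rev

    ψ≤1 : ∀ u v → ∣ ψ u v ∣ ≤ 1
    ψ≤1 u v = proj₁ (proj₂ (ψ-cases u v))

    ψ-at : ∀ i → ψ (at i) (at (suc i)) ≡ + 1
    ψ-at i = proj₂ (proj₂ (proj₂ (ψ-cases (at i) (at (suc i))))) (on-at i)

    gaps : (ℕ → V) → ℕ → ℕ
    gaps u zero = 0
    gaps u (suc n) = gaps u n + gap (u n) (u (suc n))

    gaps-sum : ∀ u n → Sum n (λ i → ψ (u i) (u (suc i))) +ᶻ + gaps u n ≡ + n
    gaps-sum u zero = refl
    gaps-sum u (suc n) = trans (cong (S +ᶻ x +ᶻ_) (trans (ℤₚ.pos-+ (gaps u n) _) (cong (+ gaps u n +ᶻ_) (proj₁ (ψ-cases (u n) (u (suc n)))))))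
      (trans (solve 3 (λ s x g → (s :+ x) :+ (g :+ (con (+ 1) :- x)) := (s :+ g) :+ con (+ 1)) refl S x (+ gaps u n))
        (trans (cong (_+ᶻ + 1) (gaps-sum u n)) (cong +_ (ℕₚ.+-comm n 1))))
      where
      S = Sum n (λ i → ψ (u i) (u (suc i)))
      x = ψ (u n) (u (suc n))

    gaps-mono : ∀ u n d → gaps u n ≤ gaps u (n + d)
    gaps-mono u n zero = ℕₚ.≤-reflexive (cong (gaps u) (sym (ℕₚ.+-identityʳ n)))
    gaps-mono u n (suc d) = ℕₚ.≤-trans (gaps-mono u n d) (subst (λ l → gaps u (n + d) ≤ gaps u l) (sym (ℕₚ.+-suc n d)) (ℕₚ.m≤m+n _ _))

    no-gap : ∀ u n d → gaps u n ≡ gaps u (n + d) → ∀ i → i < d → On (u (n + i)) (u (n + suc i))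
    no-gap u n d e i i<d = subst (λ l → On (u (n + i)) (u l)) (sym (ℕₚ.+-suc n i)) (proj₁ (proj₂ (proj₂ (ψ-cases (u (n + i)) (u (suc (n + i)))))) zero-gap)
      where
      below : gaps u (n + i) + gap (u (n + i)) (u (suc (n + i))) ≤ gaps u (n + i)
      below = ℕₚ.≤-trans (subst₂ (λ a b → gaps u a ≤ gaps u b) (ℕₚ.+-suc n i) (trans (ℕₚ.+-assoc n (suc i) (d ∸ suc i)) (cong (ℕ._+_ n) (ℕₚ.m+[n∸m]≡n i<d))) (gaps-mono u (n + suc i) (d ∸ suc i)))
        (ℕₚ.≤-trans (ℕₚ.≤-reflexive (sym e)) (gaps-mono u n i))
      zero-gap : gap (u (n + i)) (u (suc (n + i))) ≡ 0
      zero-gap = ℕₚ.n≤0⇒n≡0 (ℕₚ.+-cancelˡ-≤ (gaps u (n + i)) _ 0 (ℕₚ.≤-trans below (ℕₚ.≤-reflexive (sym (ℕₚ.+-identityʳ _)))))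

    follow : ∀ (u : ℕ → V) n s d → u n ≡ at s → (∀ i → i < d → On (u (n + i)) (u (n + suc i))) → ∀ i → i ≤ d → u (n + i) ≡ at (s + i)
    follow u n s d e on zero _ = trans (cong u (ℕₚ.+-identityʳ n)) (trans e (cong at (sym (ℕₚ.+-identityʳ s))))
    follow u n s d e on (suc i) i<d = trans (on-next (s + i) (subst (λ x → On x (u (n + suc i))) (follow u n s d e on i (ℕₚ.<⇒≤ i<d)) (on i i<d))) (cong at (sym (ℕₚ.+-suc s i)))

    -- A walk that shadows a lift of the cycle closely leaves the cycle rarely.
    off-bound : ∀ (ω ℓ : ℕ → V̂) s n B → (∀ i → ω i ~̂ ω (suc i)) → (∀ i → ℓ i ~̂ ℓ (suc i)) → (∀ i → p (ℓ i) ≡ at (s + i)) →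
      ∀ {e₀ e₁} → ∣ e₀ ∣ ≤ B → ∣ e₁ ∣ ≤ B → Cong q (height (ω 0)) (height (ℓ 0) +ᶻ e₀) → Cong q (height (ω n)) (height (ℓ n) +ᶻ e₁) →
      (n + B) + (n + B) < q → gaps (p ∘ ω) n ≤ B + B
    off-bound ω ℓ s n B ωa ℓa ℓp {e₀} {e₁} b₀ b₁ h₀ h₁ lt = subst (_≤ B + B) (cong ∣_∣ (sym D≡))
        (ℕₚ.≤-trans (∣i-j∣≤ e₀ e₁) (ℕₚ.+-mono-≤ b₀ b₁))
      where
      S = Sum n (λ i → ψ (p (ω i)) (p (ω (suc i))))
      D = gaps (p ∘ ω) n
      ℓ-sum : Sum n (λ i → ψ (p (ℓ i)) (p (ℓ (suc i)))) ≡ + n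
      ℓ-sum = trans (Sum-cong n λ i _ → proj₂ (proj₂ (proj₂ (ψ-cases (p (ℓ i)) (p (ℓ (suc i)))))) (subst₂ On (sym (ℓp i)) (trans (cong at (sym (ℕₚ.+-suc s i))) (sym (ℓp (suc i)))) (on-at (s + i)))) (Sum-one n)
      c₁ : Cong q ((height (ℓ 0) +ᶻ e₀) +ᶻ S) ((height (ℓ 0) +ᶻ + n) +ᶻ e₁)
      c₁ = c-trans (c-sym (c-+ʳ S h₀)) (c-trans (c-sym (walk-height ω ωa n)) (c-trans h₁ (c-+ʳ e₁ (c-trans (walk-height ℓ ℓa n) (c-reflexive (cong (height (ℓ 0) +ᶻ_) ℓ-sum))))))
      c₂ : Cong q (S +ᶻ e₀) (+ n +ᶻ e₁)
      c₂ = cong-by (Cong.difference c₁) (solve 5 (λ h e s n f → (s :+ e) :- (n :+ f) := ((h :+ e) :+ s) :- ((h :+ n) :+ f)) refl (height (ℓ 0)) e₀ S (+ n) e₁)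
      S≤ : ∣ S ∣ ≤ n
      S≤ = subst (∣ S ∣ ≤_) (ℕₚ.*-identityʳ n) (Sum-bound n _ 1 (λ i → ψ≤1 (p (ω i)) (p (ω (suc i)))))
      e : S +ᶻ e₀ ≡ + n +ᶻ e₁
      e = c-small c₂ (ℕₚ.≤-<-trans (ℕₚ.≤-trans (∣i-j∣≤ (S +ᶻ e₀) (+ n +ᶻ e₁)) (ℕₚ.+-mono-≤
        (ℕₚ.≤-trans (ℤₚ.∣i+j∣≤∣i∣+∣j∣ S e₀) (ℕₚ.+-mono-≤ S≤ b₀)) (ℕₚ.≤-trans (ℤₚ.∣i+j∣≤∣i∣+∣j∣ (+ n) e₁) (ℕₚ.+-mono-≤ (ℕₚ.≤-refl {n}) b₁)))) lt)
      D≡ : + D ≡ e₀ -ᶻ e₁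
      D≡ = trans (solve 3 (λ s d e → d := (s :+ d) :+ e :- (s :+ e)) refl S (+ D) e₀)
        (trans (cong₂ (λ a b → a +ᶻ e₀ -ᶻ b) (gaps-sum (p ∘ ω) n) e) (solve 3 (λ n e f → n :+ e :- (n :+ f) := e :- f) refl (+ n) e₀ e₁))

    -- With common ends no gap is allowed, so the projection never leaves the cycle, and the lift of
    -- a walk is unique.
    rigid : ∀ (ω ℓ : ℕ → V̂) s n → (∀ i → ω i ~̂ ω (suc i)) → (∀ i → ℓ i ~̂ ℓ (suc i)) → (∀ i → p (ℓ i) ≡ at (s + i)) →
      ω 0 ≡ ℓ 0 → ω n ≡ ℓ n → n + n < q → ∀ i → i ≤ n → ω i ≡ ℓ i
    rigid ω ℓ s n ωa ℓa ℓp e₀ eₙ lt = go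
      where
      none : gaps (p ∘ ω) n ≡ 0
      none = ℕₚ.n≤0⇒n≡0 (off-bound ω ℓ s n 0 ωa ℓa ℓp {+ 0} {+ 0} z≤n z≤n
        (c-reflexive (trans (cong height e₀) (sym (ℤₚ.+-identityʳ _)))) (c-reflexive (trans (cong height eₙ) (sym (ℤₚ.+-identityʳ _))))
        (subst (λ n → n + n < q) (sym (ℕₚ.+-identityʳ n)) lt))
      onc : ∀ i → i ≤ n → p (ω i) ≡ at (s + i)
      onc = follow (p ∘ ω) 0 s n (trans (cong p e₀) (trans (ℓp 0) (cong at (ℕₚ.+-identityʳ s)))) (no-gap (p ∘ ω) 0 n (sym none))
      go : ∀ i → i ≤ n → ω i ≡ ℓ i
      go zero _ = e₀
      go (suc i) i<n = lift-unique {ω i} {ω (suc i)} {ℓ (suc i)} (ωa i) (subst (_~̂ ℓ (suc i)) (sym (go i (ℕₚ.<⇒≤ i<n))) (ℓa i)) (trans (onc (suc i) i<n) (sym (ℓp (suc i))))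

    turn : Memory
    turn r a b = Sum k (λ i → ν (at i) (at (suc i)) r a b)

    turn-memory : ∀ (ω : ℕ → V̂) n s → (∀ i → ω i ~̂ ω (suc i)) → (∀ i → i ≤ k → p (ω (n + i)) ≡ at (s + i)) →
      m (ω (n + k)) ≋ m (ω n) ⊞ turn
    turn-memory ω n s ωa e r a b = c-trans (walk-memory (λ i → ω (n + i)) (shift-walk {λ i j → ω i ~̂ ω j} n ωa) k r a b)
      (c-reflexive (cong₂ _+ᶻ_ (cong (λ l → m (ω l) r a b) (ℕₚ.+-identityʳ n))
        (trans (Sum-cong k (λ i i<k → cong₂ (λ u v → ν u v r a b) (e i (ℕₚ.<⇒≤ i<k)) (trans (e (suc i) i<k) (cong at (ℕₚ.+-suc s i)))))
          (Sum-rotate k (λ i → ν (at i) (at (suc i)) r a b) (λ i → cong₂ (λ u v → ν u v r a b) (per i) (per (suc i))) s))))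

    turns-memory : ∀ (ℓ : ℕ → V̂) → (∀ i → ℓ i ~̂ ℓ (suc i)) → (∀ i → p (ℓ i) ≡ at i) → ∀ n →
      m (ℓ (n * k)) ≋ m (ℓ 0) ⊞ (λ r a b → + n *ᶻ turn r a b)
    turns-memory ℓ ℓa ℓp zero r a b = c-reflexive (sym (ℤₚ.+-identityʳ _))
    turns-memory ℓ ℓa ℓp (suc n) r a b = c-trans (c-reflexive (cong (λ l → m (ℓ l) r a b) (ℕₚ.+-comm k (n * k))))
      (c-trans (turn-memory ℓ (n * k) (n * k) ℓa (λ i _ → ℓp (n * k + i)) r a b)
      (c-trans (c-+ʳ (turn r a b) (turns-memory ℓ ℓa ℓp n r a b))
        (c-reflexive (solve 3 (λ x n t → (x :+ n :* t) :+ t := x :+ (con (+ 1) :+ n) :* t) refl (m (ℓ 0) r a b) (+ n) (turn r a b)))))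

    closes : ∀ (ℓ : ℕ → V̂) → (∀ i → ℓ i ~̂ ℓ (suc i)) → (∀ i → p (ℓ i) ≡ at i) → ∀ n →
      (∀ r → modulus r ∣ n) → ℓ (n * k) ≡ ℓ 0
    closes ℓ ℓa ℓp n d = uniq (trans (ℓp (n * k)) (trans (per* n 0) (sym (ℓp 0)))) λ r a b → c-trans (turns-memory ℓ ℓa ℓp n r a b)
      (c-trans (c-+ˡ (m (ℓ 0) r a b) (multiple r a b (d r))) (c-reflexive (ℤₚ.+-identityʳ _)))
      where
      multiple : ∀ r a b → modulus r ∣ n → Cong (modulus r) (+ n *ᶻ turn r a b) (+ 0)
      multiple r a b (ℕᵈ.divides l refl) = c-trans (c-reflexive (trans (cong (_*ᶻ turn r a b) (ℤₚ.pos-* l (modulus r)))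
        (solve 3 (λ l q t → (l :* q) :* t := q :* (l :* t)) refl (+ l) (+ modulus r) (turn r a b)))) (c-multiple (+ l *ᶻ turn r a b))

    -- The image under `σ` of a long lift of the cycle has fewer gaps than blocks in each half, so
    -- each half contains a gap-free block, a full turn. Undoing one turn by a deck transformation
    -- and then `σ` yields a second walk with the ends of a stretch of the lift. Rigidity identifies
    -- the two, which makes the image periodic between the blocks. It therefore stays on the cycle,
    -- also in the middle, at the image of `z`.
    stable : ∀ (σ : Automorphism cover) B → (∀ z → Σ[ n ∈ ℕ ] n ≤ B × Path cover n z (z · σ)) → ∀ j → B + B < j →
      ((j * k + j * k) + B) + ((j * k + j * k) + B) < q → ∀ z → p z ≡ at 0 → Σ[ s ∈ ℕ ] p (z · σ) ≡ at s
    stable σ B near j j> lt z pz = subst (λ i → Σ[ s ∈ ℕ ] p i ≡ at s) ωmid (subst (λ i → Σ[ s ∈ ℕ ] p (ω i) ≡ at s) (ℕₚ.m+[n∸m]≡n A≤mid)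
        (on-cycle _ (ℕₚ.≤-trans (ℕₚ.∸-monoˡ-≤ A (ℕₚ.m≤m+n (j * k) (t₂ * k))) (ℕₚ.m≤m+n (C ∸ A) k))))
      where
      n = j * k + j * k
      walk = lift-walk at adj z pz
      ℓ₀ = proj₁ walk
      ℓ₀p = proj₁ (proj₂ (proj₂ walk))
      ℓ₀a = proj₂ (proj₂ (proj₂ walk))
      -- `suc Q′` is 3 q, and after any multiple of 3 q turns a lift has closed up. Starting after j
      -- (3 q - 1) turns thus means starting j turns before `z`, without negative indices.
      Q′ = M ! + 2 * q
      off = j * Q′ * k
      ℓ : ℕ → V̂
      ℓ i = ℓ₀ (off + i)
      ℓa : ∀ i → ℓ i ~̂ ℓ (suc i)
      ℓa = shift-walk {λ i j → ℓ₀ i ~̂ ℓ₀ j} off ℓ₀a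
      ℓp : ∀ i → p (ℓ i) ≡ at (off + i)
      ℓp i = ℓ₀p (off + i)
      all∣ : ∀ r → modulus r ∣ j * (3 * q)
      all∣ zero = ℕᵈ.∣n⇒∣m*n j (ℕᵈ.n∣m*n 3)
      all∣ (suc _) = ℕᵈ.∣n⇒∣m*n j (ℕᵈ.m∣m*n q)
      ℓmid : ℓ (j * k) ≡ z
      ℓmid = trans (cong ℓ₀ (trans (sym (ℕₚ.*-distribʳ-+ k (j * Q′) j)) (cong (_* k) (trans (ℕₚ.+-comm (j * Q′) j) (sym (ℕₚ.*-suc j Q′))))))
        (trans (closes ℓ₀ ℓ₀a ℓ₀p (j * (3 * q)) all∣) (proj₁ (proj₂ walk)))
      ω : ℕ → V̂
      ω i = ℓ i · σ
      ωa : ∀ i → ω i ~̂ ω (suc i)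
      ωa i = ·-~ σ (ℓa i)
      ωmid : ω (j * k) ≡ z · σ
      ωmid = cong (_· σ) ℓmid
      nearby : ∀ i → Σ[ e ∈ ℤ ] ∣ e ∣ ≤ B × Cong q (height (ω i)) (height (ℓ i) +ᶻ e)
      nearby i with near (ℓ i)
      ... | l , l≤B , path with path-height ψ≤1 path
      ...   | e , e≤l , h = e , ℕₚ.≤-trans e≤l l≤B , h
      D = gaps (p ∘ ω)
      D≤ : D n ≤ B + B
      D≤ = off-bound ω ℓ off n B ωa ℓa ℓp (proj₁ (proj₂ (nearby 0))) (proj₁ (proj₂ (nearby n))) (proj₂ (proj₂ (nearby 0))) (proj₂ (proj₂ (nearby n))) lt
      step-block : ∀ s t → s + suc t * k ≡ s + t * k + k
      step-block s t = trans (cong (ℕ._+_ s) (ℕₚ.+-comm k (t * k))) (sym (ℕₚ.+-assoc s (t * k) k))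
      block : ∀ s → s + j * k ≤ n → Σ[ t ∈ ℕ ] t < j × D (s + t * k) ≡ D (s + t * k + k)
      block s s≤ = proj₁ found , proj₁ (proj₂ found) , trans (proj₂ (proj₂ found)) (cong D (step-block s (proj₁ found)))
        where
        found = flat-step (λ t → D (s + t * k)) (λ t → subst (λ l → D (s + t * k) ≤ D l) (sym (step-block s t)) (gaps-mono (p ∘ ω) (s + t * k) k)) j
          (ℕₚ.≤-trans (s≤s (ℕₚ.≤-trans (subst (λ l → D (s + j * k) ≤ D l) (ℕₚ.m+[n∸m]≡n s≤) (gaps-mono (p ∘ ω) (s + j * k) (n ∸ (s + j * k)))) D≤)) (ℕₚ.≤-trans j> (ℕₚ.m≤n+m j (D (s + 0)))))
      b₁ = block 0 (ℕₚ.m≤m+n (j * k) (j * k))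
      b₂ = block (j * k) ℕₚ.≤-refl
      t₁ = proj₁ b₁
      t₂ = proj₁ b₂
      A = t₁ * k
      C = j * k + t₂ * k
      run : ∀ a → D a ≡ D (a + k) → Σ[ s ∈ ℕ ] (∀ i → i ≤ k → p (ω (a + i)) ≡ at (s + i))
      run a e = toℕ (proj₁ first) , follow (p ∘ ω) a _ k (trans (sym (cong (p ∘ ω) (ℕₚ.+-identityʳ a))) (sym (proj₁ (proj₂ first)))) on
        where
        on = no-gap (p ∘ ω) a k e
        first = on 0 (s≤s z≤n)
      r₁ = run A (proj₂ (proj₂ b₁))
      r₂ = run C (proj₂ (proj₂ b₂))
      returns : ∀ a (r : Σ[ s ∈ ℕ ] (∀ i → i ≤ k → p (ω (a + i)) ≡ at (s + i))) → p (ω (a + k)) ≡ p (ω a)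
      returns a (s , r) = trans (r k ℕₚ.≤-refl) (trans (per s) (trans (cong at (sym (ℕₚ.+-identityʳ s))) (trans (sym (r 0 z≤n)) (cong (p ∘ ω) (ℕₚ.+-identityʳ a)))))
      dk = deck (ω (A + k)) (ω A) (returns A r₁)
      τ = proj₁ dk
      τ-shifts = deck-shifts τ (proj₁ (proj₂ dk)) (ω (A + k))
      A<mid : A < j * k
      A<mid = ℕₚ.*-monoˡ-< k (proj₁ (proj₂ b₁))
      A≤mid = ℕₚ.<⇒≤ A<mid
      A≤C : A ≤ C
      A≤C = ℕₚ.≤-trans A≤mid (ℕₚ.m≤m+n (j * k) (t₂ * k))
      d = C ∸ A
      ω′ : ℕ → V̂
      ω′ i = ω (A + k + i) · τ · σ ⁻
      ω′a : ∀ i → ω′ i ~̂ ω′ (suc i)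
      ω′a i = ·-~ (σ ⁻) (·-~ τ (shift-walk {λ i j → ω i ~̂ ω j} (A + k) ωa i))
      ω′₀ : ω′ 0 ≡ ℓ (A + 0)
      ω′₀ = trans (cong (λ i → ω i · τ · σ ⁻) (ℕₚ.+-identityʳ (A + k))) (trans (cong (_· σ ⁻) (proj₂ (proj₂ dk))) (trans (·-⁻ σ (ℓ A)) (cong ℓ (sym (ℕₚ.+-identityʳ A)))))
      A+k+d : A + k + d ≡ C + k
      A+k+d = trans (ℕₚ.+-assoc A k d) (trans (cong (ℕ._+_ A) (ℕₚ.+-comm k d)) (trans (sym (ℕₚ.+-assoc A d k)) (cong (_+ k) (ℕₚ.m+[n∸m]≡n A≤C))))
      -- Both blocks change the memory by the same `turn`, and this is what `τ` subtracts.
      back : ω (C + k) · τ ≡ ω C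
      back = uniq (trans (proj₁ (τ-shifts (ω (C + k)))) (returns C r₂)) λ r a b → c-trans (proj₂ (τ-shifts (ω (C + k))) r a b)
        (c-trans (c-+ (turn-memory ω C _ ωa (proj₂ r₂) r a b)
          (c-- (c-reflexive (cong (λ z → m z r a b) (proj₂ (proj₂ dk)))) (turn-memory ω A _ ωa (proj₂ r₁) r a b)))
          (c-reflexive (solve 3 (λ x y t → (x :+ t) :+ (y :- (y :+ t)) := x) refl (m (ω C) r a b) (m (ω A) r a b) (turn r a b))))
      ω′d : ω′ d ≡ ℓ (A + d)
      ω′d = trans (cong (λ i → ω i · τ · σ ⁻) A+k+d) (trans (cong (_· σ ⁻) back) (trans (·-⁻ σ (ℓ C)) (cong ℓ (sym (ℕₚ.m+[n∸m]≡n A≤C)))))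
      C≤n : C ≤ n
      C≤n = ℕₚ.+-monoʳ-≤ (j * k) (ℕₚ.*-monoˡ-≤ k (ℕₚ.<⇒≤ (proj₁ (proj₂ b₂))))
      d≤ : d ≤ n + B
      d≤ = ℕₚ.≤-trans (ℕₚ.m∸n≤m C A) (ℕₚ.≤-trans C≤n (ℕₚ.m≤m+n n B))
      same : ∀ i → i ≤ d → ω′ i ≡ ℓ (A + i)
      same = rigid ω′ (λ i → ℓ (A + i)) (off + A) d ω′a (shift-walk {λ i j → ℓ i ~̂ ℓ j} A ℓa)
        (λ i → trans (ℓp (A + i)) (cong at (sym (ℕₚ.+-assoc off A i)))) ω′₀ ω′d (ℕₚ.≤-<-trans (ℕₚ.+-mono-≤ d≤ d≤) lt)
      periodic : ∀ i → i ≤ d → p (ω (A + k + i)) ≡ p (ω (A + i))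
      periodic i i≤d = trans (sym (proj₁ (τ-shifts (ω (A + k + i))))) (cong p (trans (sym (⁻-· σ _)) (cong (_· σ) (same i i≤d))))
      on-cycle : ∀ i → i ≤ d + k → Σ[ s ∈ ℕ ] p (ω (A + i)) ≡ at s
      on-cycle = steps-of (λ i → Σ[ s ∈ ℕ ] p (ω (A + i)) ≡ at s) κ d (λ i i≤k → _ , proj₂ r₁ i i≤k)
        (λ i i≤d h → proj₁ h , trans (cong (p ∘ ω) (sym (ℕₚ.+-assoc A k i))) (trans (periodic i i≤d) (proj₂ h)))

  module _ (conn : Connected Δ) (sep : Separating Δ κ) where
    open Threshold Δ conn κ

    module _ (large : enough ≤ M) where
      -- A cycle through `p y` that misses `p (y · σ)` would contradict `stable`.
      displacement : ∀ (σ : Automorphism cover) → (∀ z → Σ[ n ∈ ℕ ] n ≤ reach × Path cover n z (z · σ)) → ∀ y → p (y · σ) ≡ p y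
      displacement σ near y = decidable-stable (p (y · σ) Finₚ.≟ p y) λ ne → let s = sep (p y) (p (y · σ)) (ne ∘ sym) in
        contradict (proj₂ (proj₂ s)) (Along.stable (proj₁ s) σ reach near blocks blocks-> (ℕₚ.≤-<-trans (ℕₚ.≤-trans enough-≥ large) (big-> M)) y (sym (proj₁ (proj₂ s))))
        where
        contradict : ∀ {u : V} {f : ℕ → V} → (∀ i → f i ≢ u) → ¬ (Σ[ i ∈ ℕ ] u ≡ f i)
        contradict avoid (i , e) = avoid i (sym e)

      -- A deck transformation moving one point by a short path moves every point by a short path, and so does its conjugate by α.
      short : ∀ (α : Automorphism cover) {z z′ l} → p z ≡ p z′ → Path cover l z z′ → l ≤ diameter + suc diameter → p (z · α) ≡ p (z′ · α)
      short α {z} {z′} {l} e s l≤ = trans (sym (displacement σ near (z · α))) (cong p (trans (cong (λ y → y · τ · α) (·-⁻ α z)) (cong (_· α) (proj₂ (proj₂ dk)))))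
        where
        dk = deck z z′ e
        τ = proj₁ dk
        σ : Automorphism cover
        σ = Group._∙_ (Aut cover) (Group._∙_ (Aut cover) (α ⁻) τ) α
        τ-shifts = deck-shifts τ (proj₁ (proj₂ dk)) z
        near-τ : ∀ y → Σ[ n ∈ ℕ ] n ≤ reach × Path cover n y (y · τ)
        near-τ y with ways (p y) (p z)
        ... | l₁ , l₁≤ , s₁ with lift-path s₁ y refl
        ...   | y₁ , e₁ , t₁ with deck z y₁ (sym e₁)
        ...     | ρ , ρ↓ , zρ = (l₁ + l) + l₁ , reach-≥ l₁≤ l≤ ,
                  (t₁ +++ subst (λ x → Path cover l x (z′ · ρ)) zρ (map-path ρ s)) +++ subst (λ x → Path cover l₁ x (y · τ)) commute (reverse-path (map-path τ t₁))
          where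
          ρ-shifts = deck-shifts ρ ρ↓ z
          commute : y₁ · τ ≡ z′ · ρ
          commute = trans (cong (_· τ) (sym zρ)) (trans (uniq (trans (proj₁ (τ-shifts (z · ρ))) (trans (proj₁ (ρ-shifts z)) (sym (trans (proj₁ (ρ-shifts (z · τ))) (proj₁ (τ-shifts z))))))
            (λ r a b → c-trans (proj₂ (τ-shifts (z · ρ)) r a b) (c-trans (c-+ʳ _ (proj₂ (ρ-shifts z) r a b)) (c-trans
              (c-reflexive (solve 3 (λ x y t → (x :+ y) :+ t := (x :+ t) :+ y) refl (m z r a b) ((m (z · ρ) ⊟ m z) r a b) ((m (z · τ) ⊟ m z) r a b)))
              (c-sym (c-trans (proj₂ (ρ-shifts (z · τ)) r a b) (c-+ʳ _ (proj₂ (τ-shifts z) r a b))))))))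
            (cong (_· ρ) (proj₂ (proj₂ dk))))
        near : ∀ y → Σ[ n ∈ ℕ ] n ≤ reach × Path cover n y (y · σ)
        near y = conjugate (near-τ (y · α ⁻))
          where
          conjugate : Σ[ n ∈ ℕ ] n ≤ reach × Path cover n (y · α ⁻) (y · α ⁻ · τ) → Σ[ n ∈ ℕ ] n ≤ reach × Path cover n y (y · σ)
          conjugate (n , n≤ , t) = n , n≤ , subst (λ x → Path cover n x (y · σ)) (⁻-· α y) (map-path α t)

      -- Points of one fibre may be far apart. Every vertex of a walk between them is pushed into
      -- the fibre by a path of length at most the diameter; consecutive results are then close
      -- enough for `short`.
      fibres : ∀ (α : Automorphism cover) {z z′} → p z ≡ p z′ → p (z · α) ≡ p (z′ · α)
      fibres α {z} {z′} e = trans (retract z refl) (trans (along (cover-connected z z′)) (sym (retract z′ (sym e))))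
        where
        v = p z
        h : ∀ y → Σ[ n ∈ ℕ ] n ≤ diameter × (Σ[ y′ ∈ V̂ ] p y′ ≡ v × Path cover n y y′)
        h y = proj₁ (ways (p y) v) , proj₁ (proj₂ (ways (p y) v)) , lift-path (proj₂ (proj₂ (ways (p y) v))) y refl
        ĥ : V̂ → V̂
        ĥ y = proj₁ (proj₂ (proj₂ (h y)))
        retract : ∀ y → p y ≡ v → p (y · α) ≡ p (ĥ y · α)
        retract y e = short α (trans e (sym (proj₁ (proj₂ (proj₂ (proj₂ (h y))))))) (proj₂ (proj₂ (proj₂ (proj₂ (h y)))))
          (ℕₚ.≤-trans (proj₁ (proj₂ (h y))) (ℕₚ.m≤m+n diameter (suc diameter)))
        edge : ∀ {y y′} → y ~̂ y′ → p (ĥ y · α) ≡ p (ĥ y′ · α)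
        edge {y} {y′} a = short α (trans (proj₁ (proj₂ (proj₂ (proj₂ (h y))))) (sym (proj₁ (proj₂ (proj₂ (proj₂ (h y′)))))))
          (reverse-path (proj₂ (proj₂ (proj₂ (proj₂ (h y))))) +++ (a ∷ proj₂ (proj₂ (proj₂ (proj₂ (h y′))))))
          (ℕₚ.+-mono-≤ (proj₁ (proj₂ (h y))) (s≤s (proj₁ (proj₂ (h y′)))))
        along : ∀ {y y′} → Star _~̂_ y y′ → p (ĥ y · α) ≡ p (ĥ y′ · α)
        along done = refl
        along (a ◅ s) = trans (edge a) (along s)

      project : ∀ (α : Automorphism cover) → Σ[ ᾱ ∈ Automorphism Δ ] Covers α ᾱ
      project α = automorphism Δ (f α) (f (α ⁻)) (inverse α (α ⁻) (·-⁻ α)) (inverse (α ⁻) α (⁻-· α)) (f-~ α) (f-~ (α ⁻)) ,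
          λ z → fibres α (sym (proj₂ (p-surjective conn (p z))))
        where
        s : V → V̂
        s u = proj₁ (p-surjective conn u)
        f : Automorphism cover → V → V
        f α u = p (s u · α)
        inverse : ∀ α β → (∀ z → z · α · β ≡ z) → ∀ u → f β (f α u) ≡ u
        inverse α β e u = trans (fibres β (proj₂ (p-surjective conn (f α u)))) (trans (cong p (e (s u))) (proj₂ (p-surjective conn u)))
        f-~ : ∀ α {u v} → u ~₀ v → f α u ~₀ f α v
        f-~ α {u} {v} a = subst (f α u ~₀_) (fibres α (trans (proj₁ (proj₂ l)) (sym (proj₂ (p-surjective conn v))))) (~-p (·-~ α (proj₂ (proj₂ l))))
          where l = lift (s u) (subst (_~₀ v) (sym (proj₂ (p-surjective conn u))) a)

-- Cycles in plain covers

module Plain {V : Set} where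
  none : Fin 0 → V → V → Set
  none ()

  none? : ∀ i u v → Dec (none i u v)
  none? ()

module Counting {Δ : Graph} {κ : ℕ} (c : Cycle Δ κ) where
  open Cycle c
  private
    k = suc κ

  count : ∀ s → s < k → ∀ n → n ≤ k → Sum n (λ r → ι (at r Finₚ.≟ at s)) ≡ ι (s ℕₚ.<? n)
  count s s<k zero n≤k = refl
  count s s<k (suc n) n<k with s ℕₚ.≟ n
  ... | yes refl = trans (cong₂ _+ᶻ_ (trans (count s s<k n (ℕₚ.<⇒≤ n<k)) (ι-no (s ℕₚ.<? n) (ℕₚ.<-irrefl refl))) (ι-yes (at n Finₚ.≟ at s) refl))
    (sym (ι-yes (s ℕₚ.<? suc n) ℕₚ.≤-refl))
  ... | no s≢n = trans (cong₂ _+ᶻ_ (count s s<k n (ℕₚ.<⇒≤ n<k)) (ι-no (at n Finₚ.≟ at s) (λ e → s≢n (sym (inj n<k s<k e)))))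
    (trans (ℤₚ.+-identityʳ _) (ι-⇔ (s ℕₚ.<? n) (s ℕₚ.<? suc n) ℕₚ.m≤n⇒m≤1+n (λ s< → ℕₚ.≤∧≢⇒< (ℕₚ.≤-pred s<) s≢n)))

  count-periods : ∀ s → s < k → ∀ a b → b ≤ k → Sum (a * k + b) (λ r → ι (at r Finₚ.≟ at s)) ≡ + a +ᶻ ι (s ℕₚ.<? b)
  count-periods s s<k a b b≤k = trans (Sum-++ (a * k) b f) (cong₂ _+ᶻ_
    (trans (Sum-periods k f f-per a) (trans (cong (+ a *ᶻ_) (trans (count s s<k k ℕₚ.≤-refl) (ι-yes (s ℕₚ.<? k) s<k))) (ℤₚ.*-identityʳ (+ a))))
    (trans (Sum-cong b (λ r _ → trans (cong f (ℕₚ.+-comm (a * k) r)) (cong (λ v → ι (v Finₚ.≟ at s)) (per* a r)))) (count s s<k b b≤k)))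
    where
    f = λ r → ι (at r Finₚ.≟ at s)
    f-per : ∀ i → f (i + k) ≡ f i
    f-per i = cong (λ v → ι (v Finₚ.≟ at s)) (per i)

  -- An arc of the cycle is determined by its start (`det`) and never run backwards (`norev`), so
  -- net crossings of an arc count visits to its start.
  crossings : ∀ s r → dart (at r) (at (suc r)) (at s) (at (suc s)) ≡ ι (at r Finₚ.≟ at s)
  crossings s r = evaluate (at r Finₚ.≟ at s) (at (suc r) Finₚ.≟ at (suc s)) (at (suc r) Finₚ.≟ at s) (at r Finₚ.≟ at (suc s)) det (λ e f → norev f e)
    where
    evaluate : ∀ {P Q P′ Q′ : Set} (d : Dec P) (e : Dec Q) (d′ : Dec P′) (e′ : Dec Q′) → (P → Q) → (P′ → ¬ Q′) → ι d *ᶻ ι e -ᶻ ι d′ *ᶻ ι e′ ≡ ι d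
    evaluate d e (yes p′) (yes q′) f g = ⊥-elim (g p′ q′)
    evaluate (yes p) e (yes _) (no _) f g = cong (λ e → + 1 *ᶻ e -ᶻ + 0) (ι-yes e (f p))
    evaluate (yes p) e (no _) e′ f g = cong (λ e → + 1 *ᶻ e -ᶻ + 0) (ι-yes e (f p))
    evaluate (no _) e (yes _) (no _) f g = refl
    evaluate (no _) e (no _) e′ f g = refl

dart-elsewhere : ∀ {n} {u v a b : Fin n} → ¬ (u ≡ a × v ≡ b) → ¬ (u ≡ b × v ≡ a) → dart u v a b ≡ + 0
dart-elsewhere {u = u} {v} {a} {b} f g = evaluate (u Finₚ.≟ a) (v Finₚ.≟ b) (v Finₚ.≟ a) (u Finₚ.≟ b) (λ e e′ → f (e , e′)) (λ e e′ → g (e′ , e))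
  where
  evaluate : ∀ {P Q P′ Q′ : Set} (d : Dec P) (e : Dec Q) (d′ : Dec P′) (e′ : Dec Q′) → (P → ¬ Q) → (P′ → ¬ Q′) → ι d *ᶻ ι e -ᶻ ι d′ *ᶻ ι e′ ≡ + 0
  evaluate (yes p) (yes q) d′ e′ f g = ⊥-elim (f p q)
  evaluate d e (yes p′) (yes q′) f g = ⊥-elim (g p′ q′)
  evaluate (yes _) (no _) (yes _) (no _) f g = refl
  evaluate (yes _) (no _) (no _) e′ f g = refl
  evaluate (no _) e (yes _) (no _) f g = refl
  evaluate (no _) e (no _) e′ f g = refl

module Lines (Δ : Graph) (M : ℕ) (o : Graph.Vertex Δ) (κ : ℕ) (k≤M : suc κ ≤ M) where
  open Cover Δ 0 Plain.none Plain.none? M o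
  open Projection Δ 0 Plain.none Plain.none? M o κ using (module Height; module Along)
  open Graph Δ using () renaming (Vertex to V; size to N; _~_ to _~₀_)

  private
    q = big M
    k = suc κ

  -- `suc κ′` is q k, the length of the lifted cycles. In the form `κ + M ! * k` the last index is
  -- seen to lie over the last index `κ`.
  κ′ : ℕ
  κ′ = M ! + κ * big M

  κ′≡ : κ′ ≡ κ + M ! * k
  κ′≡ = ℕₚ.suc-injective (ℕₚ.*-comm k q)

  module _ (c : Cycle Δ κ) where
    open Cycle c

    -- Going around the cycle n times changes the memory by n, so the lift closes up after q turns.
    private
      module Line (z : V̂) (z₀ : p z ≡ at 0) where
        ℓ : ℕ → V̂
        ℓ = proj₁ (lift-walk at adj z z₀)

        ℓ₀ : ℓ 0 ≡ z
        ℓ₀ = proj₁ (proj₂ (lift-walk at adj z z₀))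

        ℓp : ∀ i → p (ℓ i) ≡ at i
        ℓp = proj₁ (proj₂ (proj₂ (lift-walk at adj z z₀)))

        ℓa : ∀ i → ℓ i ~̂ ℓ (suc i)
        ℓa = proj₂ (proj₂ (proj₂ (lift-walk at adj z z₀)))

        next : ∀ {i j} → ℓ i ≡ ℓ j → ℓ (suc i) ≡ ℓ (suc j)
        next {i} {j} e = lift-unique (ℓa i) (subst (_~̂ ℓ (suc j)) (sym e) (ℓa j))
          (trans (ℓp (suc i)) (trans (det (trans (sym (ℓp i)) (trans (cong p e) (ℓp j)))) (sym (ℓp (suc j)))))

        ∣q : ∀ r → modulus r ∣ q
        ∣q zero = ℕᵈ.∣-refl

        period : ∀ i → ℓ (i + suc κ′) ≡ ℓ i
        period zero = trans (cong ℓ (ℕₚ.*-comm k q)) (Along.closes c ℓ ℓa ℓp q ∣q)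
        period (suc i) = next (period i)

        open Height (λ u v → ι (Along.on? c u v))

        turns : ∀ i n → Cong q (height (ℓ (i + n))) (height (ℓ i) +ᶻ + n)
        turns i n = c-trans (walk-height (λ l → ℓ (i + l)) (λ l → subst (ℓ (i + l) ~̂_) (cong ℓ (sym (ℕₚ.+-suc i l))) (ℓa (i + l))) n)
          (c-reflexive (cong₂ _+ᶻ_ (cong (height ∘ ℓ) (ℕₚ.+-identityʳ i))
            (trans (Sum-cong n (λ l _ → trans (cong₂ ψ (ℓp (i + l)) (trans (ℓp (i + suc l)) (cong at (ℕₚ.+-suc i l)))) (Along.ψ-at c (i + l)))) (Sum-one n))))

        -- Each turn raises the height by `k`, and `k ≤ M` makes `k` invertible modulo `q`.
        separate : ∀ {i} n → n < q → ℓ i ≡ ℓ (i + n * k) → n ≡ 0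
        separate {i} n n<q e = ℤₚ.+-injective (c-small (big-cancel M (+ k) (s≤s z≤n) k≤M
          (c-trans (c-reflexive (trans (sym (ℤₚ.pos-* k n)) (cong +_ (ℕₚ.*-comm k n))))
            (c-trans (c-reflexive (solve 2 (λ h x → x := (h :+ x) :- h) refl (height (ℓ i)) (+ (n * k))))
              (c-unmove _ _ (c-trans (c-sym (turns i (n * k))) (c-reflexive (trans (cong height (sym e)) (sym (ℤₚ.+-identityʳ _)))))))))
          (subst (_< q) (cong ∣_∣ (sym (ℤₚ.+-identityʳ (+ n)))) n<q))

        injective≤ : ∀ {i j} → i ≤ j → j < suc κ′ → ℓ i ≡ ℓ j → i ≡ j
        injective≤ {i} {j} i≤j j< e = trans (sym (ℕₚ.+-identityʳ i)) (trans (cong (λ n → i + n * k) (sym n≡0)) (sym j≡))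
          where
          n = j ℕᵐ./ k ∸ i ℕᵐ./ k
          rem : i ℕᵐ.% k ≡ j ℕᵐ.% k
          rem = inj (ℕᵐ.m%n<n i k) (ℕᵐ.m%n<n j k) (trans (back i) (trans (trans (sym (ℓp i)) (trans (cong p e) (ℓp j))) (sym (back j))))
            where
            back : ∀ i → at (i ℕᵐ.% k) ≡ at i
            back i = trans (sym (per* (i ℕᵐ./ k) (i ℕᵐ.% k))) (cong at (sym (ℕᵐ.m≡m%n+[m/n]*n i k)))
          j≡ : j ≡ i + n * k
          j≡ = begin
            j                                              ≡⟨ ℕᵐ.m≡m%n+[m/n]*n j k ⟩
            j ℕᵐ.% k + j ℕᵐ./ k * k                        ≡⟨ cong₂ (λ a b → a + b * k) (sym rem) (sym (ℕₚ.m+[n∸m]≡n (ℕᵐ./-monoˡ-≤ k i≤j))) ⟩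
            i ℕᵐ.% k + (i ℕᵐ./ k + n) * k                  ≡⟨ cong (ℕ._+_ (i ℕᵐ.% k)) (ℕₚ.*-distribʳ-+ k (i ℕᵐ./ k) n) ⟩
            i ℕᵐ.% k + (i ℕᵐ./ k * k + n * k)              ≡⟨ sym (ℕₚ.+-assoc (i ℕᵐ.% k) _ _) ⟩
            i ℕᵐ.% k + i ℕᵐ./ k * k + n * k                ≡⟨ cong (_+ n * k) (sym (ℕᵐ.m≡m%n+[m/n]*n i k)) ⟩
            i + n * k                                      ∎
            where open ≡-Reasoning
          n<q : n < q
          n<q = ℕₚ.≤-<-trans (ℕₚ.m∸n≤m (j ℕᵐ./ k) (i ℕᵐ./ k)) (ℕᵐ.m<n*o⇒m/o<n (subst (j <_) (ℕₚ.*-comm k q) j<))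
          n≡0 : n ≡ 0
          n≡0 = separate n n<q (trans e (cong ℓ j≡))

        injective : ∀ {i j} → i < suc κ′ → j < suc κ′ → ℓ i ≡ ℓ j → i ≡ j
        injective {i} {j} i< j< e with ℕₚ.≤-total i j
        ... | inj₁ i≤j = injective≤ i≤j j< e
        ... | inj₂ j≤i = sym (injective≤ j≤i i< (sym e))

    lift-cycle : ∀ z → p z ≡ at 0 → Σ[ ĉ ∈ Cycle cover κ′ ] Cycle.at ĉ 0 ≡ z × (∀ i → p (Cycle.at ĉ i) ≡ at i)
    lift-cycle z z₀ = record
      { at = ℓ ; adj = ℓa ; per = period ; det = next
      ; norev = λ e f → norev (trans (sym (ℓp _)) (trans (cong p e) (ℓp _))) (trans (sym (ℓp _)) (trans (cong p f) (ℓp _)))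
      ; inj = injective } , ℓ₀ , ℓp
      where open Line z z₀

  Lift : Cycle Δ κ → V̂ → Set
  Lift c z = Σ[ ĉ ∈ Cycle cover κ′ ] Cycle.at ĉ 0 ≡ z × (∀ i → p (Cycle.at ĉ i) ≡ Cycle.at c i)

  crossing : Crossing Δ κ → Crossing cover κ′
  crossing cr z = lifted (cr (p z))
    where
    build : ∀ (c c′ : Cycle Δ κ) → Avoids Δ c′ (Cycle.at c 0) (Cycle.at c 1) → Avoids Δ c′ (Cycle.at c κ) (Cycle.at c 0) → Lift c z → Lift c′ z →
      Σ[ c ∈ Cycle cover κ′ ] Σ[ c′ ∈ Cycle cover κ′ ] Cycle.at c 0 ≡ z × Cycle.at c′ 0 ≡ z ×
        Avoids cover c′ (Cycle.at c 0) (Cycle.at c 1) × Avoids cover c′ (Cycle.at c κ′) (Cycle.at c 0)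
    lifted : (Σ[ c ∈ Cycle Δ κ ] Σ[ c′ ∈ Cycle Δ κ ] Cycle.at c 0 ≡ p z × Cycle.at c′ 0 ≡ p z ×
        Avoids Δ c′ (Cycle.at c 0) (Cycle.at c 1) × Avoids Δ c′ (Cycle.at c κ) (Cycle.at c 0)) → _
    lifted (c , c′ , c₀ , c′₀ , first , last) = build c c′ first last (lift-cycle c z (sym c₀)) (lift-cycle c′ z (sym c′₀))
    build c c′ first last (ĉ , ĉ₀ , ĉp) (ĉ′ , ĉ′₀ , ĉ′p) = ĉ , ĉ′ , ĉ₀ , ĉ′₀ ,
      (λ i → (λ e → proj₁ (first i) (down (proj₁ e) (ĉp 0) , down (proj₂ e) (ĉp 1))) , (λ e → proj₂ (first i) (down (proj₁ e) (ĉp 1) , down (proj₂ e) (ĉp 0)))) ,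
      (λ i → (λ e → proj₁ (last i) (down (proj₁ e) last-p , down (proj₂ e) (ĉp 0))) , (λ e → proj₂ (last i) (down (proj₁ e) (ĉp 0) , down (proj₂ e) last-p)))
      where
      down : ∀ {i z v} → Cycle.at ĉ′ i ≡ z → p z ≡ v → Cycle.at c′ i ≡ v
      down {i} e f = trans (sym (ĉ′p i)) (trans (cong p e) f)
      last-p : p (Cycle.at ĉ κ′) ≡ Cycle.at c κ
      last-p = trans (ĉp κ′) (trans (cong (Cycle.at c) κ′≡) (Cycle.per* c (M !) κ))

  -- Suppose both lifts reach `z′`. An edge of `c` avoided by `c′` has net count 0 along the lift of
  -- `c′`, hence 0 modulo `q` along that of `c`. For the last edge this count is the number `a` of
  -- completed turns; for the first edge it is one more as soon as a new turn has begun. Both vanish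
  -- only at `z` itself.
  module Meeting (z z′ : V̂) (c c′ : Cycle Δ κ) (first : Avoids Δ c′ (Cycle.at c 0) (Cycle.at c 1))
    (last : Avoids Δ c′ (Cycle.at c κ) (Cycle.at c 0)) (ĉ : Cycle cover κ′) (ĉ₀ : Cycle.at ĉ 0 ≡ z) (ĉp : ∀ i → p (Cycle.at ĉ i) ≡ Cycle.at c i)
    (ĉ′ : Cycle cover κ′) (ĉ′₀ : Cycle.at ĉ′ 0 ≡ z) (ĉ′p : ∀ i → p (Cycle.at ĉ′ i) ≡ Cycle.at c′ i)
    (i : Fin (suc κ′)) (ĉi : Cycle.at ĉ (toℕ i) ≡ z′) where
    open Counting c
    a = toℕ i ℕᵐ./ k
    b = toℕ i ℕᵐ.% k
    b<k = ℕᵐ.m%n<n (toℕ i) k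
    i≡ : toℕ i ≡ a * k + b
    i≡ = trans (ℕᵐ.m≡m%n+[m/n]*n (toℕ i) k) (ℕₚ.+-comm b (a * k))
    passes : ∀ s → s < k → Avoids Δ c′ (Cycle.at c s) (Cycle.at c (suc s)) → ∀ j → Cycle.at ĉ′ j ≡ z′ → Cong q (+ a +ᶻ ι (s ℕₚ.<? b)) (+ 0)
    passes s s<k avoid j ĉ′j = c-trans (c-reflexive (trans (sym (trans (cong (λ n → Sum n (λ r → ι (Cycle.at c r Finₚ.≟ Cycle.at c s))) i≡) (count-periods s s<k a b (ℕₚ.<⇒≤ b<k)))) (solve 2 (λ h x → x := (h :+ x) :- h) refl (height z) _)))
        (c-unmove _ _ (c-trans (c-sym along) across))
      where
      x = Cycle.at c s
      y = Cycle.at c (suc s)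
      open Height (λ u v → ι (u Finₚ.≟ x) *ᶻ ι (v Finₚ.≟ y))
      step : ∀ r → ψ (p (Cycle.at ĉ r)) (p (Cycle.at ĉ (suc r))) ≡ ι (Cycle.at c r Finₚ.≟ Cycle.at c s)
      step r = trans (cong₂ ψ (ĉp r) (ĉp (suc r))) (crossings s r)
      skip : ∀ r → ψ (p (Cycle.at ĉ′ r)) (p (Cycle.at ĉ′ (suc r))) ≡ + 0
      skip r = trans (cong₂ ψ (ĉ′p r) (ĉ′p (suc r))) (dart-elsewhere (proj₁ (avoid r)) (proj₂ (avoid r)))
      along : Cong q (height z′) (height z +ᶻ Sum (toℕ i) (λ r → ι (Cycle.at c r Finₚ.≟ Cycle.at c s)))
      along = c-trans (c-reflexive (cong height (sym ĉi))) (c-trans (walk-height (Cycle.at ĉ) (Cycle.adj ĉ) (toℕ i))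
        (c-reflexive (cong₂ _+ᶻ_ (cong height ĉ₀) (Sum-cong (toℕ i) (λ r _ → step r)))))
      across : Cong q (height z′) (height z +ᶻ + 0)
      across = c-trans (c-reflexive (cong height (sym ĉ′j))) (c-trans (walk-height (Cycle.at ĉ′) (Cycle.adj ĉ′) j)
        (c-reflexive (cong₂ _+ᶻ_ (cong height ĉ′₀) (Sum-zero j (λ r _ → skip r)))))
    1<q : 1 < q
    1<q = ℕₚ.≤-<-trans (ℕₚ.≤-trans (s≤s z≤n) k≤M) (big-> M)
    meet : z ≢ z′ → ∀ j → Cycle.at ĉ′ j ≢ z′
    meet z≢z′ j ĉ′j = finish b refl
      where
      last-avoid : Avoids Δ c′ (Cycle.at c κ) (Cycle.at c (suc κ))
      last-avoid = subst (Avoids Δ c′ (Cycle.at c κ)) (sym (Cycle.per c 0)) last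
      a≡0 : a ≡ 0
      a≡0 = ℤₚ.+-injective (c-small (c-trans (c-reflexive (trans (sym (ℤₚ.+-identityʳ (+ a))) (cong (+ a +ᶻ_) (sym (ι-no (κ ℕₚ.<? b) (ℕₚ.≤⇒≯ (ℕₚ.≤-pred b<k))))))) (passes κ ℕₚ.≤-refl last-avoid j ĉ′j))
        (subst (_< q) (cong ∣_∣ (sym (ℤₚ.+-identityʳ (+ a)))) (ℕᵐ.m<n*o⇒m/o<n (subst (toℕ i <_) (ℕₚ.*-comm k q) (Finₚ.toℕ<n i)))))
      finish : ∀ b′ → b ≡ b′ → ⊥
      finish zero e = z≢z′ (trans (sym ĉ₀) (trans (cong (Cycle.at ĉ) (sym (trans i≡ (cong₂ (λ a b → a * k + b) a≡0 e)))) ĉi))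
      finish (suc b′) e = one (c-small (subst₂ (λ a b → Cong q (+ a +ᶻ ι (0 ℕₚ.<? b)) (+ 0)) a≡0 e (passes 0 (s≤s z≤n) first j ĉ′j)) 1<q)
        where
        one : ¬ (+ 1 ≡ + 0)
        one ()

  separating : Crossing Δ κ → Separating cover κ′
  separating cr z z′ z≢z′ = lifted (cr (p z))
    where
    Goal = Σ[ c ∈ Cycle cover κ′ ] Cycle.at c 0 ≡ z × (∀ i → Cycle.at c i ≢ z′)
    choose : ∀ (c c′ : Cycle Δ κ) → Avoids Δ c′ (Cycle.at c 0) (Cycle.at c 1) → Avoids Δ c′ (Cycle.at c κ) (Cycle.at c 0) → Lift c z → Lift c′ z → Goal
    choose c c′ first last (ĉ , ĉ₀ , ĉp) (ĉ′ , ĉ′₀ , ĉ′p) = decide (Finₚ.any? (λ i → Cycle.at ĉ (toℕ {suc κ′} i) Finₚ.≟ z′))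
      where
      decide : Dec (Σ[ i ∈ Fin (suc κ′) ] Cycle.at ĉ (toℕ i) ≡ z′) → Goal
      decide (no ∄) = ĉ , ĉ₀ , λ i e → ∄ (proj₁ (Cycle.reduce ĉ i) , trans (proj₂ (Cycle.reduce ĉ i)) e)
      decide (yes (i , ĉi)) = ĉ′ , ĉ′₀ , Meeting.meet z z′ c c′ first last ĉ ĉ₀ ĉp ĉ′ ĉ′₀ ĉ′p i ĉi z≢z′
    lifted : (Σ[ c ∈ Cycle Δ κ ] Σ[ c′ ∈ Cycle Δ κ ] Cycle.at c 0 ≡ p z × Cycle.at c′ 0 ≡ p z ×
        Avoids Δ c′ (Cycle.at c 0) (Cycle.at c 1) × Avoids Δ c′ (Cycle.at c κ) (Cycle.at c 0)) → Goal
    lifted (c , c′ , c₀ , c′₀ , first , last) = choose c c′ first last (lift-cycle c z (sym c₀)) (lift-cycle c′ z (sym c′₀))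

-- Oriented graphs with a half-arc-transitive group whose vertex stabilizer is H

Neighbours : (Γ : Graph) → Graph.Vertex Γ → ℕ → Set
Neighbours Γ v d = Exactly (Graph._~_ Γ v) d

record OrientedAction {c ℓ} (H : Group c ℓ) : Set (lsuc 0ℓ ⊔ c ⊔ ℓ) where
  private
    module H = Group H
  field
    Γ : Graph
  open Graph Γ
  private
    infixl 8 _·_
    _·_ = _^^_ Γ
    module A = Group (Aut Γ)
  field
    connected  : Connected Γ
    arc        : Vertex → Vertex → Set
    arc⇒~      : ∀ {u v} → arc u v → u ~ v
    ~⇒arc      : ∀ {u v} → u ~ v → arc u v ⊎ arc v u
    arc-anti   : ∀ {u v} → arc u v → ¬ arc v u
    𝒢          : Automorphism Γ → Set
    𝒢-∙        : ∀ {α β} → 𝒢 α → 𝒢 β → 𝒢 (α A.∙ β)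
    𝒢-⁻¹       : ∀ {α} → 𝒢 α → 𝒢 (α A.⁻¹)
    𝒢-arc      : ∀ {α} → 𝒢 α → ∀ {u v} → arc u v → arc (u · α) (v · α)
    transitive : ∀ u v → Σ[ α ∈ Automorphism Γ ] 𝒢 α × u · α ≡ v
    outs       : ∀ {u v w} → arc u v → arc u w → Σ[ α ∈ Automorphism Γ ] 𝒢 α × u · α ≡ u × v · α ≡ w
    base       : Vertex
    act        : H.Carrier → Automorphism Γ
    act-𝒢      : ∀ h → 𝒢 (act h)
    act-fix    : ∀ h → base · act h ≡ base
    act-cong   : ∀ {h k} → h H.≈ k → act h A.≈ act k
    act-∙      : ∀ h k → act (h H.∙ k) A.≈ act h A.∙ act k
    act-inj    : ∀ {h k} → act h A.≈ act k → h H.≈ k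
    act-sur    : ∀ α → 𝒢 α → base · α ≡ base → Σ[ h ∈ H.Carrier ] α A.≈ act h
    neighbours : ∀ v → Neighbours Γ v 4

module CoverLevel {c ℓ} {H : Group c ℓ} (L : OrientedAction H) (R : ℕ)
  (E : Fin R → Graph.Vertex (OrientedAction.Γ L) → Graph.Vertex (OrientedAction.Γ L) → Set) (E? : ∀ i u v → Dec (E i u v)) (M : ℕ)
  (compatible : ∀ g → OrientedAction.𝒢 L g → Cover.Compatible (OrientedAction.Γ L) R E E? M (OrientedAction.base L) g) where

  private
    module L = OrientedAction L
    module H = Group H
    module A = Group (Aut L.Γ)
    Δ = L.Γ
  open Cover Δ R E E? M L.base
  private
    module Â = Group (Aut cover)
    infixl 8 _·_ _·̂_
    _·_ = _^^_ Δ
    _·̂_ = _^^_ cover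
    open Graph Δ using () renaming (_~_ to _~₀_)

    lifted : ∀ g → L.𝒢 g → ∀ z z′ → p z′ ≡ p z · g → Σ[ α ∈ Automorphism cover ] Covers α g × z ·̂ α ≡ z′
    lifted g g∈ = lift-automorphism g (compatible g g∈) (compatible (g A.⁻¹) (L.𝒢-⁻¹ g∈))

    root-fixed : ∀ h → p root ≡ p root · L.act h
    root-fixed h = trans p-root (trans (sym (L.act-fix h)) (cong (_· L.act h) (sym p-root)))

    act̂ : ∀ h → Σ[ α ∈ Automorphism cover ] Covers α (L.act h) × root ·̂ α ≡ root
    act̂ h = lifted (L.act h) (L.act-𝒢 h) root root (root-fixed h)

    covers-∙ : ∀ {α β g h} → Covers α g → Covers β h → Covers (α Â.∙ β) (g A.∙ h)
    covers-∙ {α} {β} {g} {h} α↓ β↓ z = trans (β↓ (z ·̂ α)) (cong (_· h) (α↓ z))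

    covers-⁻¹ : ∀ {α g} → Covers α g → Covers (α Â.⁻¹) (g A.⁻¹)
    covers-⁻¹ {α} {g} α↓ z = trans (sym (Perm.inverseˡ (Automorphism.perm g)))
      (cong (Automorphism.perm g ⟨$⟩ˡ_) (trans (sym (α↓ (z ·̂ (α Â.⁻¹)))) (cong p (Perm.inverseʳ (Automorphism.perm α)))))

  level : OrientedAction H
  level = record
    { Γ = cover
    ; connected = cover-connected
    ; arc = λ z z′ → z ~̂ z′ × L.arc (p z) (p z′)
    ; arc⇒~ = proj₁
    ; ~⇒arc = λ {z} {z′} a → [ (λ x → inj₁ (a , x)) , (λ x → inj₂ (~̂-sym a , x)) ]′ (L.~⇒arc (~-p a))
    ; arc-anti = λ a b → L.arc-anti (proj₂ a) (proj₂ b)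
    ; 𝒢 = λ α → Σ[ g ∈ Automorphism Δ ] L.𝒢 g × Covers α g
    ; 𝒢-∙ = λ { {α} {β} (g , g∈ , α↓) (h , h∈ , β↓) → g A.∙ h , L.𝒢-∙ g∈ h∈ , covers-∙ {α} {β} {g} {h} α↓ β↓ }
    ; 𝒢-⁻¹ = λ { {α} (g , g∈ , α↓) → g A.⁻¹ , L.𝒢-⁻¹ g∈ , covers-⁻¹ {α} {g} α↓ }
    ; 𝒢-arc = λ { {α} (g , g∈ , α↓) {z} {z′} (a , x) → Equivalence.to (Automorphism.preserve α z z′) a ,
        subst₂ L.arc (sym (α↓ z)) (sym (α↓ z′)) (L.𝒢-arc g∈ x) }
    ; transitive = λ z z′ → from-transitive z z′ (L.transitive (p z) (p z′))
    ; outs = λ {z} {z₁} {z₂} a b → from-outs z z₁ z₂ a b (L.outs (proj₂ a) (proj₂ b))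
    ; base = root
    ; act = λ h → proj₁ (act̂ h)
    ; act-𝒢 = λ h → L.act h , L.act-𝒢 h , proj₁ (proj₂ (act̂ h))
    ; act-fix = λ h → proj₂ (proj₂ (act̂ h))
    ; act-cong = λ {h} {k} e → covers-unique (proj₁ (act̂ h)) (proj₁ (act̂ k)) (L.act h) (L.act k) (proj₁ (proj₂ (act̂ h))) (proj₁ (proj₂ (act̂ k)))
        (L.act-cong e) root (trans (proj₂ (proj₂ (act̂ h))) (sym (proj₂ (proj₂ (act̂ k)))))
    ; act-∙ = λ h k → covers-unique (proj₁ (act̂ (h H.∙ k))) (proj₁ (act̂ h) Â.∙ proj₁ (act̂ k)) (L.act (h H.∙ k)) (L.act h A.∙ L.act k)
        (proj₁ (proj₂ (act̂ (h H.∙ k)))) (covers-∙ {proj₁ (act̂ h)} {proj₁ (act̂ k)} {L.act h} {L.act k} (proj₁ (proj₂ (act̂ h))) (proj₁ (proj₂ (act̂ k))))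
        (L.act-∙ h k) root (trans (proj₂ (proj₂ (act̂ (h H.∙ k)))) (sym (trans (cong (_·̂ proj₁ (act̂ k)) (proj₂ (proj₂ (act̂ h)))) (proj₂ (proj₂ (act̂ k))))))
    ; act-inj = λ {h} {k} e → L.act-inj (λ u → from-surjective h k e u (p-surjective L.connected u))
    ; act-sur = λ { α (g , g∈ , α↓) fix → from-sur α g α↓ fix (L.act-sur g g∈
        (trans (cong (_· g) (sym p-root)) (trans (sym (α↓ root)) (trans (cong p fix) p-root)))) }
    ; neighbours = λ z → from-neighbours z (L.neighbours (p z))
    }
    where
    from-transitive : ∀ z z′ → Σ[ g ∈ Automorphism Δ ] L.𝒢 g × p z · g ≡ p z′ →
      Σ[ α ∈ Automorphism cover ] (Σ[ g ∈ Automorphism Δ ] L.𝒢 g × Covers α g) × z ·̂ α ≡ z′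
    from-transitive z z′ (g , g∈ , e) = let (α , α↓ , e′) = lifted g g∈ z z′ (sym e) in α , (g , g∈ , α↓) , e′

    from-outs : ∀ z z₁ z₂ → z ~̂ z₁ × L.arc (p z) (p z₁) → z ~̂ z₂ × L.arc (p z) (p z₂) →
      Σ[ g ∈ Automorphism Δ ] L.𝒢 g × p z · g ≡ p z × p z₁ · g ≡ p z₂ →
      Σ[ α ∈ Automorphism cover ] (Σ[ g ∈ Automorphism Δ ] L.𝒢 g × Covers α g) × z ·̂ α ≡ z × z₁ ·̂ α ≡ z₂
    from-outs z z₁ z₂ (a₁ , _) (a₂ , _) (g , g∈ , e , e′) = let (α , α↓ , fix) = lifted g g∈ z z (sym e) in
      α , (g , g∈ , α↓) , fix ,
      lift-unique (subst (_~̂ z₁ ·̂ α) fix (Equivalence.to (Automorphism.preserve α z z₁) a₁)) a₂ (trans (α↓ z₁) e′)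

    from-surjective : ∀ h k → proj₁ (act̂ h) Â.≈ proj₁ (act̂ k) → ∀ u → Σ[ z ∈ V̂ ] p z ≡ u → u · L.act h ≡ u · L.act k
    from-surjective h k e u (z , refl) = trans (sym (proj₁ (proj₂ (act̂ h)) z)) (trans (cong p (e z)) (proj₁ (proj₂ (act̂ k)) z))

    from-sur : ∀ α g → Covers α g → root ·̂ α ≡ root → Σ[ h ∈ H.Carrier ] g A.≈ L.act h → Σ[ h ∈ H.Carrier ] α Â.≈ proj₁ (act̂ h)
    from-sur α g α↓ fix (h , e) = h , covers-unique α (proj₁ (act̂ h)) g (L.act h) α↓ (proj₁ (proj₂ (act̂ h))) e root (trans fix (sym (proj₂ (proj₂ (act̂ h)))))

    from-neighbours : ∀ z → Neighbours Δ (p z) 4 → Neighbours cover z 4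
    from-neighbours z (f , f-inj , f~ , f-all) = (λ i → proj₁ (lift z (f~ i))) ,
      (λ {i} {j} e → f-inj (trans (sym (proj₁ (proj₂ (lift z (f~ i))))) (trans (cong p e) (proj₁ (proj₂ (lift z (f~ j))))))) ,
      (λ i → proj₂ (proj₂ (lift z (f~ i)))) ,
      λ w a → let (i , e) = f-all (p w) (~-p a) in i , lift-unique (proj₂ (proj₂ (lift z (f~ i)))) a (trans (proj₁ (proj₂ (lift z (f~ i)))) e)

plain-level : ∀ {c ℓ} {H : Group c ℓ} → OrientedAction H → ℕ → OrientedAction H
plain-level L M = CoverLevel.level L 0 Plain.none Plain.none? M λ g _ → (λ ()) , λ ()

⟪⟫-zero : ∀ {n} (w : Matrix n) → ⟪ w , (λ _ _ → + 0) ⟫ ≡ + 0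
⟪⟫-zero w = ∑-zero λ a → ∑-zero λ b → ℤₚ.*-zeroʳ (w a b)

⟪⟫-Sum : ∀ {n} (w : Matrix n) l (x : ℕ → Matrix n) → ⟪ w , (λ a b → Sum l (λ i → x i a b)) ⟫ ≡ Sum l (λ i → ⟪ w , x i ⟫)
⟪⟫-Sum w zero x = ⟪⟫-zero w
⟪⟫-Sum w (suc l) x = trans (⟪⟫-+ w (λ a b → Sum l (λ i → x i a b)) (x l)) (cong (_+ᶻ ⟪ w , x l ⟫) (⟪⟫-Sum w l x))

-- Translations of a cover

module Translations (Δ : Graph) (R : ℕ) (E : Fin R → Graph.Vertex Δ → Graph.Vertex Δ → Set)
  (E? : ∀ i u v → Dec (E i u v)) (M : ℕ) (o : Graph.Vertex Δ) where

  open Cover Δ R E E? M o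
  open Projection Δ R E E? M o 0 using (_·_; _⁻; ·-⁻; ⁻-·; ·-~; module Height)
  open Graph Δ using () renaming (Vertex to V; size to N)

  private
    q = big M
    module A = Group (Aut cover)

  scale : ℤ → Memory → Memory
  scale n μ r a b = n *ᶻ μ r a b

  shifts-cong : ∀ τ {μ μ′} → μ ≋ μ′ → Shifts τ μ → Shifts τ μ′
  shifts-cong τ e s z = proj₁ (s z) , λ r a b → c-trans (proj₂ (s z) r a b) (c-+ˡ (m z r a b) (e r a b))

  shifts-∙ : ∀ σ τ {μ μ′} → Shifts σ μ → Shifts τ μ′ → Shifts (σ A.∙ τ) (μ ⊞ μ′)
  shifts-∙ σ τ {μ} {μ′} s t z = trans (proj₁ (t (z · σ))) (proj₁ (s z)) , λ r a b → c-trans (proj₂ (t (z · σ)) r a b)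
    (c-trans (c-+ʳ (μ′ r a b) (proj₂ (s z) r a b)) (c-reflexive (ℤₚ.+-assoc (m z r a b) _ _)))

  shifts-⁻¹ : ∀ τ {μ} → Shifts τ μ → Shifts (τ ⁻) (λ r a b → neg (μ r a b))
  shifts-⁻¹ τ {μ} s z = trans (sym (proj₁ (s (z · τ ⁻)))) (cong p (⁻-· τ z)) , λ r a b → c-trans
    (c-reflexive (solve 2 (λ x y → x := (x :+ y) :+ :- y) refl (m (z · τ ⁻) r a b) (μ r a b)))
    (c-+ʳ (neg (μ r a b)) (c-trans (c-sym (proj₂ (s (z · τ ⁻)) r a b)) (c-reflexive (cong (λ y → m y r a b) (⁻-· τ z)))))

  pow : Automorphism cover → ℕ → Automorphism cover
  pow τ zero = A.ε
  pow τ (suc n) = τ A.∙ pow τ n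

  shifts-pow : ∀ τ {μ} → Shifts τ μ → ∀ n → Shifts (pow τ n) (scale (+ n) μ)
  shifts-pow τ {μ} s zero z = refl , λ r a b → c-reflexive (sym (ℤₚ.+-identityʳ _))
  shifts-pow τ {μ} s (suc n) = shifts-cong (pow τ (suc n))
    (λ r a b → c-reflexive (solve 2 (λ n x → x :+ n :* x := (con (+ 1) :+ n) :* x) refl (+ n) (μ r a b)))
    (shifts-∙ τ (pow τ n) {μ} {scale (+ n) μ} s (shifts-pow τ {μ} s n))

  shifts-multiple : ∀ τ {μ} → Shifts τ μ → ∀ n → Σ[ σ ∈ Automorphism cover ] Shifts σ (scale n μ)
  shifts-multiple τ {μ} s (+ n) = pow τ n , shifts-pow τ {μ} s n
  shifts-multiple τ {μ} s -[1+ n ] = pow τ (suc n) ⁻ , shifts-cong (pow τ (suc n) ⁻)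
    (λ r a b → c-reflexive (ℤₚ.neg-distribˡ-* (+ suc n) (μ r a b))) (shifts-⁻¹ (pow τ (suc n)) (shifts-pow τ {μ} s (suc n)))

  conj : Automorphism cover → Automorphism cover → Automorphism cover
  conj β κ = (β ⁻ A.∙ κ) A.∙ β

  conj-shifts : ∀ β b → Covers β b → (k : Compatible b) → ∀ κ {μ} → Shifts κ μ → Shifts (conj β κ) (push b (proj₁ k) μ)
  conj-shifts β b β↓ k κ {μ} s z =
      trans (β↓ w) (trans (cong (λ u → _^^_ Δ u b) (proj₁ (s w′))) (trans (sym (β↓ w′)) (cong p (⁻-· β z)))) ,
      λ r i j → c-trans (c-move (m (w · β) r i j) (push b ρ (m w) r i j) (affine b k β β↓ w′ w r i j))
        (c-trans (c-+ (push-cong b ρ {m w} {m w′ ⊞ μ} (proj₂ (s w′)) r i j) (c-+ʳ (neg (push b ρ (m w′) r i j)) (c-reflexive (cong (λ y → m y r i j) (⁻-· β z)))))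
          (c-reflexive (solve 3 (λ a x z → (x :+ a) :+ (z :- x) := z :+ a) refl (push b ρ μ r i j) (push b ρ (m w′) r i j) (m z r i j))))
    where
    ρ = proj₁ k
    w′ = z · β ⁻
    w = w′ · κ

  covers-inverse : ∀ β b → Covers β b → Covers (β ⁻) (Group._⁻¹ (Aut Δ) b)
  covers-inverse β b β↓ z = trans (sym (Perm.inverseˡ (Automorphism.perm b)))
    (cong (Automorphism.perm b ⟨$⟩ˡ_) (trans (sym (β↓ (z · β ⁻))) (cong p (⁻-· β z))))

  conj-covers : ∀ β b → Covers β b → ∀ κ → Covers κ (Group.ε (Aut Δ)) → Covers (conj β κ) (Group.ε (Aut Δ))
  conj-covers β b β↓ κ κ↓ z = trans (β↓ (z · β ⁻ · κ)) (trans (cong (λ u → _^^_ Δ u b) (κ↓ (z · β ⁻))) (trans (sym (β↓ (z · β ⁻))) (cong p (⁻-· β z))))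

  shifts-≈ : ∀ σ τ {μ} → σ A.≈ τ → Shifts σ μ → Shifts τ μ
  shifts-≈ σ τ {μ} e s z = subst (λ y → p y ≡ p z × (m y ≋ m z ⊞ μ)) (e z) (s z)

  shifts-covers : ∀ τ {μ} → Shifts τ μ → Covers τ (Group.ε (Aut Δ))
  shifts-covers τ s z = proj₁ (s z)

  shift-height : ∀ w τ {μ} → Shifts τ μ → ∀ z → Cong q (Height.height w (z · τ)) (Height.height w z +ᶻ ⟪ w , μ zero ⟫)
  shift-height w τ {μ} s z = c-trans (⟪⟫-mod w (λ a b → proj₂ (s z) zero a b)) (c-reflexive (⟪⟫-+ w (m z zero) (μ zero)))

  -- Both heights change by the same amount along every edge, so their difference is constant. This
  -- is how automorphisms move the relations defined by heights.
  height-transport : ∀ (w w′ : Matrix N) α ᾱ → Covers α ᾱ → (∀ a b → w′ a b ≡ w (_^^_ Δ a ᾱ) (_^^_ Δ b ᾱ)) → ∀ z z′ →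
    Cong q (Height.height w (z′ · α) -ᶻ Height.height w′ z′) (Height.height w (z · α) -ᶻ Height.height w′ z)
  height-transport w w′ α ᾱ α↓ w≡ z z′ = go (cover-connected z z′)
    where
    open Height w renaming (height to h; ψ to ψ₁; step-height to step₁)
    open Height w′ renaming (height to h′; ψ to ψ₂; step-height to step₂)
    edge : ∀ {y y′} → y ~̂ y′ → Cong q (h (y′ · α) -ᶻ h′ y′) (h (y · α) -ᶻ h′ y)
    edge {y} {y′} a = c-trans (c-- (step₁ (·-~ α a)) (step₂ a)) (c-reflexive
      (trans (cong (λ x → (h (y · α) +ᶻ x) -ᶻ (h′ y +ᶻ ψ₂ (p y) (p y′))) (trans (cong₂ ψ₁ (α↓ y) (α↓ y′)) (cong₂ _-ᶻ_ (sym (w≡ (p y) (p y′))) (sym (w≡ (p y′) (p y))))))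
        (solve 3 (λ a b x → (a :+ x) :- (b :+ x) := a :- b) refl (h (y · α)) (h′ y) (ψ₂ (p y) (p y′)))))
    go : ∀ {z} → Star _~̂_ z z′ → Cong q (h (z′ · α) -ᶻ h′ z′) (h (z · α) -ᶻ h′ z)
    go done = c-refl
    go (a ◅ s) = c-trans (go s) (edge a)

-- Reading an automorphism off the weights of cycles

same-abs : ∀ i j → ∣ i ∣ ≡ ∣ j ∣ → i ≡ j ⊎ i ≡ neg j
same-abs (+ m) (+ n) e = inj₁ (cong +_ e)
same-abs (+ m) -[1+ n ] e = inj₂ (cong +_ e)
same-abs -[1+ m ] (+ suc n) refl = inj₂ refl
same-abs -[1+ m ] -[1+ n ] refl = inj₁ refl

module Weights (Δ : Graph) (κ : ℕ) where
  open Graph Δ using () renaming (Vertex to V; size to N)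

  private
    k = suc κ
    infixl 8 _·_
    _·_ = _^^_ Δ
    module A = Group (Aut Δ)

  opaque
    W : Matrix N
    W = proj₁ (matrix-digits N k)

    S : ℕ
    S = proj₁ (proj₂ (matrix-digits N k))

    W-bound : ∀ (x : Matrix N) → (∀ a b → ∣ x a b ∣ ≤ k) → ∣ ⟪ W , x ⟫ ∣ ≤ S
    W-bound = proj₁ (proj₂ (proj₂ (matrix-digits N k)))

    W-sep : ∀ (x y : Matrix N) → (∀ a b → ∣ x a b ∣ ≤ k) → (∀ a b → ∣ y a b ∣ ≤ k) → ⟪ W , x ⟫ ≡ ⟪ W , y ⟫ → ∀ a b → x a b ≡ y a b
    W-sep = proj₂ (proj₂ (proj₂ (matrix-digits N k)))

  W∘ : Automorphism Δ → Matrix N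
  W∘ g a b = W (a · g) (b · g)

  flow : Cycle Δ κ → Matrix N
  flow c a b = Sum k (λ i → dart (at i) (at (suc i)) a b)
    where open Cycle c

  pairing : ∀ w c → ⟪ w , flow c ⟫ ≡ Sum k (λ i → w (Cycle.at c i) (Cycle.at c (suc i)) -ᶻ w (Cycle.at c (suc i)) (Cycle.at c i))
  pairing w c = trans (⟪⟫-Sum w k (λ i → dart (at i) (at (suc i)))) (Sum-cong k (λ i _ → ⟪⟫-dart w (at i) (at (suc i))))
    where open Cycle c

  flow-bound : ∀ c a b → ∣ flow c a b ∣ ≤ k
  flow-bound c a b = subst (∣ flow c a b ∣ ≤_) (ℕₚ.*-identityʳ k) (Sum-bound k _ 1 (λ i → ∣dart∣≤1 (at i) (at (suc i)) a b))
    where open Cycle c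

  flow-first : ∀ c → flow c (Cycle.at c 0) (Cycle.at c 1) ≡ + 1
  flow-first c = trans (Sum-cong k (λ i _ → Counting.crossings c 0 i)) (trans (Counting.count c 0 (s≤s z≤n) k ℕₚ.≤-refl) (ι-yes (0 ℕₚ.<? k) (s≤s z≤n)))

  flow-away : ∀ c {a} b → (∀ i → Cycle.at c i ≢ a) → flow c a b ≡ + 0
  flow-away c b away = Sum-zero k (λ i _ → dart-elsewhere (λ e → away i (proj₁ e)) (λ e → away (suc i) (proj₂ e)))

  Ω : Cycle Δ κ → ℤ
  Ω c = ⟪ W , flow c ⟫

  Ω-map : ∀ g c → Ω (map-cycle Δ g c) ≡ ⟪ W∘ g , flow c ⟫
  Ω-map g c = trans (pairing W (map-cycle Δ g c)) (sym (pairing (W∘ g) c))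

  Ω-cong : ∀ c d → (∀ i → Cycle.at c i ≡ Cycle.at d i) → Ω c ≡ Ω d
  Ω-cong c d e = ⟪⟫-cong W (λ a b → Sum-cong k (λ i _ → cong₂ (λ u v → dart u v a b) (e i) (e (suc i))))

  Ω-bound : ∀ c → ∣ Ω c ∣ ≤ S
  Ω-bound c = W-bound (flow c) (flow-bound c)

  Ω-nonzero : ∀ c → 1 ≤ ∣ Ω c ∣
  Ω-nonzero c with ∣ Ω c ∣ in eq
  ... | suc _ = s≤s z≤n
  ... | zero = ⊥-elim (one≢zero (trans (sym (flow-first c)) (W-sep (flow c) (λ _ _ → + 0) (flow-bound c) (λ _ _ → z≤n)
      (trans (ℤₚ.∣i∣≡0⇒i≡0 eq) (sym (⟪⟫-zero W))) (Cycle.at c 0) (Cycle.at c 1))))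
    where
    one≢zero : ¬ (+ 1 ≡ + 0)
    one≢zero ()

  -- For β = g⁻¹α the hypothesis says that β multiplies all weights of cycles by one ratio. Along
  -- the β-orbit of a cycle the sizes form a bounded geometric progression of positive integers, so
  -- the ratio is 1 or -1, and the digits give that `c` and its image have the same flow up to sign.
  -- If α and g differ at `v`, a cycle through `v · g` whose image misses this vertex is a
  -- counterexample.
  proportional : Separating Δ κ → ∀ α g →
    (∀ d d′ → Ω (map-cycle Δ g d) *ᶻ Ω (map-cycle Δ α d′) ≡ Ω (map-cycle Δ g d′) *ᶻ Ω (map-cycle Δ α d)) → α A.≈ g
  proportional sep α g hyp v = decidable-stable (v · α Finₚ.≟ v · g) λ ne → separated ne (sep (v · g) (v · g · β ⁻) (λ e → ne (trans (sym (moved e)) refl)))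
    where
    _⁻ : Automorphism Δ → Automorphism Δ
    _⁻ = A._⁻¹
    β : Automorphism Δ
    β = (g ⁻) A.∙ α
    moved : v · g ≡ v · g · β ⁻ → v · g ≡ v · α
    moved e = trans (sym (trans (cong (_· β) e) (Perm.inverseʳ (Automorphism.perm β)))) (cong (_· α) (Perm.inverseˡ (Automorphism.perm g)))
    swap : ∀ D D′ → Ω D *ᶻ Ω (map-cycle Δ β D′) ≡ Ω D′ *ᶻ Ω (map-cycle Δ β D)
    swap D D′ = subst₂ (λ a b → a *ᶻ Ω (map-cycle Δ β D′) ≡ b *ᶻ Ω (map-cycle Δ β D)) (undo D) (undo D′) (hyp (map-cycle Δ (g ⁻) D) (map-cycle Δ (g ⁻) D′))
      where
      undo : ∀ D → Ω (map-cycle Δ g (map-cycle Δ (g ⁻) D)) ≡ Ω D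
      undo D = Ω-cong (map-cycle Δ g (map-cycle Δ (g ⁻) D)) D (λ i → Perm.inverseʳ (Automorphism.perm g))
    separated : v · α ≢ v · g → Σ[ c ∈ Cycle Δ κ ] Cycle.at c 0 ≡ v · g × (∀ i → Cycle.at c i ≢ v · g · β ⁻) → ⊥
    separated ne (c , c₀ , avoid) = conclude (same-abs (Ω c) (Ω (map-cycle Δ β c)) (geometric A S (λ j → Ω-nonzero (D j)) (λ j → Ω-bound (D j)) progression))
      where
      D : ℕ → Cycle Δ κ
      D zero = c
      D (suc j) = map-cycle Δ β (D j)
      A : ℕ → ℕ
      A j = ∣ Ω (D j) ∣
      progression : ∀ j → A j * A (suc (suc j)) ≡ A (suc j) * A (suc j)
      progression j = trans (sym (ℤₚ.abs-* (Ω (D j)) (Ω (D (suc (suc j)))))) (trans (cong ∣_∣ (swap (D j) (D (suc j)))) (ℤₚ.abs-* (Ω (D (suc j))) (Ω (D (suc j)))))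
      βc = map-cycle Δ β c
      zero-flow : flow βc (Cycle.at c 0) (Cycle.at c 1) ≡ + 0
      zero-flow = flow-away βc (Cycle.at c 1) (λ i e → avoid i (trans (sym (Perm.inverseˡ (Automorphism.perm β))) (cong (_· (β ⁻)) (trans e c₀))))
      one≢zero : ¬ (+ 1 ≡ + 0)
      one≢zero ()
      conclude : Ω c ≡ Ω βc ⊎ Ω c ≡ neg (Ω βc) → ⊥
      conclude (inj₁ e) = one≢zero (trans (sym (flow-first c)) (trans (W-sep (flow c) (flow βc) (flow-bound c) (flow-bound βc) e _ _) zero-flow))
      conclude (inj₂ e) = one≢zero (trans (sym (flow-first c)) (trans
        (W-sep (flow c) (λ a b → ℤ.-1ℤ *ᶻ flow βc a b) (flow-bound c) (λ a b → subst (_≤ k) (trans (sym (ℤₚ.∣-i∣≡∣i∣ (flow βc a b))) (cong ∣_∣ (sym (ℤₚ.-1*i≡-i (flow βc a b))))) (flow-bound βc a b))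
          (trans e (sym (trans (⟪⟫-* ℤ.-1ℤ W (flow βc)) (ℤₚ.-1*i≡-i (Ω βc))))) _ _)
        (cong (ℤ.-1ℤ *ᶻ_) zero-flow)))

-- Two covers over a graph with separating cycles

c-diffˡ : ∀ {q a b a′ b′} → Cong q (a′ -ᶻ b′) (a -ᶻ b) → Cong q a a′ → Cong q b b′
c-diffˡ {q} {a} {b} {a′} {b′} d e = cong-by (∣m∣n⇒∣m+n (Cong.difference d) (Cong.difference e))
  (solve 4 (λ a b a′ b′ → b :- b′ := ((a′ :- b′) :- (a :- b)) :+ (a :- a′)) refl a b a′ b′)

c-diffʳ : ∀ {q a b a′ b′} → Cong q (a′ -ᶻ b′) (a -ᶻ b) → Cong q b b′ → Cong q a a′
c-diffʳ {q} {a} {b} {a′} {b′} d e = cong-by (∣m∣n⇒∣m-n (Cong.difference e) (Cong.difference d))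
  (solve 4 (λ a b a′ b′ → a :- a′ := (b :- b′) :- ((a′ :- b′) :- (a :- b))) refl a b a′ b′)

Sum-first : ∀ n f → (∀ i → i < n → f (suc i) ≡ + 0) → Sum (suc n) f ≡ f 0
Sum-first zero f z = ℤₚ.+-identityˡ (f 0)
Sum-first (suc n) f z = trans (cong₂ _+ᶻ_ (Sum-first n f λ i i<n → z i (ℕₚ.m≤n⇒m≤1+n i<n)) (z n ℕₚ.≤-refl)) (ℤₚ.+-identityʳ (f 0))

module Tower {ℓ₁ ℓ₂} {H : Group ℓ₁ ℓ₂} (L₀ : OrientedAction H) (κ : ℕ)
  (cr : Crossing (OrientedAction.Γ L₀) κ) (sep : Separating (OrientedAction.Γ L₀) κ)
  (hn : ℕ) (hs : Fin hn → Group.Carrier H) (enum : ∀ x → Σ[ i ∈ Fin hn ] Group._≈_ H x (hs i)) where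

  private
    module L₀ = OrientedAction L₀
    Δ₀ = L₀.Γ
    k = suc κ
    module A₀ = Group (Aut Δ₀)
    infixl 8 _·₀_ _·₁_ _·₂_
    _·₀_ = _^^_ Δ₀

  open Weights Δ₀ κ

  opaque
    -- The summands serve, in order, the lifting of cycles, the projection of automorphisms,
    -- coprimality to 3, the nonvanishing modulo `q₁` of weights of cycles, and the invertibility of
    -- the determinants in `killer`.
    M₁ : ℕ
    M₁ = k + (Threshold.enough Δ₀ L₀.connected κ + (3 + (S + (S * S + S * S))))

    k≤M₁ : k ≤ M₁
    k≤M₁ = ℕₚ.m≤m+n k _

    enough≤M₁ : Threshold.enough Δ₀ L₀.connected κ ≤ M₁
    enough≤M₁ = ℕₚ.≤-trans (ℕₚ.m≤m+n _ _) (ℕₚ.m≤n+m _ k)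

    3≤M₁ : 3 ≤ M₁
    3≤M₁ = ℕₚ.≤-trans (ℕₚ.≤-trans (ℕₚ.m≤m+n 3 _) (ℕₚ.m≤n+m _ _)) (ℕₚ.m≤n+m _ k)

    S≤M₁ : S ≤ M₁
    S≤M₁ = ℕₚ.≤-trans (ℕₚ.≤-trans (ℕₚ.≤-trans (ℕₚ.m≤m+n S _) (ℕₚ.m≤n+m _ 3)) (ℕₚ.m≤n+m _ _)) (ℕₚ.m≤n+m _ k)

    S²≤M₁ : S * S + S * S ≤ M₁
    S²≤M₁ = ℕₚ.≤-trans (ℕₚ.≤-trans (ℕₚ.≤-trans (ℕₚ.m≤n+m _ S) (ℕₚ.m≤n+m _ 3)) (ℕₚ.m≤n+m _ _)) (ℕₚ.m≤n+m _ k)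

  private
    q₁ = big M₁
    module C₁ = Cover Δ₀ 0 Plain.none Plain.none? M₁ L₀.base
    module P₁ = Projection Δ₀ 0 Plain.none Plain.none? M₁ L₀.base κ
    module T₁ = Translations Δ₀ 0 Plain.none Plain.none? M₁ L₀.base
    module Ln = Lines Δ₀ M₁ L₀.base κ k≤M₁
    Δ₁ = C₁.cover
    module A₁ = Group (Aut Δ₁)
    _·₁_ = _^^_ Δ₁

  L₁ : OrientedAction H
  L₁ = plain-level L₀ M₁

  -- The relations attached to the given automorphisms

  private
    N₀ = Graph.size Δ₀
    R = N₀ * hn

    -- An automorphism in `𝒢` is one fixing the base followed by a chosen one moving the base, so
    -- pairs of a vertex and an element of H index them all.
    auto : Fin R → Automorphism Δ₀
    auto r = L₀.act (hs (proj₂ (Fin.remQuot {N₀} hn r))) A₀.∙ proj₁ (L₀.transitive L₀.base (proj₁ (Fin.remQuot {N₀} hn r)))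

    auto-𝒢 : ∀ r → L₀.𝒢 (auto r)
    auto-𝒢 r = L₀.𝒢-∙ (L₀.act-𝒢 _) (proj₁ (proj₂ (L₀.transitive L₀.base (proj₁ (Fin.remQuot {N₀} hn r)))))

    auto-all : ∀ α → L₀.𝒢 α → Σ[ r ∈ Fin R ] α A₀.≈ auto r
    auto-all α α∈ = Fin.combine u i , λ v → trans (sym (Perm.inverseʳ (Automorphism.perm t)))
        (trans (cong (_·₀ t) (trans (proj₂ stab v) (L₀.act-cong (proj₂ (enum h)) v)))
          (cong (λ x → v ·₀ (L₀.act (hs (proj₂ x)) A₀.∙ proj₁ (L₀.transitive L₀.base (proj₁ x)))) (sym (Finₚ.remQuot-combine u i))))
      where
      u = L₀.base ·₀ α
      t = proj₁ (L₀.transitive L₀.base u)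
      stab = L₀.act-sur (α A₀.∙ (t A₀.⁻¹)) (L₀.𝒢-∙ α∈ (L₀.𝒢-⁻¹ (proj₁ (proj₂ (L₀.transitive L₀.base u)))))
        (trans (cong (_·₀ (t A₀.⁻¹)) (sym (proj₂ (proj₂ (L₀.transitive L₀.base u))))) (Perm.inverseˡ (Automorphism.perm t)))
      h = proj₁ stab
      i = proj₁ (enum h)

    -- An index of the identity, obtained as a product with an inverse because `𝒢` is only given
    -- closed under these operations.
    r₀ : Fin R
    r₀ = proj₁ (auto-all (L₀.act (Group.ε H) A₀.∙ (L₀.act (Group.ε H) A₀.⁻¹)) (L₀.𝒢-∙ (L₀.act-𝒢 _) (L₀.𝒢-⁻¹ (L₀.act-𝒢 _))))

    auto-r₀ : ∀ v → v ·₀ auto r₀ ≡ v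
    auto-r₀ v = trans (sym (proj₂ (auto-all (L₀.act (Group.ε H) A₀.∙ (L₀.act (Group.ε H) A₀.⁻¹)) (L₀.𝒢-∙ (L₀.act-𝒢 _) (L₀.𝒢-⁻¹ (L₀.act-𝒢 _)))) v))
      (Perm.inverseˡ (Automorphism.perm (L₀.act (Group.ε H))))

    height : Fin R → C₁.V̂ → ℤ
    height r z = ⟪ W∘ (auto r) , C₁.m z zero ⟫

    -- Classes stay inside a fibre, so a crossing between classes still shows which arc of the base
    -- was used.
    E : Fin R → C₁.V̂ → C₁.V̂ → Set
    E r z z′ = C₁.p z ≡ C₁.p z′ × Cong q₁ (height r z) (height r z′)

    E? : ∀ r z z′ → Dec (E r z z′)
    E? r z z′ = (C₁.p z Finₚ.≟ C₁.p z′) ×-dec c? (height r z) (height r z′)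

    E-sym : ∀ {r z z′} → E r z z′ → E r z′ z
    E-sym (e , f) = sym e , c-sym f

    E-trans : ∀ {r z z′ z″} → E r z z′ → E r z′ z″ → E r z z″
    E-trans (e , f) (e′ , f′) = trans e e′ , c-trans f f′

    -- `auto (ρ r)` is `g₀` followed by `auto r`. Hence the heights for `r` at image points and
    -- those for `ρ r` at the points themselves differ by a constant.
    compatible : ∀ g → OrientedAction.𝒢 L₁ g → Σ[ ρ ∈ (Fin R → Fin R) ] (∀ r u v → E r (u ·₁ g) (v ·₁ g) ⇔ E (ρ r) u v)
    compatible g (g₀ , g₀∈ , g↓) = ρ , λ r u v → mk⇔
        (λ e → ^^-inj Δ₀ g₀ (trans (sym (g↓ u)) (trans (proj₁ e) (g↓ v))) , c-diffˡ (transported r u v) (proj₂ e))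
        (λ e → trans (g↓ u) (trans (cong (_·₀ g₀) (proj₁ e)) (sym (g↓ v))) , c-diffʳ (transported r u v) (proj₂ e))
      where
      ρ : Fin R → Fin R
      ρ r = proj₁ (auto-all (g₀ A₀.∙ auto r) (L₀.𝒢-∙ g₀∈ (auto-𝒢 r)))
      ρ-≈ : ∀ r v → v ·₀ auto (ρ r) ≡ v ·₀ g₀ ·₀ auto r
      ρ-≈ r v = sym (proj₂ (auto-all (g₀ A₀.∙ auto r) (L₀.𝒢-∙ g₀∈ (auto-𝒢 r))) v)
      transported : ∀ r u v → Cong q₁ (height r (v ·₁ g) -ᶻ height (ρ r) v) (height r (u ·₁ g) -ᶻ height (ρ r) u)
      transported r = T₁.height-transport (W∘ (auto r)) (W∘ (auto (ρ r))) g g₀ g↓ (λ a b → cong₂ W (ρ-≈ r a) (ρ-≈ r b))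

  opaque
    M₂ : ℕ
    M₂ = Threshold.enough Δ₁ C₁.cover-connected Ln.κ′ + 3

    enough≤M₂ : Threshold.enough Δ₁ C₁.cover-connected Ln.κ′ ≤ M₂
    enough≤M₂ = ℕₚ.m≤m+n _ 3

    3≤M₂ : 3 ≤ M₂
    3≤M₂ = ℕₚ.m≤n+m 3 _

  private
    module C₂ = Cover Δ₁ R E E? M₂ C₁.root
    module P₂ = Projection Δ₁ R E E? M₂ C₁.root Ln.κ′
    module T₂ = Translations Δ₁ R E E? M₂ C₁.root
    Δ₂ = C₂.cover
    module A₂ = Group (Aut Δ₂)
    _·₂_ = _^^_ Δ₂

  L₂ : OrientedAction H
  L₂ = CoverLevel.level L₁ R E E? M₂ compatible

  private
    -- A deck transformation changes each height by a constant. Nothing of the kind is known for an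
    -- automorphism such as `α₁` below, but its conjugates of deck transformations are deck
    -- transformations again, and so act on memories in a known way.
    deck-compatible : ∀ y → C₁.Covers y A₀.ε → C₂.Compatible y
    deck-compatible y y↓ = id , λ r u v → mk⇔
        (λ e → trans (sym (y↓ u)) (trans (proj₁ e) (y↓ v)) , c-diffˡ (shifted r u v) (proj₂ e))
        (λ e → trans (y↓ u) (trans (proj₁ e) (sym (y↓ v))) , c-diffʳ (shifted r u v) (proj₂ e))
      where
      shifted : ∀ r u v → Cong q₁ (height r (v ·₁ y) -ᶻ height r v) (height r (u ·₁ y) -ᶻ height r u)
      shifted r = T₁.height-transport (W∘ (auto r)) (W∘ (auto r)) y A₀.ε y↓ (λ a b → refl)

    Saturated : C₂.Memory → Set
    Saturated x = ∀ r {a a′ b b′} → E r a a′ → E r b b′ → Cong 3 (x (suc r) a b) (x (suc r) a′ b′)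

    ν-saturated : ∀ u v → Saturated (C₂.ν u v)
    ν-saturated u v r {a} {a′} {b} {b′} e f = c-reflexive (cong₂ _-ᶻ_ (cong₂ _*ᶻ_ (move u e) (move v f)) (cong₂ _*ᶻ_ (move v e) (move u f)))
      where
      move : ∀ u {a a′} → E r a a′ → ι (E? r u a) ≡ ι (E? r u a′)
      move u {a} {a′} e = ι-⇔ (E? r u a) (E? r u a′) (λ d → E-trans {r} {u} {a} {a′} d e) (λ d → E-trans {r} {u} {a′} {a} d (E-sym {r} {a} {a′} e))

    m-saturated : ∀ z → Saturated (C₂.m z)
    m-saturated z = go (C₂.cover-connected C₂.root z) root-saturated
      where
      root-saturated : Saturated (C₂.m C₂.root)
      root-saturated r e f = c-trans (C₂.m-root (suc r) _ _) (c-sym (C₂.m-root (suc r) _ _))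
      go : ∀ {y} → Star C₂._~̂_ y z → Saturated (C₂.m y) → Saturated (C₂.m z)
      go done s = s
      go {y} (_◅_ {j = y′} a as) s = go as λ r e f → c-trans (C₂.~-m a (suc r) _ _)
        (c-trans (c-+ (s r e f) (ν-saturated (C₂.p y) (C₂.p y′) r e f)) (c-sym (C₂.~-m a (suc r) _ _)))

    shift-saturated : ∀ τ {μ} → C₂.Shifts τ μ → Saturated μ
    shift-saturated τ {μ} s r {a} {a′} {b} {b′} e f = c-trans (c-sym (c-unmove _ _ (proj₂ (s C₂.root) (suc r) a b)))
      (c-trans (c-- (m-saturated (C₂.root ·₂ τ) r e f) (m-saturated C₂.root r e f)) (c-unmove _ _ (proj₂ (s C₂.root) (suc r) a′ b′)))

    cycle-shift : ∀ (d : Cycle Δ₀ κ) → Σ[ τ ∈ Automorphism Δ₁ ] C₁.Shifts τ (P₁.Along.turn d)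
    cycle-shift d = proj₁ dk , T₁.shifts-cong (proj₁ dk)
        (λ r a b → c-unmove _ _ (c-trans (c-reflexive (cong (λ y → C₁.m y r a b) (proj₂ (proj₂ dk))))
          (c-trans (P₁.Along.turn-memory d ℓ 0 0 ℓa (λ i _ → ℓp i) r a b) (c-reflexive (cong (λ y → C₁.m y r a b +ᶻ P₁.Along.turn d r a b) ℓ₀)))))
        (C₁.deck-shifts (proj₁ dk) (proj₁ (proj₂ dk)) z)
      where
      open Cycle d
      z = proj₁ (C₁.p-surjective L₀.connected (at 0))
      walk = C₁.lift-walk at adj z (proj₂ (C₁.p-surjective L₀.connected (at 0)))
      ℓ = proj₁ walk
      ℓ₀ = proj₁ (proj₂ walk)
      ℓp = proj₁ (proj₂ (proj₂ walk))
      ℓa = proj₂ (proj₂ (proj₂ walk))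
      dk = C₁.deck z (ℓ k) (trans (cong C₁.p (sym ℓ₀)) (trans (ℓp 0) (trans (sym (per 0)) (sym (ℓp k)))))

  -- An automorphism descending to none of the given ones

  module _ (α : Automorphism Δ₂) where
    private
      α₁ = proj₁ (P₂.project C₁.cover-connected (Ln.separating cr) enough≤M₂ α)

      α↓ : C₂.Covers α α₁
      α↓ = proj₂ (P₂.project C₁.cover-connected (Ln.separating cr) enough≤M₂ α)

      α₀ = proj₁ (P₁.project L₀.connected sep enough≤M₁ α₁)

      α₁↓ : C₁.Covers α₁ α₀
      α₁↓ = proj₂ (P₁.project L₀.connected sep enough≤M₁ α₁)

      module Bad (bad : ∀ r → ¬ (α₀ A₀.≈ auto r)) where

        -- The two bounds make the value seen by `α₀` invertible modulo `q₁`, so that powers of the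
        -- conjugated translation reach every height.
        Killer : Fin R → Set
        Killer r = Σ[ y ∈ Automorphism Δ₁ ] Σ[ μ ∈ C₁.Memory ] C₁.Shifts y μ × ⟪ W∘ (auto r) , μ zero ⟫ ≡ + 0 ×
          1 ≤ ∣ ⟪ W∘ α₀ , μ zero ⟫ ∣ × ∣ ⟪ W∘ α₀ , μ zero ⟫ ∣ ≤ M₁

        -- The turns of `d` and `d′` are combined with coefficients orthogonal to their weights
        -- under `g`; the value under `α₀` is then a determinant. `proportional` refutes that all
        -- these determinants vanish, and a double negation is enough on the way to a contradiction.
        killer : ∀ r → ¬ ¬ Killer r
        killer r none = bad r (proportional sep α₀ g λ d d′ → decidable-stable (_ ℤₚ.≟ _) λ ne → none (build d d′ ne))
          where
          g = auto r
          build : ∀ d d′ → Ω (map-cycle Δ₀ g d) *ᶻ Ω (map-cycle Δ₀ α₀ d′) ≢ Ω (map-cycle Δ₀ g d′) *ᶻ Ω (map-cycle Δ₀ α₀ d) → Killer r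
          build d d′ ne = proj₁ y₁ A₁.∙ proj₁ y₂ , μ , T₁.shifts-∙ (proj₁ y₁) (proj₁ y₂) (proj₂ y₁) (proj₂ y₂) ,
              trans (value g) (solve 2 (λ x y → y :* x :+ :- x :* y := con (+ 0)) refl (Ω (map-cycle Δ₀ g d)) (Ω (map-cycle Δ₀ g d′))) ,
              subst (1 ≤_) (cong ∣_∣ (sym s≡)) (positive _ λ e → ne (sym (ℤₚ.i-j≡0⇒i≡j _ _ e))) ,
              subst (_≤ M₁) (cong ∣_∣ (sym s≡)) (ℕₚ.≤-trans (∣i-j∣≤ (Ω (map-cycle Δ₀ g d′) *ᶻ Ω (map-cycle Δ₀ α₀ d)) _)
                (ℕₚ.≤-trans (ℕₚ.+-mono-≤ (small (map-cycle Δ₀ g d′) (map-cycle Δ₀ α₀ d)) (small (map-cycle Δ₀ g d) (map-cycle Δ₀ α₀ d′))) S²≤M₁))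
            where
            A = Ω (map-cycle Δ₀ g d′)
            B = neg (Ω (map-cycle Δ₀ g d))
            y₁ = T₁.shifts-multiple (proj₁ (cycle-shift d)) (proj₂ (cycle-shift d)) A
            y₂ = T₁.shifts-multiple (proj₁ (cycle-shift d′)) (proj₂ (cycle-shift d′)) B
            μ : C₁.Memory
            μ = T₁.scale A (P₁.Along.turn d) C₁.⊞ T₁.scale B (P₁.Along.turn d′)
            value : ∀ g → ⟪ W∘ g , μ zero ⟫ ≡ A *ᶻ Ω (map-cycle Δ₀ g d) +ᶻ B *ᶻ Ω (map-cycle Δ₀ g d′)
            value g = trans (⟪⟫-+ (W∘ g) (λ a b → A *ᶻ flow d a b) (λ a b → B *ᶻ flow d′ a b))
              (cong₂ _+ᶻ_ (trans (⟪⟫-* A (W∘ g) (flow d)) (cong (A *ᶻ_) (sym (Ω-map g d)))) (trans (⟪⟫-* B (W∘ g) (flow d′)) (cong (B *ᶻ_) (sym (Ω-map g d′)))))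
            s≡ : ⟪ W∘ α₀ , μ zero ⟫ ≡ Ω (map-cycle Δ₀ g d′) *ᶻ Ω (map-cycle Δ₀ α₀ d) -ᶻ Ω (map-cycle Δ₀ g d) *ᶻ Ω (map-cycle Δ₀ α₀ d′)
            s≡ = trans (value α₀) (cong (A *ᶻ Ω (map-cycle Δ₀ α₀ d) +ᶻ_) (sym (ℤₚ.neg-distribˡ-* (Ω (map-cycle Δ₀ g d)) (Ω (map-cycle Δ₀ α₀ d′)))))
            small : ∀ c d → ∣ Ω c *ᶻ Ω d ∣ ≤ S * S
            small c d = subst (_≤ S * S) (sym (ℤₚ.abs-* (Ω c) (Ω d))) (ℕₚ.*-mono-≤ (Ω-bound c) (Ω-bound d))
            positive : ∀ i → i ≢ + 0 → 1 ≤ ∣ i ∣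
            positive (+ zero) ne = ⊥-elim (ne refl)
            positive (+ suc _) ne = s≤s z≤n
            positive -[1+ _ ] ne = s≤s z≤n

        cyc cyc′ : Cycle Δ₀ κ
        cyc = proj₁ (cr L₀.base)
        cyc′ = proj₁ (proj₂ (cr L₀.base))

        v∗ w∗ : Graph.Vertex Δ₀
        v∗ = Cycle.at cyc 0
        w∗ = Cycle.at cyc 1

        cyc′₀ : Cycle.at cyc′ 0 ≡ v∗
        cyc′₀ = trans (proj₁ (proj₂ (proj₂ (proj₂ (cr L₀.base))))) (sym (proj₁ (proj₂ (proj₂ (cr L₀.base)))))

        avoids : Avoids Δ₀ cyc′ v∗ w∗
        avoids = proj₁ (proj₂ (proj₂ (proj₂ (proj₂ (cr L₀.base)))))

        -- Among lifts of one fixed arc, the classes of both ends under `r₀` depend only on the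
        -- height of the start (`pair-E`). A memory restricted to them is thus a function of a
        -- residue modulo `q₁`.
        Pair : C₁.V̂ → C₁.V̂ → Set
        Pair z z₁ = C₁.p z ≡ v∗ × C₁.p z₁ ≡ w∗ × (z C₁.~̂ z₁)

        -- Being nonzero would not survive the passage to differences in a commutator; being
        -- nonconstant does.
        Constant : C₂.Memory → Set
        Constant μ = ∀ {z z₁ z′ z₁′} → Pair z z₁ → Pair z′ z₁′ → Cong 3 (μ (suc r₀) z z₁) (μ (suc r₀) z′ z₁′)

        h : C₁.V̂ → ℤ
        h = height r₀

        ψ∗ : ℤ
        ψ∗ = W∘ (auto r₀) v∗ w∗ -ᶻ W∘ (auto r₀) w∗ v∗

        pair-height : ∀ {z z₁} → Pair z z₁ → Cong q₁ (h z₁) (h z +ᶻ ψ∗)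
        pair-height {z} {z₁} (e , e₁ , a) = c-trans (P₁.Height.step-height (W∘ (auto r₀)) {z} {z₁} a)
          (c-reflexive (cong₂ (λ u v → h z +ᶻ (W∘ (auto r₀) u v -ᶻ W∘ (auto r₀) v u)) e e₁))

        pair-E : ∀ {z z₁ z′ z₁′} → Pair z z₁ → Pair z′ z₁′ → Cong q₁ (h z) (h z′) → E r₀ z z′ × E r₀ z₁ z₁′
        pair-E {z} {z₁} {z′} {z₁′} P P′ e = (trans (proj₁ P) (sym (proj₁ P′)) , e) ,
          (trans (proj₁ (proj₂ P)) (sym (proj₁ (proj₂ P′))) , c-trans (pair-height P) (c-trans (c-+ʳ ψ∗ e) (c-sym (pair-height P′))))

        -- The commutators start from the deck transformation comparing two closed walks traversed in either order.
        record Run (d : Cycle Δ₀ κ) (z : C₁.V̂) (ẑ : C₂.V̂) : Set where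
          field
            line   : ℕ → C₁.V̂
            line₀  : line 0 ≡ z
            line-p : ∀ i → C₁.p (line i) ≡ Cycle.at d i
            line-~ : ∀ i → line i C₁.~̂ line (suc i)
            end    : C₂.V̂
            end-p  : C₂.p end ≡ line k
            end-m  : C₂.m end C₂.≋ C₂.m ẑ C₂.⊞ (λ r a b → Sum k (λ i → C₂.ν (line i) (line (suc i)) r a b))

          finish : C₁.V̂
          finish = line k

          finish-p : C₁.p finish ≡ Cycle.at d 0
          finish-p = trans (line-p k) (Cycle.per d 0)

          finish-m : C₁.m finish C₁.≋ C₁.m z C₁.⊞ P₁.Along.turn d
          finish-m r a b = c-trans (P₁.Along.turn-memory d line 0 0 line-~ (λ i _ → line-p i) r a b)
            (c-reflexive (cong (λ y → C₁.m y r a b +ᶻ P₁.Along.turn d r a b) line₀))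

        run : ∀ d z → C₁.p z ≡ Cycle.at d 0 → ∀ ẑ → C₂.p ẑ ≡ z → Run d z ẑ
        run d z e ẑ ê = record
          { line = proj₁ walk ; line₀ = proj₁ (proj₂ walk) ; line-p = proj₁ (proj₂ (proj₂ walk)) ; line-~ = proj₂ (proj₂ (proj₂ walk))
          ; end = proj₁ ŵalk k ; end-p = proj₁ (proj₂ (proj₂ ŵalk)) k
          ; end-m = λ r a b → c-trans (P₂.walk-memory (proj₁ ŵalk) (proj₂ (proj₂ (proj₂ ŵalk))) k r a b)
              (c-reflexive (cong₂ _+ᶻ_ (cong (λ y → C₂.m y r a b) (proj₁ (proj₂ ŵalk)))
                (Sum-cong k (λ i _ → cong₂ (λ u v → C₂.ν u v r a b) (proj₁ (proj₂ (proj₂ ŵalk)) i) (proj₁ (proj₂ (proj₂ ŵalk)) (suc i)))))) }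
          where
          walk = C₁.lift-walk (Cycle.at d) (Cycle.adj d) z e
          ŵalk = C₂.lift-walk (proj₁ walk) (proj₂ (proj₂ (proj₂ walk))) ẑ (trans ê (sym (proj₁ (proj₂ walk))))

        products : ∀ {P Q P′ Q′ : Set} (d : Dec P) (e : Dec Q) (d′ : Dec P′) (e′ : Dec Q′) → (P → ¬ Q) → (P′ → ¬ Q′) → ι d *ᶻ ι e -ᶻ ι d′ *ᶻ ι e′ ≡ + 0
        products (yes p) (yes q) d′ e′ f g = ⊥-elim (f p q)
        products d e (yes p′) (yes q′) f g = ⊥-elim (g p′ q′)
        products (yes _) (no _) (yes _) (no _) f g = refl
        products (yes _) (no _) (no _) e′ f g = refl
        products (no _) e (yes _) (no _) f g = refl
        products (no _) e (no _) e′ f g = refl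

        product : ∀ {P Q P′ Q′ : Set} (d : Dec P) (e : Dec Q) (d′ : Dec P′) (e′ : Dec Q′) → (P → Q) → ¬ P′ → ι d *ᶻ ι e -ᶻ ι d′ *ᶻ ι e′ ≡ ι d
        product d e (yes p′) e′ f g = ⊥-elim (g p′)
        product (yes p) e (no _) e′ f g = cong (λ e → + 1 *ᶻ e -ᶻ + 0) (ι-yes e (f p))
        product (no _) e (no _) e′ f g = refl

        -- Only the first step of `cyc` lies over the arc from `v∗` to `w∗`, so a pair is crossed
        -- exactly when its start is equivalent to the start of the lift.
        value : ∀ {z ẑ} (s : Run cyc z ẑ) {a b} → Pair a b → Sum k (λ i → C₂.ν (Run.line s i) (Run.line s (suc i)) (suc r₀) a b) ≡ ι (E? r₀ z a)
        value {z} s {a} {b} P = trans (Sum-first κ f rest) (trans (product (E? r₀ (line 0) a) (E? r₀ (line 1) b) (E? r₀ (line 1) a) (E? r₀ (line 0) b)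
            (λ e → proj₂ (pair-E {line 0} {line 1} {a} {b} (line-p 0 , line-p 1 , line-~ 0) P (proj₂ e)))
            (λ e → Graph.~-irr Δ₀ (subst (Graph._~_ Δ₀ v∗) (trans (sym (line-p 1)) (trans (proj₁ e) (proj₁ P))) (Cycle.adj cyc 0))))
            (cong (λ y → ι (E? r₀ y a)) line₀))
          where
          open Run s
          f : ℕ → ℤ
          f i = C₂.ν (line i) (line (suc i)) (suc r₀) a b
          rest : ∀ i → i < κ → f (suc i) ≡ + 0
          rest i i<κ = products (E? r₀ (line (suc i)) a) (E? r₀ (line (suc (suc i))) b) (E? r₀ (line (suc (suc i))) a) (E? r₀ (line (suc i)) b)
            (λ e _ → no-return (Cycle.inj cyc (s≤s i<κ) (s≤s z≤n) (trans (sym (line-p (suc i))) (trans (proj₁ e) (proj₁ P)))))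
            (λ e e′ → Cycle.norev cyc {suc i} {0} (trans (sym (line-p (suc i))) (trans (proj₁ e′) (proj₁ (proj₂ P)))) (trans (sym (line-p (suc (suc i)))) (trans (proj₁ e) (proj₁ P))))
            where
            no-return : ¬ (suc i ≡ 0)
            no-return ()

        value′ : ∀ {z ẑ} (s : Run cyc′ z ẑ) {a b} → Pair a b → Sum k (λ i → C₂.ν (Run.line s i) (Run.line s (suc i)) (suc r₀) a b) ≡ + 0
        value′ s {a} {b} P = Sum-zero k λ i _ → products (E? r₀ (line i) a) (E? r₀ (line (suc i)) b) (E? r₀ (line (suc i)) a) (E? r₀ (line i) b)
            (λ e e′ → proj₁ (avoids i) (trans (sym (line-p i)) (trans (proj₁ e) (proj₁ P)) , trans (sym (line-p (suc i))) (trans (proj₁ e′) (proj₁ (proj₂ P)))))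
            (λ e e′ → proj₂ (avoids i) (trans (sym (line-p i)) (trans (proj₁ e′) (proj₁ (proj₂ P))) , trans (sym (line-p (suc i))) (trans (proj₁ e) (proj₁ P))))
          where open Run s

        -- The memory of `κ̂` is to disappear relation by relation, that of its conjugate is to stay
        -- nonconstant. As `α` need not respect memories, `μ` and `μ′` are linked only through the
        -- translations themselves.
        record State (j : ℕ) : Set where
          field
            κ̂        : Automorphism Δ₂
            μ μ′     : C₂.Memory
            shifts   : C₂.Shifts κ̂ μ
            shifts′  : C₂.Shifts (T₂.conj α κ̂) μ′
            vanishes : ∀ r → toℕ r < j → ∀ a b → Cong 3 (μ (suc r) a b) (+ 0)
            varies   : ¬ Constant μ′

        start : State 0
        start = record
          -- The known translation `κ̂′` is placed on the conjugate side, where a nonconstant memory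
          -- is needed; at stage 0 no memory of `κ̂` has to vanish.
          { κ̂ = T₂.conj (α A₂.⁻¹) κ̂′ ; μ = _ ; μ′ = μ′
          ; shifts = C₂.deck-shifts (T₂.conj (α A₂.⁻¹) κ̂′) (T₂.conj-covers (α A₂.⁻¹) (α₁ A₁.⁻¹) (T₂.covers-inverse α α₁ α↓) κ̂′ (proj₁ (proj₂ dk))) C₂.root
          ; shifts′ = T₂.shifts-≈ κ̂′ (T₂.conj α (T₂.conj (α A₂.⁻¹) κ̂′))
              (λ y → sym (trans (Perm.inverseʳ (Automorphism.perm α)) (cong (_·₂ κ̂′) (Perm.inverseʳ (Automorphism.perm α)))))
              (C₂.deck-shifts κ̂′ (proj₁ (proj₂ dk)) (Run.end s₂′))
          ; vanishes = λ _ () ; varies = varies }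
          where
          ẑ₀ = proj₁ (C₂.p-surjective C₁.cover-connected (proj₁ (C₁.p-surjective L₀.connected v∗)))
          z₀ = C₂.p ẑ₀
          z₀-p : C₁.p z₀ ≡ v∗
          z₀-p = trans (cong C₁.p (proj₂ (C₂.p-surjective C₁.cover-connected (proj₁ (C₁.p-surjective L₀.connected v∗))))) (proj₂ (C₁.p-surjective L₀.connected v∗))
          s₁ : Run cyc z₀ ẑ₀
          s₁ = run cyc z₀ z₀-p ẑ₀ refl
          s₂ : Run cyc′ (Run.finish s₁) (Run.end s₁)
          s₂ = run cyc′ (Run.finish s₁) (trans (Run.finish-p s₁) (sym cyc′₀)) (Run.end s₁) (Run.end-p s₁)
          s₁′ : Run cyc′ z₀ ẑ₀
          s₁′ = run cyc′ z₀ (trans z₀-p (sym cyc′₀)) ẑ₀ refl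
          z₁′ = Run.finish s₁′
          z₁′-p : C₁.p z₁′ ≡ v∗
          z₁′-p = trans (Run.finish-p s₁′) cyc′₀
          s₂′ : Run cyc z₁′ (Run.end s₁′)
          s₂′ = run cyc z₁′ z₁′-p (Run.end s₁′) (Run.end-p s₁′)
          T T′ : C₁.Memory
          T = P₁.Along.turn cyc
          T′ = P₁.Along.turn cyc′
          same-end : Run.finish s₂′ ≡ Run.finish s₂
          same-end = C₁.uniq (trans (Run.finish-p s₂′) (trans (sym cyc′₀) (sym (Run.finish-p s₂)))) λ r a b →
            c-trans (Run.finish-m s₂′ r a b) (c-trans (c-+ʳ (T r a b) (Run.finish-m s₁′ r a b))
              (c-trans (c-reflexive (solve 3 (λ x y t → (x :+ y) :+ t := (x :+ t) :+ y) refl (C₁.m z₀ r a b) (T′ r a b) (T r a b)))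
                (c-sym (c-trans (Run.finish-m s₂ r a b) (c-+ʳ (T′ r a b) (Run.finish-m s₁ r a b))))))
          dk = C₂.deck (Run.end s₂′) (Run.end s₂) (trans (Run.end-p s₂′) (trans same-end (sym (Run.end-p s₂))))
          κ̂′ = proj₁ dk
          μ′ : C₂.Memory
          μ′ = C₂.m (Run.end s₂′ ·₂ κ̂′) C₂.⊟ C₂.m (Run.end s₂′)
          evaluate : ∀ {a b} → Pair a b → Cong 3 (μ′ (suc r₀) a b) (ι (E? r₀ z₀ a) -ᶻ ι (E? r₀ z₁′ a))
          evaluate {a} {b} P = c-trans (c-- (c-trans (c-reflexive (cong (λ y → C₂.m y (suc r₀) a b) (proj₂ (proj₂ dk))))
              (c-trans (Run.end-m s₂ (suc r₀) a b) (c-+ (Run.end-m s₁ (suc r₀) a b) (c-reflexive (value′ s₂ P)))))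
              (c-trans (Run.end-m s₂′ (suc r₀) a b) (c-+ (Run.end-m s₁′ (suc r₀) a b) (c-reflexive (value s₂′ P)))))
            (c-reflexive (trans (cong₂ (λ u v → ((C₂.m ẑ₀ (suc r₀) a b +ᶻ u) +ᶻ + 0) -ᶻ ((C₂.m ẑ₀ (suc r₀) a b +ᶻ v) +ᶻ ι (E? r₀ z₁′ a))) (value s₁ P) (value′ s₁′ P))
              (solve 3 (λ m x y → ((m :+ x) :+ con (+ 0)) :- ((m :+ con (+ 0)) :+ y) := x :- y) refl (C₂.m ẑ₀ (suc r₀) a b) (ι (E? r₀ z₀ a)) (ι (E? r₀ z₁′ a)))))
          apart : ¬ Cong q₁ (h z₀) (h z₁′)
          apart e = nonzero (c-small {q₁} {x} {+ 0} (c-trans (c-reflexive (solve 2 (λ h x → x := (h :+ x) :- h) refl (h z₀) x))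
              (c-unmove _ _ (c-trans (c-sym moved) (c-trans (c-sym e) (c-reflexive (sym (ℤₚ.+-identityʳ (h z₀))))))))
              (subst (_< q₁) (cong ∣_∣ (sym (ℤₚ.+-identityʳ x))) (ℕₚ.≤-<-trans (ℕₚ.≤-trans (Ω-bound (map-cycle Δ₀ (auto r₀) cyc′)) S≤M₁) (big-> M₁))))
            where
            x = Ω (map-cycle Δ₀ (auto r₀) cyc′)
            moved : Cong q₁ (h z₁′) (h z₀ +ᶻ x)
            moved = c-trans (⟪⟫-mod (W∘ (auto r₀)) (λ a b → Run.finish-m s₁′ zero a b))
              (c-reflexive (trans (⟪⟫-+ (W∘ (auto r₀)) (C₁.m z₀ zero) (flow cyc′)) (cong (h z₀ +ᶻ_) (sym (Ω-map (auto r₀) cyc′)))))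
            nonzero : x ≢ + 0
            nonzero e = ℕₚ.1+n≰n (subst (1 ≤_) (cong ∣_∣ e) (Ω-nonzero (map-cycle Δ₀ (auto r₀) cyc′)))
          varies : ¬ Constant μ′
          -- The entry is 1 at the pair starting in `z₀` and -1 at the one starting in `z₁′`; these
          -- differ modulo 3.
          varies const = absurd (c-small {3} {+ 1} { -[1+ 0 ]} (c-trans (c-reflexive (sym at₀)) (c-trans (c-sym (evaluate P₀)) (c-trans (const P₀ P′) (c-trans (evaluate P′) (c-reflexive at′))))) (s≤s (s≤s (s≤s z≤n))))
            where
            P₀ : Pair z₀ (Run.line s₁ 1)
            P₀ = z₀-p , Run.line-p s₁ 1 , subst (C₁._~̂ Run.line s₁ 1) (Run.line₀ s₁) (Run.line-~ s₁ 0)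
            P′ : Pair z₁′ (Run.line s₂′ 1)
            P′ = z₁′-p , Run.line-p s₂′ 1 , subst (C₁._~̂ Run.line s₂′ 1) (Run.line₀ s₂′) (Run.line-~ s₂′ 0)
            at₀ : ι (E? r₀ z₀ z₀) -ᶻ ι (E? r₀ z₁′ z₀) ≡ + 1
            at₀ = cong₂ _-ᶻ_ (ι-yes (E? r₀ z₀ z₀) (refl , c-refl)) (ι-no (E? r₀ z₁′ z₀) (λ e → apart (c-sym (proj₂ e))))
            at′ : ι (E? r₀ z₀ z₁′) -ᶻ ι (E? r₀ z₁′ z₁′) ≡ -[1+ 0 ]
            at′ = cong₂ _-ᶻ_ (ι-no (E? r₀ z₀ z₁′) (λ e → apart (proj₂ e))) (ι-yes (E? r₀ z₁′ z₁′) (refl , c-refl))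
            absurd : ¬ (+ 1 ≡ -[1+ 0 ])
            absurd ()

        -- Commuting with a killer of the relation j annihilates the memory of that relation, while its
        -- α-conjugate shifts heights by a unit and so cannot make the conjugate memory constant.
        module Step (j : ℕ) (j<R : j < R) (s : State j) (K : Killer (fromℕ< j<R)) where
          open State s
          r = fromℕ< j<R
          y = proj₁ K
          μy = proj₁ (proj₂ K)

          y-shifts : C₁.Shifts y μy
          y-shifts = proj₁ (proj₂ (proj₂ K))

          unit : ℤ
          unit = ⟪ W∘ α₀ , μy zero ⟫

          1≤unit : 1 ≤ ∣ unit ∣
          1≤unit = proj₁ (proj₂ (proj₂ (proj₂ (proj₂ K))))

          unit≤M₁ : ∣ unit ∣ ≤ M₁
          unit≤M₁ = proj₂ (proj₂ (proj₂ (proj₂ (proj₂ K))))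

          y↓ : C₁.Covers y A₀.ε
          y↓ = T₁.shifts-covers y y-shifts

          target = C₂.p-surjective C₁.cover-connected (C₂.p C₂.root ·₁ y)
          ŷ-data = C₂.lift-automorphism y (deck-compatible y y↓) (deck-compatible (y A₁.⁻¹) (T₁.shifts-covers (y A₁.⁻¹) (T₁.shifts-⁻¹ y y-shifts)))
            C₂.root (proj₁ target) (proj₂ target)
          ŷ = proj₁ ŷ-data

          ŷ↓ : C₂.Covers ŷ y
          ŷ↓ = proj₁ (proj₂ ŷ-data)

          y′ : Automorphism Δ₁
          y′ = T₁.conj α₁ y

          y′↓ : C₁.Covers y′ A₀.ε
          y′↓ = T₁.conj-covers α₁ α₀ α₁↓ y y↓

          ŷ′ : Automorphism Δ₂
          ŷ′ = T₂.conj α ŷ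

          ŷ′↓ : C₂.Covers ŷ′ y′
          ŷ′↓ z = trans (α↓ _) (cong (_·₁ α₁) (trans (ŷ↓ (z ·₂ (α A₂.⁻¹))) (cong (_·₁ y) (T₂.covers-inverse α α₁ α↓ z))))

          negated : C₂.Memory → C₂.Memory
          negated x r a b = neg (x r a b)

          κ⁺ : Automorphism Δ₂
          κ⁺ = T₂.conj ŷ κ̂ A₂.∙ (κ̂ A₂.⁻¹)

          μ⁺ μ⁺′ : C₂.Memory
          μ⁺ = C₂.push y id μ C₂.⊞ negated μ
          μ⁺′ = C₂.push y′ id μ′ C₂.⊞ negated μ′

          shifts⁺ : C₂.Shifts κ⁺ μ⁺
          shifts⁺ = T₂.shifts-∙ (T₂.conj ŷ κ̂) (κ̂ A₂.⁻¹) (T₂.conj-shifts ŷ y ŷ↓ (deck-compatible y y↓) κ̂ shifts) (T₂.shifts-⁻¹ κ̂ shifts)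

          κ′ : Automorphism Δ₂
          κ′ = T₂.conj α κ̂

          shifts⁺′ : C₂.Shifts (T₂.conj α κ⁺) μ⁺′
          shifts⁺′ = T₂.shifts-≈ (T₂.conj ŷ′ κ′ A₂.∙ (κ′ A₂.⁻¹)) (T₂.conj α κ⁺)
            (λ z → trans (cong (λ x → x ·₂ κ̂ ·₂ α ·₂ (α A₂.⁻¹) ·₂ ŷ ·₂ α ·₂ (α A₂.⁻¹) ·₂ (κ̂ A₂.⁻¹) ·₂ α) (cancel _))
              (trans (cong (λ x → x ·₂ ŷ ·₂ α ·₂ (α A₂.⁻¹) ·₂ (κ̂ A₂.⁻¹) ·₂ α) (cancel _)) (cong (λ x → x ·₂ (κ̂ A₂.⁻¹) ·₂ α) (cancel _))))
            (T₂.shifts-∙ (T₂.conj ŷ′ κ′) (κ′ A₂.⁻¹) (T₂.conj-shifts ŷ′ y′ ŷ′↓ (deck-compatible y′ y′↓) κ′ shifts′) (T₂.shifts-⁻¹ κ′ shifts′))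
            where
            cancel : ∀ x → x ·₂ α ·₂ (α A₂.⁻¹) ≡ x
            cancel x = Perm.inverseˡ (Automorphism.perm α)

          vanishes⁺ : ∀ i → toℕ i < suc j → ∀ a b → Cong 3 (μ⁺ (suc i) a b) (+ 0)
          vanishes⁺ i (s≤s i≤j) a b = [ old , (λ e → new (Finₚ.toℕ-injective (trans e (sym (Finₚ.toℕ-fromℕ< j<R))))) ]′ (ℕₚ.m≤n⇒m<n∨m≡n i≤j)
            where
            old : toℕ i < j → Cong 3 (μ⁺ (suc i) a b) (+ 0)
            old i<j = c-- (vanishes i i<j (a ·₁ (y A₁.⁻¹)) (b ·₁ (y A₁.⁻¹))) (vanishes i i<j a b)
            level : ∀ i → i ≡ r → ∀ a → E i (a ·₁ (y A₁.⁻¹)) a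
            level i refl a = proj₁ (T₁.shifts-⁻¹ y y-shifts a) , c-sym (c-trans (c-reflexive (cong (height r) (sym (Perm.inverseʳ (Automorphism.perm y)))))
              (c-trans (T₁.shift-height (W∘ (auto r)) y y-shifts (a ·₁ (y A₁.⁻¹))) (c-reflexive (trans (cong (height r (a ·₁ (y A₁.⁻¹)) +ᶻ_) (proj₁ (proj₂ (proj₂ (proj₂ K))))) (ℤₚ.+-identityʳ _)))))
            -- `y` maps every class of this relation to itself, so `push y` leaves a saturated
            -- memory unchanged.
            new : i ≡ r → Cong 3 (μ⁺ (suc i) a b) (+ 0)
            new i≡r = c-trans (c-- (shift-saturated κ̂ {μ} shifts i (level i i≡r a) (level i i≡r b)) (c-refl {x = μ (suc i) a b})) (c-reflexive (ℤₚ.+-inverseʳ (μ (suc i) a b)))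

          -- Transport along `α₁` turns the weight `W∘ α₀` of `y` into the weight for `r₀`, whose
          -- automorphism is the identity.
          raise : ∀ z → Cong q₁ (h (z ·₁ y′)) (h z +ᶻ unit)
          raise z = c-trans (c-move (h (z ·₁ y′)) (g u′) (T₁.height-transport (W∘ (auto r₀)) (W∘ α₀) α₁ α₀ α₁↓ (λ a b → cong₂ W (sym (auto-r₀ _)) (sym (auto-r₀ _))) u u′))
              (c-trans (c-+ (T₁.shift-height (W∘ α₀) y y-shifts u) (c-reflexive (cong (λ x → h x -ᶻ g u) (Perm.inverseʳ (Automorphism.perm α₁)))))
                (c-reflexive (solve 3 (λ g s h → (g :+ s) :+ (h :- g) := h :+ s) refl (g u) unit (h z))))
            where
            g : C₁.V̂ → ℤ
            g z = ⟪ W∘ α₀ , C₁.m z zero ⟫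
            u = z ·₁ (α₁ A₁.⁻¹)
            u′ = u ·₁ y

          t : Automorphism Δ₁
          t = y′ A₁.⁻¹

          tⁿ : ℕ → Automorphism Δ₁
          tⁿ = T₁.pow t

          lower : ∀ n z → Cong q₁ (h (z ·₁ tⁿ n)) (h z +ᶻ + n *ᶻ neg unit)
          lower zero z = c-reflexive (sym (ℤₚ.+-identityʳ (h z)))
          lower (suc n) z = c-trans (lower n (z ·₁ t)) (c-trans (c-+ʳ (+ n *ᶻ neg unit) (c-trans
              (c-reflexive (solve 2 (λ x s → x := (x :+ s) :+ :- s) refl (h (z ·₁ t)) unit))
              (c-+ʳ (neg unit) (c-trans (c-sym (raise (z ·₁ t))) (c-reflexive (cong h (Perm.inverseʳ (Automorphism.perm y′))))))))
            (c-reflexive (solve 3 (λ h s n → (h :+ :- s) :+ n :* :- s := h :+ (con (+ 1) :+ n) :* :- s) refl (h z) unit (+ n))))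

          t-p : ∀ n z → C₁.p (z ·₁ tⁿ n) ≡ C₁.p z
          t-p zero z = refl
          t-p (suc n) z = trans (t-p n (z ·₁ t)) (T₁.covers-inverse y′ A₀.ε y′↓ z)

          t-pair : ∀ n {z z₁} → Pair z z₁ → Pair (z ·₁ tⁿ n) (z₁ ·₁ tⁿ n)
          t-pair n {z} {z₁} (e , e₁ , a) = trans (t-p n z) e , trans (t-p n z₁) e₁ , Equivalence.to (Automorphism.preserve (tⁿ n) z z₁) a

          F : C₁.V̂ → C₁.V̂ → ℤ
          F = μ′ (suc r₀)

          same-level : ∀ {z z₁ z′ z₁′} → Pair z z₁ → Pair z′ z₁′ → Cong q₁ (h z) (h z′) → Cong 3 (F z z₁) (F z′ z₁′)
          same-level {z} {z₁} {z′} {z₁′} P P′ e = shift-saturated κ′ {μ′} shifts′ r₀ (proj₁ (pair-E P P′ e)) (proj₂ (pair-E P P′ e))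

          -- If the difference were a constant `k₀`, the entries would form arithmetic progressions
          -- along powers of `t`. After `q₁` steps the height is back, so `q₁` k₀ and hence k₀ is 0
          -- modulo 3. As `unit` is invertible modulo `q₁`, powers of `t` connect all heights, and
          -- `μ′` would already be constant.
          varies⁺ : ¬ Constant μ⁺′
          varies⁺ const = varies λ {z} {z₁} {z′} {z₁′} P P′ → let (N , e) = big-solve M₁ unit (h z -ᶻ h z′) 1≤unit unit≤M₁ in
              c-trans (c-sym (invariant N P)) (same-level (t-pair N P) P′ (c-trans (lower N z) (c-trans (c-reflexive (cong (h z +ᶻ_) (sym (ℤₚ.neg-distribʳ-* (+ N) unit))))
                (c-trans (c-+ˡ (h z) (c-neg e)) (c-reflexive (solve 2 (λ x y → x :+ :- (x :- y) := y) refl (h z) (h z′)))))))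
            where
            z₀ = proj₁ (C₁.p-surjective L₀.connected v∗)
            z₀-p = proj₂ (C₁.p-surjective L₀.connected v∗)
            next = C₁.lift z₀ {w∗} (subst (λ v → Graph._~_ Δ₀ v w∗) (sym z₀-p) (Cycle.adj cyc 0))
            P₀ : Pair z₀ (proj₁ next)
            P₀ = z₀-p , proj₁ (proj₂ next) , proj₂ (proj₂ next)
            k₀ : ℤ
            k₀ = F (z₀ ·₁ t) (proj₁ next ·₁ t) -ᶻ F z₀ (proj₁ next)
            one : ∀ {z z₁} → Pair z z₁ → Cong 3 (F (z ·₁ t) (z₁ ·₁ t)) (F z z₁ +ᶻ k₀)
            one {z} {z₁} P = c-move (F (z ·₁ t) (z₁ ·₁ t)) (F z z₁) (const P P₀)
            many : ∀ n {z z₁} → Pair z z₁ → Cong 3 (F (z ·₁ tⁿ n) (z₁ ·₁ tⁿ n)) (F z z₁ +ᶻ + n *ᶻ k₀)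
            many zero {z} {z₁} P = c-reflexive (sym (ℤₚ.+-identityʳ (F z z₁)))
            many (suc n) {z} {z₁} P = c-trans (many n (t-pair 1 P)) (c-trans (c-+ʳ (+ n *ᶻ k₀) (one P))
              (c-reflexive (solve 3 (λ f k n → (f :+ k) :+ n :* k := f :+ (con (+ 1) :+ n) :* k) refl (F z z₁) k₀ (+ n))))
            k₀≡0 : Cong 3 k₀ (+ 0)
            k₀≡0 = big-cancel-3 M₁ 3≤M₁ (c-trans (c-reflexive (solve 2 (λ f x → x := (f :+ x) :- f) refl (F z₀ (proj₁ next)) (+ q₁ *ᶻ k₀)))
              (c-unmove _ _ (c-trans (c-sym (many q₁ P₀)) (c-trans (same-level (t-pair q₁ P₀) P₀
                (c-trans (lower q₁ z₀) (c-trans (c-+ˡ (h z₀) (c-multiple (neg unit))) (c-reflexive (ℤₚ.+-identityʳ (h z₀))))))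
                (c-reflexive (sym (ℤₚ.+-identityʳ (F z₀ (proj₁ next)))))))))
            invariant : ∀ n {z z₁} → Pair z z₁ → Cong 3 (F (z ·₁ tⁿ n) (z₁ ·₁ tⁿ n)) (F z z₁)
            invariant n {z} {z₁} P = c-trans (many n P) (c-trans (c-+ˡ (F z z₁) (c-trans (c-*ˡ (+ n) k₀≡0) (c-reflexive (ℤₚ.*-zeroʳ (+ n))))) (c-reflexive (ℤₚ.+-identityʳ (F z z₁))))

          result : State (suc j)
          result = record { κ̂ = κ⁺ ; μ = μ⁺ ; μ′ = μ⁺′ ; shifts = shifts⁺ ; shifts′ = shifts⁺′ ; vanishes = vanishes⁺ ; varies = varies⁺ }

        states : ∀ j → j ≤ R → ¬ ¬ State j
        states zero _ none = none start
        states (suc j) j<R none = states j (ℕₚ.<⇒≤ j<R) λ s → killer (fromℕ< j<R) λ K → none (Step.result j j<R s K)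

        -- With all relation memories gone, only the memory modulo `q₂` is left, so the power `q₂`
        -- of `κ̂` is trivial. The same power of the conjugate is then trivial too, and `q₂` being
        -- prime to 3 its relation memories vanish.
        finished : ¬ State R
        finished s = varies λ {z} {z₁} {z′} {z₁′} _ _ → c-trans (zero′ z z₁) (c-sym (zero′ z′ z₁′))
          where
          open State s
          q₂ = big M₂
          trivial : ∀ z → z ·₂ T₂.pow κ̂ q₂ ≡ z
          trivial z = C₂.uniq (proj₁ (T₂.shifts-pow κ̂ {μ} shifts q₂ z)) λ r a b → c-trans (proj₂ (T₂.shifts-pow κ̂ {μ} shifts q₂ z) r a b)
            (c-trans (c-+ˡ (C₂.m z r a b) (none r a b)) (c-reflexive (ℤₚ.+-identityʳ (C₂.m z r a b))))
            where
            none : ∀ r a b → Cong (C₂.modulus r) (+ q₂ *ᶻ μ r a b) (+ 0)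
            none zero a b = c-multiple (μ zero a b)
            none (suc r) a b = c-trans (c-*ˡ (+ q₂) (vanishes r (Finₚ.toℕ<n r) a b)) (c-reflexive (ℤₚ.*-zeroʳ (+ q₂)))
          conj-pow : ∀ n z → z ·₂ T₂.pow (T₂.conj α κ̂) n ≡ z ·₂ T₂.conj α (T₂.pow κ̂ n)
          conj-pow zero z = sym (Perm.inverseʳ (Automorphism.perm α))
          conj-pow (suc n) z = trans (conj-pow n (z ·₂ T₂.conj α κ̂)) (cong (λ x → x ·₂ T₂.pow κ̂ n ·₂ α) (Perm.inverseˡ (Automorphism.perm α)))
          fixed : C₂.root ·₂ T₂.pow (T₂.conj α κ̂) q₂ ≡ C₂.root
          fixed = trans (conj-pow q₂ C₂.root) (trans (cong (_·₂ α) (trivial (C₂.root ·₂ (α A₂.⁻¹)))) (Perm.inverseʳ (Automorphism.perm α)))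
          zero′ : ∀ a b → Cong 3 (μ′ (suc r₀) a b) (+ 0)
          zero′ a b = big-cancel-3 M₂ 3≤M₂ (c-trans (c-reflexive (solve 2 (λ m x → x := (m :+ x) :- m) refl (C₂.m C₂.root (suc r₀) a b) (+ q₂ *ᶻ μ′ (suc r₀) a b)))
            (c-unmove _ _ (c-trans (c-sym (proj₂ (T₂.shifts-pow (T₂.conj α κ̂) {μ′} shifts′ q₂ C₂.root) (suc r₀) a b))
              (c-reflexive (trans (cong (λ x → C₂.m x (suc r₀) a b) fixed) (sym (ℤₚ.+-identityʳ (C₂.m C₂.root (suc r₀) a b))))))))

    all-lift : OrientedAction.𝒢 L₂ α
    all-lift = decide (Finₚ.any? λ r → Finₚ.all? λ v → v ·₀ α₀ Finₚ.≟ v ·₀ auto r)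
      where
      decide : Dec (Σ[ r ∈ Fin R ] α₀ A₀.≈ auto r) → OrientedAction.𝒢 L₂ α
      decide (yes (r , e)) = α₁ , (auto r , auto-𝒢 r , λ z → trans (α₁↓ z) (e (C₁.p z))) , α↓
      decide (no none) = ⊥-elim (Bad.states (λ r e → none (r , e)) R ℕₚ.≤-refl (Bad.finished λ r e → none (r , e)))

-- Degrees

degree-subset : ∀ (Γ : Graph) v → Graph.degree Γ v ≡ Subset.size (subset (Graph._~_ Γ v) (Graph._~?_ Γ v))
degree-subset Γ v = count size id
  where
  open Graph Γ
  count : ∀ l (g : Fin l → Vertex) → List.length (List.filter (v ~?_) (List.tabulate g)) ≡ Subset.size (subset (λ i → v ~ g i) (λ i → v ~? g i))
  count zero g = refl
  count (suc l) g with v ~? g zero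
  ... | yes _ = cong suc (count l (g ∘ suc))
  ... | no _ = count l (g ∘ suc)

neighbours⇒degree : ∀ (Γ : Graph) v {d} → Neighbours Γ v d → Graph.degree Γ v ≡ d
neighbours⇒degree Γ v nb = trans (degree-subset Γ v) (ℕₚ.≤-antisym (exactly-≤ (exactly (Graph._~?_ Γ v)) nb id) (exactly-≤ nb (exactly (Graph._~?_ Γ v)) id))

degree⇒neighbours : ∀ (Γ : Graph) v {d} → Graph.degree Γ v ≡ d → Neighbours Γ v d
degree⇒neighbours Γ v e = subst (Neighbours Γ v) (trans (sym (degree-subset Γ v)) e) (exactly (Graph._~?_ Γ v))

-- Orders of subgroups

isGroupIsomorphism : ∀ {a b c d} (G : Group a b) (H : Group c d) (f : Group.Carrier G → Group.Carrier H) →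
  (∀ {x y} → Group._≈_ G x y → Group._≈_ H (f x) (f y)) → (∀ x y → Group._≈_ H (f (Group._∙_ G x y)) (Group._∙_ H (f x) (f y))) →
  (∀ {x y} → Group._≈_ H (f x) (f y) → Group._≈_ G x y) → (∀ y → Σ[ x ∈ Group.Carrier G ] Group._≈_ H (f x) y) →
  IsGroupIsomorphism (Group.rawGroup G) (Group.rawGroup H) f
isGroupIsomorphism G H f f-cong f-∙ f-inj f-sur = record
  { isGroupMonomorphism = record
    { isGroupHomomorphism = record
      { isMonoidHomomorphism = record
        { isMagmaHomomorphism = record { isRelHomomorphism = record { cong = f-cong } ; homo = f-∙ }
        ; ε-homo = f-ε }
      ; ⁻¹-homo = λ x → HP.inverseˡ-unique (f (x G.⁻¹)) (f x) (H.trans (H.sym (f-∙ (x G.⁻¹) x)) (H.trans (f-cong (G.inverseˡ x)) f-ε)) }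
    ; injective = f-inj }
  ; surjective = λ y → proj₁ (f-sur y) , λ e → H.trans (f-cong e) (proj₂ (f-sur y)) }
  where
  module G = Group G
  module H = Group H
  module HP = GroupProperties H
  f-ε : f G.ε H.≈ H.ε
  f-ε = HP.identityʳ-unique (f G.ε) (f G.ε) (H.trans (H.sym (f-∙ G.ε G.ε)) (f-cong (G.identityˡ G.ε)))

generated-⊆ : ∀ {c ℓ} (H : Group c ℓ) {S T : Group.Carrier H → Set ℓ} → (∀ {x} → S x → Generated H T x) → ∀ {x} → Generated H S x → Generated H T x
generated-⊆ H f (gen s) = f s
generated-⊆ H f ε′ = ε′
generated-⊆ H f (p ∙′ q) = generated-⊆ H f p ∙′ generated-⊆ H f q
generated-⊆ H f (inv p) = inv (generated-⊆ H f p)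
generated-⊆ H f (resp e p) = resp e (generated-⊆ H f p)

generated-trivial : ∀ {c ℓ} (H : Group c ℓ) {S : Group.Carrier H → Set ℓ} → (∀ {x} → S x → Group._≈_ H x (Group.ε H)) → ∀ {x} → Generated H S x → Group._≈_ H x (Group.ε H)
generated-trivial H f (gen s) = f s
generated-trivial H f ε′ = Group.refl H
generated-trivial H f (p ∙′ q) = Group.trans H (Group.∙-cong H (generated-trivial H f p) (generated-trivial H f q)) (Group.identityˡ H _)
generated-trivial H f (inv p) = Group.trans H (Group.⁻¹-cong H (generated-trivial H f p)) (GroupProperties.ε⁻¹≈ε H)
generated-trivial H f (resp e p) = Group.trans H (Group.sym H e) (generated-trivial H f p)

module Orders {c ℓ} (H : Group c ℓ) (_≟_ : ∀ x y → Dec (Group._≈_ H x y)) where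
  open Group H renaming (refl to ≈-refl; sym to ≈-sym; trans to ≈-trans)
  open GroupProperties H using (⁻¹-involutive; ⁻¹-anti-homo-∙)

  member? : ∀ {S : Carrier → Set ℓ} {k} → HasOrder (⟨_⟩ H S) k → ∀ x → Dec (Generated H S x)
  member? {S} o x = map′ (λ e → resp (proj₂ e) (proj₂ (Inverse.from o (proj₁ e))))
    (λ g → Inverse.to o (x , g) , proj₂ (Inverse.inverse o) refl)
    (Finₚ.any? λ i → proj₁ (Inverse.from o i) ≟ x)

  enum-inj : ∀ {S : Carrier → Set ℓ} {k} (o : HasOrder (⟨_⟩ H S) k) {i j} → proj₁ (Inverse.from o i) ≈ proj₁ (Inverse.from o j) → i ≡ j
  enum-inj o {i} {j} e = trans (sym (proj₁ (Inverse.inverse o) {i} {Inverse.from o i} ≈-refl)) (trans (Inverse.to-cong o {Inverse.from o i} {Inverse.from o j} e) (proj₁ (Inverse.inverse o) {j} {Inverse.from o j} ≈-refl))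

  code-inj : ∀ {S : Carrier → Set ℓ} {k} (o : HasOrder (⟨_⟩ H S) k) {x y : Σ Carrier (Generated H S)} → Inverse.to o x ≡ Inverse.to o y → proj₁ x ≈ proj₁ y
  code-inj o {x} {y} e = ≈-trans (≈-sym (proj₂ (Inverse.inverse o) refl)) (≈-trans (Inverse.from-cong o e) (proj₂ (Inverse.inverse o) refl))

  cancelʳ : ∀ {x y} → (x ∙ y) ∙ y ⁻¹ ≈ x
  cancelʳ {x} {y} = ≈-trans (assoc x y (y ⁻¹)) (≈-trans (∙-congˡ (inverseʳ y)) (identityʳ x))

  cancelˡ : ∀ {x y} → x ⁻¹ ∙ (x ∙ y) ≈ y
  cancelˡ {x} {y} = ≈-trans (≈-sym (assoc (x ⁻¹) x y)) (≈-trans (∙-congʳ (inverseˡ x)) (identityˡ y))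

  module _ {S : Carrier → Set ℓ} {k} (oS : HasOrder (⟨_⟩ H S) k) where
    private
      s : Fin k → Carrier
      s i = proj₁ (Inverse.from oS i)

      s∈ : ∀ i → Generated H S (s i)
      s∈ i = proj₂ (Inverse.from oS i)

    translates : ∀ r → (Fin r → Carrier) → Fin (r * k) → Carrier
    translates r w i = s (proj₂ (Fin.remQuot {r} k i)) ∙ w (proj₁ (Fin.remQuot {r} k i))

    translates-∈ : ∀ {T : Carrier → Set ℓ} → (∀ {x} → Generated H S x → Generated H T x) → ∀ r w → (∀ a → Generated H T (w a)) →
      ∀ i → Generated H T (translates r w i)
    translates-∈ S⊆T r w w∈ i = S⊆T (s∈ _) ∙′ w∈ _

    translates-inj : ∀ r w → (∀ a b → Generated H S (w a ∙ w b ⁻¹) → a ≡ b) → ∀ {i j} → translates r w i ≈ translates r w j → i ≡ j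
    translates-inj r w distinct {i} {j} e = trans (sym (Finₚ.combine-remQuot {r} k i)) (trans (cong (λ x → Fin.combine (proj₁ x) (proj₂ x))
        (pairs _ _ _ _ e)) (Finₚ.combine-remQuot {r} k j))
      where
      quotient : ∀ i j {x y} → s i ∙ x ≈ s j ∙ y → Generated H S (x ∙ y ⁻¹)
      quotient i j {x} {y} e = resp (≈-sym (≈-trans (∙-congʳ (≈-trans (≈-sym cancelˡ) (∙-congˡ e))) (≈-trans (assoc _ _ _) (∙-congˡ cancelʳ)))) (inv (s∈ i) ∙′ s∈ j)
      pairs : ∀ a i b j → s i ∙ w a ≈ s j ∙ w b → (a , i) ≡ (b , j)
      pairs a i b j e with distinct a b (quotient i j e)
      ... | refl = cong (a ,_) (enum-inj oS (≈-trans (≈-sym cancelʳ) (≈-trans (∙-congʳ e) cancelʳ)))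

    translates-hit : ∀ r w a {x} → Generated H S (x ∙ w a ⁻¹) → Σ[ i ∈ Fin (r * k) ] translates r w i ≈ x
    translates-hit r w a {x} g = Fin.combine a i , subst (λ p → s (proj₂ p) ∙ w (proj₁ p) ≈ x) (sym (Finₚ.remQuot-combine a i))
        (≈-trans (∙-congʳ (proj₂ (Inverse.inverse oS) refl)) (≈-trans (assoc _ _ _) (≈-trans (∙-congˡ (inverseˡ _)) (identityʳ x))))
      where i = Inverse.to oS (x ∙ w a ⁻¹ , g)

  hasOrder : ∀ {T : Carrier → Set ℓ} {k} (e : Fin k → Carrier) → (∀ i → Generated H T (e i)) → (∀ {i j} → e i ≈ e j → i ≡ j) →
    (∀ {x} → Generated H T x → Σ[ i ∈ Fin k ] e i ≈ x) → HasOrder (⟨_⟩ H T) k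
  hasOrder e e∈ e-inj e-hit = record
    { to = λ { (x , g) → proj₁ (e-hit g) } ; from = λ i → e i , e∈ i
    ; to-cong = λ { {_ , g} {_ , h} x≈y → e-inj (≈-trans (proj₂ (e-hit g)) (≈-trans x≈y (≈-sym (proj₂ (e-hit h))))) }
    ; from-cong = λ { refl → ≈-refl }
    ; inverse = (λ { {_} {_ , g} x≈ → e-inj (≈-trans (proj₂ (e-hit g)) x≈) }) , λ { {_ , g} refl → proj₂ (e-hit g) } }

  double : ∀ {S T : Carrier → Set ℓ} {k d} → HasOrder (⟨_⟩ H S) k → (∀ {x} → Generated H S x → Generated H T x) → Generated H T d → ¬ Generated H S d →
    (∀ {x} → Generated H T x → Generated H S x ⊎ Generated H S (x ∙ d ⁻¹)) → HasOrder (⟨_⟩ H T) (2 * k)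
  double {S} {T} {k} {d} oS S⊆T d∈T d∉S split = hasOrder (translates oS 2 w) (translates-∈ oS S⊆T 2 w w∈) (translates-inj oS 2 w distinct)
      λ g → [ (λ s → translates-hit oS 2 w zero (resp (≈-sym drop) s)) , translates-hit oS 2 w (suc zero) ]′ (split g)
    where
    w : Fin 2 → Carrier
    w zero = ε
    w (suc zero) = d
    w∈ : ∀ a → Generated H T (w a)
    w∈ zero = ε′
    w∈ (suc zero) = d∈T
    drop : ∀ {x} → x ∙ ε ⁻¹ ≈ x
    drop = ≈-trans (∙-congˡ (GroupProperties.ε⁻¹≈ε H)) (identityʳ _)
    distinct : ∀ a b → Generated H S (w a ∙ w b ⁻¹) → a ≡ b
    distinct zero zero _ = refl
    distinct zero (suc zero) g = ⊥-elim (d∉S (resp (≈-trans (⁻¹-cong (identityˡ _)) (⁻¹-involutive d)) (inv g)))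
    distinct (suc zero) zero g = ⊥-elim (d∉S (resp drop g))
    distinct (suc zero) (suc zero) _ = refl

  cosets : ∀ {S T : Carrier → Set ℓ} {k l} → HasOrder (⟨_⟩ H S) k → HasOrder (⟨_⟩ H T) l → (∀ {x} → Generated H S x → Generated H T x) →
    ∀ r (w : Fin r → Carrier) → (∀ a → Generated H T (w a)) → (∀ a b → Generated H S (w a ∙ w b ⁻¹) → a ≡ b) → r * k ≤ l
  cosets oS oT S⊆T r w w∈ distinct = Finₚ.injective⇒≤ {f = λ i → Inverse.to oT (translates oS r w i , translates-∈ oS S⊆T r w w∈ i)}
    (λ e → translates-inj oS r w distinct (code-inj oT e))

  module _ {S T : Carrier → Set ℓ} {k} (oS : HasOrder (⟨_⟩ H S) k) (oT : HasOrder (⟨_⟩ H T) (2 * k)) (0<k : 0 < k) where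
    -- Otherwise the cosets of `ε`, `x` and `y` would be three disjoint ones in a group with room
    -- for two.
    index-two : (∀ {x} → Generated H S x → Generated H T x) → ∀ {x y} → Generated H T x → Generated H T y →
      ¬ Generated H S x → ¬ Generated H S y → Generated H S (x ∙ y ⁻¹)
    index-two S⊆T {x} {y} x∈ y∈ x∉ y∉ = decidable-stable (member? oS (x ∙ y ⁻¹)) λ q∉ →
        ℕₚ.<⇒≱ (ℕₚ.*-monoˡ-< k {{ℕ.>-nonZero 0<k}} (ℕₚ.n<1+n 2)) (cosets oS oT S⊆T 3 w w∈ (distinct q∉))
      where
      w : Fin 3 → Carrier
      w zero = ε
      w (suc zero) = x
      w (suc (suc zero)) = y
      w∈ : ∀ a → Generated H T (w a)
      w∈ zero = ε′
      w∈ (suc zero) = x∈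
      w∈ (suc (suc zero)) = y∈
      flip∈ : ∀ {x y} → Generated H S (x ∙ y ⁻¹) → Generated H S (y ∙ x ⁻¹)
      flip∈ g = resp (≈-trans (⁻¹-anti-homo-∙ _ _) (∙-congʳ (⁻¹-involutive _))) (inv g)
      drop : ∀ {x} → Generated H S (x ∙ ε ⁻¹) → Generated H S x
      drop g = resp (≈-trans (∙-congˡ (GroupProperties.ε⁻¹≈ε H)) (identityʳ _)) g
      distinct : ¬ Generated H S (x ∙ y ⁻¹) → ∀ a b → Generated H S (w a ∙ w b ⁻¹) → a ≡ b
      distinct q∉ zero zero _ = refl
      distinct q∉ zero (suc zero) g = ⊥-elim (x∉ (drop (flip∈ g)))
      distinct q∉ zero (suc (suc zero)) g = ⊥-elim (y∉ (drop (flip∈ g)))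
      distinct q∉ (suc zero) zero g = ⊥-elim (x∉ (drop g))
      distinct q∉ (suc zero) (suc zero) _ = refl
      distinct q∉ (suc zero) (suc (suc zero)) g = ⊥-elim (q∉ g)
      distinct q∉ (suc (suc zero)) zero g = ⊥-elim (y∉ (drop g))
      distinct q∉ (suc (suc zero)) (suc zero) g = ⊥-elim (q∉ (flip∈ g))
      distinct q∉ (suc (suc zero)) (suc (suc zero)) _ = refl

    strict : ¬ (∀ {x} → Generated H T x → Generated H S x)
    strict T⊆S = ℕₚ.<⇒≱ (ℕₚ.≤-trans (ℕₚ.≤-reflexive (cong suc (sym (ℕₚ.*-identityˡ k)))) (ℕₚ.*-monoˡ-< k {{ℕ.>-nonZero 0<k}} (ℕₚ.n<1+n 1)))
      (Finₚ.injective⇒≤ {f = λ i → Inverse.to oS (proj₁ (Inverse.from oT i) , T⊆S (proj₂ (Inverse.from oT i)))} (λ e → enum-inj oT (code-inj oS e)))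

-- From an oriented action to a half-arc-transitive graph

HalfArcTransitiveStabilizer : ∀ {c ℓ} → Group c ℓ → Set _
HalfArcTransitiveStabilizer H = Σ[ Γ ∈ Graph ] Σ[ v ∈ Graph.Vertex Γ ] (Connected Γ × Tetravalent Γ × HalfArcTransitive Γ × H ≅ Stabilizer Γ v)

whole-group : ∀ {c ℓ} {H : Group c ℓ} (L : OrientedAction H) → (∀ α → OrientedAction.𝒢 L α) → HalfArcTransitiveStabilizer H
whole-group {H = H} L all = L.Γ , L.base , L.connected , (λ v → neighbours⇒degree L.Γ v (L.neighbours v)) ,
    ((λ u v → let (α , _ , e) = L.transitive u v in α , e) , edges , not-arc-transitive) ,
    stab , isGroupIsomorphism H (Stabilizer L.Γ L.base) stab L.act-cong L.act-∙ L.act-inj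
      (λ { (α , fix) → let (h , e) = L.act-sur α (all α) fix in h , λ z → sym (e z) })
  where
  module L = OrientedAction L
  open Graph L.Γ using (Vertex; _~_)
  infixl 8 _·_
  _·_ = _^^_ L.Γ
  stab : Group.Carrier H → Σ[ α ∈ Automorphism L.Γ ] L.base · α ≡ L.base
  stab h = L.act h , L.act-fix h
  arcs : ∀ {u v x y} → L.arc u v → L.arc x y → Σ[ α ∈ Automorphism L.Γ ] u · α ≡ x × v · α ≡ y
  arcs {u} {v} {x} {y} p q = let (α , α∈ , e) = L.transitive u x
                                 (β , _ , fix , e′) = L.outs (subst (λ z → L.arc z (v · α)) e (L.𝒢-arc α∈ p)) q in
    Group._∙_ (Aut L.Γ) α β , trans (cong (_· β) e) fix , e′
  edges : EdgeTransitive L.Γ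
  edges {u} {v} {x} {y} p q = choose (L.~⇒arc p) (L.~⇒arc q)
    where
    choose : L.arc u v ⊎ L.arc v u → L.arc x y ⊎ L.arc y x → Σ[ α ∈ Automorphism L.Γ ] ((u · α ≡ x × v · α ≡ y) ⊎ (u · α ≡ y × v · α ≡ x))
    choose (inj₁ p) (inj₁ q) = let (α , e , f) = arcs p q in α , inj₁ (e , f)
    choose (inj₁ p) (inj₂ q) = let (α , e , f) = arcs p q in α , inj₂ (e , f)
    choose (inj₂ p) (inj₁ q) = let (α , e , f) = arcs p q in α , inj₂ (f , e)
    choose (inj₂ p) (inj₂ q) = let (α , e , f) = arcs p q in α , inj₁ (f , e)
  not-arc-transitive : ¬ ArcTransitive L.Γ
  not-arc-transitive transitive = choose (L.~⇒arc edge)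
    where
    v = L.base
    w = proj₁ (L.neighbours v) zero
    edge : v ~ w
    edge = proj₁ (proj₂ (proj₂ (L.neighbours v))) zero
    reversed = transitive edge (Graph.~-sym L.Γ edge)
    α = proj₁ reversed
    choose : L.arc v w ⊎ L.arc w v → ⊥
    choose (inj₁ p) = L.arc-anti p (subst₂ L.arc (proj₁ (proj₂ reversed)) (proj₂ (proj₂ reversed)) (L.𝒢-arc (all α) p))
    choose (inj₂ p) = L.arc-anti p (subst₂ L.arc (proj₂ (proj₂ reversed)) (proj₁ (proj₂ reversed)) (L.𝒢-arc (all α) p))

along : ∀ {a b c d} {G : Group a b} {H : Group c d} f → IsGroupIsomorphism (Group.rawGroup G) (Group.rawGroup H) f →
  HalfArcTransitiveStabilizer H → HalfArcTransitiveStabilizer G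
along f f-iso (Γ , v , connected , tetravalent , transitive , g , g-iso) = Γ , v , connected , tetravalent , transitive , g ∘ f ,
  Composition.isGroupIsomorphism (λ p q z → trans (p z) (q z)) f-iso g-iso

-- The preliminary cover makes cycles separating, for which M = k is enough. The crossing property
-- is passed on along with it, because the next cover has to be separating as well.
covering-graph : ∀ {c ℓ} {H : Group c ℓ} (L : OrientedAction H) κ → Crossing (OrientedAction.Γ L) κ →
  ∀ n (hs : Fin n → Group.Carrier H) → (∀ x → Σ[ i ∈ Fin n ] Group._≈_ H x (hs i)) → HalfArcTransitiveStabilizer H
covering-graph L κ cr n hs enum = whole-group T.L₂ T.all-lift
  where
  module Ln = Lines (OrientedAction.Γ L) (suc κ) (OrientedAction.base L) κ ℕₚ.≤-refl
  module T = Tower (plain-level L (suc κ)) Ln.κ′ (Ln.crossing cr) (Ln.separating cr) n hs enum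

-- The bottom of the tower

iter : {A : Set} → (A → A) → ℕ → A → A
iter t zero x = x
iter t (suc i) x = iter t i (t x)

iter-+ : {A : Set} (t : A → A) → ∀ i j x → iter t (i + j) x ≡ iter t j (iter t i x)
iter-+ t zero j x = refl
iter-+ t (suc i) j x = iter-+ t i j (t x)

iter-suc : {A : Set} (t : A → A) → ∀ i x → iter t (suc i) x ≡ t (iter t i x)
iter-suc t zero x = refl
iter-suc t (suc i) x = iter-suc t i (t x)

iter-* : {A : Set} (t : A → A) → ∀ d {x} → iter t d x ≡ x → ∀ l → iter t (l * d) x ≡ x
iter-* t d e zero = refl
iter-* t d {x} e (suc l) = trans (iter-+ t d (l * d) x) (trans (cong (iter t (l * d)) e) (iter-* t d e l))

iter-inj : {A : Set} (t : A → A) → (∀ {x y} → t x ≡ t y → x ≡ y) → ∀ i {x y} → iter t i x ≡ iter t i y → x ≡ y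
iter-inj t inj zero e = e
iter-inj t inj (suc i) e = inj (iter-inj t inj i e)

-- By pigeonhole every point returns after at most N steps, and all such numbers divide N!.
finite-order : {A : Set} (N : ℕ) (enc : A → Fin N) → (∀ {x y} → enc x ≡ enc y → x ≡ y) →
  (t : A → A) → (∀ {x y} → t x ≡ t y → x ≡ y) → ∀ x → iter t (N !) x ≡ x
finite-order {A} N enc enc-inj t t-inj x = from-collision (Finₚ.pigeonhole (ℕₚ.n<1+n N) (λ i → enc (iter t (toℕ i) x)))
  where
  from-collision : (Σ[ i ∈ Fin (suc N) ] Σ[ j ∈ Fin (suc N) ] (i Fin.< j) × enc (iter t (toℕ i) x) ≡ enc (iter t (toℕ j) x)) → iter t (N !) x ≡ x
  from-collision (i , j , i<j , e) = order-divides (toℕ j ∸ toℕ i) (ℕₚ.m<n⇒0<n∸m i<j) (ℕₚ.≤-trans (ℕₚ.m∸n≤m (toℕ j) (toℕ i)) (ℕₚ.≤-pred (Finₚ.toℕ<n j)))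
      (iter-inj t t-inj (toℕ i) (trans (sym (iter-+ t (toℕ j ∸ toℕ i) (toℕ i) x)) (trans (cong (λ l → iter t l x) (ℕₚ.m∸n+n≡m (ℕₚ.<⇒≤ i<j))) (sym (enc-inj e)))))
    where
    order-divides : ∀ d → 0 < d → d ≤ N → iter t d x ≡ x → iter t (N !) x ≡ x
    order-divides (suc d) _ d≤N e with ℕᵈ.∣-trans (ℕᵈ.m∣m*n {suc d} (d !)) (ℕᵈ.m≤n⇒m!∣n! d≤N)
    ... | ℕᵈ.divides l N!≡ = trans (cong (λ i → iter t i x) N!≡) (iter-* t (suc d) e l)

Z₃ : Set
Z₃ = Fin 3

next : Z₃ → Z₃
next zero = suc zero
next (suc zero) = suc (suc zero)
next (suc (suc zero)) = zero

rot : Z₃ → Z₃ → Z₃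
rot r = iter next (toℕ r)

rot⁻ : Z₃ → Z₃
rot⁻ zero = zero
rot⁻ (suc zero) = suc (suc zero)
rot⁻ (suc (suc zero)) = suc zero

rot-rot⁻ : ∀ r s → rot r (rot (rot⁻ r) s) ≡ s
rot-rot⁻ zero s = refl
rot-rot⁻ (suc zero) zero = refl
rot-rot⁻ (suc zero) (suc zero) = refl
rot-rot⁻ (suc zero) (suc (suc zero)) = refl
rot-rot⁻ (suc (suc zero)) zero = refl
rot-rot⁻ (suc (suc zero)) (suc zero) = refl
rot-rot⁻ (suc (suc zero)) (suc (suc zero)) = refl

rot⁻-rot : ∀ r s → rot (rot⁻ r) (rot r s) ≡ s
rot⁻-rot zero s = refl
rot⁻-rot (suc zero) zero = refl
rot⁻-rot (suc zero) (suc zero) = refl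
rot⁻-rot (suc zero) (suc (suc zero)) = refl
rot⁻-rot (suc (suc zero)) zero = refl
rot⁻-rot (suc (suc zero)) (suc zero) = refl
rot⁻-rot (suc (suc zero)) (suc (suc zero)) = refl

rot-next : ∀ r s → rot r (next s) ≡ next (rot r s)
rot-next r s = iter-suc next (toℕ r) s

rot-rot : ∀ r r′ → Σ[ r″ ∈ Z₃ ] (∀ s → rot r′ (rot r s) ≡ rot r″ s)
rot-rot zero r′ = r′ , λ s → refl
rot-rot r zero = r , λ s → refl
rot-rot (suc zero) (suc zero) = suc (suc zero) , λ s → refl
rot-rot (suc zero) (suc (suc zero)) = zero , rot⁻-rot (suc zero)
rot-rot (suc (suc zero)) (suc zero) = zero , rot⁻-rot (suc (suc zero))
rot-rot (suc (suc zero)) (suc (suc zero)) = suc zero , λ { zero → refl ; (suc zero) → refl ; (suc (suc zero)) → refl }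

rot-transitive : ∀ s s′ → Σ[ r ∈ Z₃ ] rot r s ≡ s′
rot-transitive zero s′ = s′ , from-zero s′
  where
  from-zero : ∀ s → rot s zero ≡ s
  from-zero zero = refl
  from-zero (suc zero) = refl
  from-zero (suc (suc zero)) = refl
rot-transitive (suc zero) zero = suc (suc zero) , refl
rot-transitive (suc zero) (suc zero) = zero , refl
rot-transitive (suc zero) (suc (suc zero)) = suc zero , refl
rot-transitive (suc (suc zero)) zero = suc zero , refl
rot-transitive (suc (suc zero)) (suc zero) = suc (suc zero) , refl
rot-transitive (suc (suc zero)) (suc (suc zero)) = zero , refl

next-irr : ∀ s → s ≢ next s
next-irr zero ()
next-irr (suc zero) ()
next-irr (suc (suc zero)) ()

next-anti : ∀ {s s′} → s′ ≡ next s → s ≢ next s′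
next-anti {zero} refl ()
next-anti {suc zero} refl ()
next-anti {suc (suc zero)} refl ()

next-inj : ∀ {s s′} → next s ≡ next s′ → s ≡ s′
next-inj {s} {s′} e = trans (sym (rot⁻-rot (suc zero) s)) (trans (cong (rot (suc (suc zero))) e) (rot⁻-rot (suc zero) s′))

finite-group : ∀ n (_∙_ : Fin n → Fin n → Fin n) e (_⁻¹ : Fin n → Fin n) → (∀ x y z → (x ∙ y) ∙ z ≡ x ∙ (y ∙ z)) →
  (∀ x → e ∙ x ≡ x) → (∀ x → x ∙ e ≡ x) → (∀ x → (x ⁻¹) ∙ x ≡ e) → (∀ x → x ∙ (x ⁻¹) ≡ e) → Group 0ℓ 0ℓ
finite-group n _∙_ e _⁻¹ assoc identityˡ identityʳ inverseˡ inverseʳ = record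
  { Carrier = Fin n ; _≈_ = _≡_ ; _∙_ = _∙_ ; ε = e ; _⁻¹ = _⁻¹
  ; isGroup = record
    { isMonoid = record
      { isSemigroup = record
        { isMagma = record { isEquivalence = record { refl = refl ; sym = sym ; trans = trans } ; ∙-cong = cong₂ _∙_ }
        ; assoc = assoc }
      ; identity = identityˡ , identityʳ }
    ; inverse = inverseˡ , inverseʳ
    ; ⁻¹-cong = cong _⁻¹ } }

-- `core` says that only the identity can be pulled back through `τ` within K forever; it makes the
-- action of H faithful. `h∗` lies outside both subgroups, so that it represents the second coset
-- for out- and in-neighbours at once.
module Bottom (n : ℕ) (_∙_ : Fin n → Fin n → Fin n) (e : Fin n) (_⁻¹ : Fin n → Fin n)
  (assoc : ∀ x y z → (x ∙ y) ∙ z ≡ x ∙ (y ∙ z)) (identityˡ : ∀ x → e ∙ x ≡ x) (identityʳ : ∀ x → x ∙ e ≡ x)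
  (inverseˡ : ∀ x → (x ⁻¹) ∙ x ≡ e) (inverseʳ : ∀ x → x ∙ (x ⁻¹) ≡ e)
  (K K′ : Fin n → Set) (K? : ∀ x → Dec (K x)) (K′? : ∀ x → Dec (K′ x))
  (K-e : K e) (K-∙ : ∀ {x b} → K b → K x → K (x ∙ b)) (K-∙⁻ : ∀ {x b} → K b → K (x ∙ b) → K x)
  (K-index : ∀ {x y} → ¬ K x → ¬ K y → K (x ∙ (y ⁻¹))) (K′-index : ∀ {x y} → ¬ K′ x → ¬ K′ y → K′ (x ∙ (y ⁻¹)))
  (τ τ⁻ : Fin n → Fin n) (τ⁻τ : ∀ x → τ⁻ (τ x) ≡ x) (ττ⁻ : ∀ x → τ (τ⁻ x) ≡ x)
  (τ-e : τ e ≡ e) (τ-∙ : ∀ x {b} → K b → τ (x ∙ b) ≡ τ x ∙ τ b) (τ-K : ∀ {x} → K x → K′ (τ x)) (τ-K⁻ : ∀ {x} → K′ (τ x) → K x)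
  (h∗ : Fin n) (h∗∉K : ¬ K h∗) (h∗∉K′ : ¬ K′ h∗)
  (core : (P : Fin n → Set) → (∀ g → P g → Σ[ g′ ∈ Fin n ] K g′ × τ g′ ≡ g × P g′) → ∀ g → P g → g ≡ e) where

  X : Set
  X = Fin n × Fin 2

  ρ : Fin n → X → X
  ρ h (i , y) = i ∙ h , y

  toggle : {P : Set} → Dec P → Fin 2 → Fin 2
  toggle (yes _) y = y
  toggle (no _) y = Fin.opposite y

  toggle-toggle : {P : Set} (d : Dec P) → ∀ y → toggle d (toggle d y) ≡ y
  toggle-toggle (yes _) y = refl
  toggle-toggle (no _) y = Finₚ.opposite-involutive y

  toggle-⇔ : {P Q : Set} (d : Dec P) (e : Dec Q) → (P → Q) → (Q → P) → ∀ y → toggle d y ≡ toggle e y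
  toggle-⇔ (yes p) (yes q) f g y = refl
  toggle-⇔ (yes p) (no ¬q) f g y = ⊥-elim (¬q (f p))
  toggle-⇔ (no ¬p) (yes q) f g y = ⊥-elim (¬p (g q))
  toggle-⇔ (no ¬p) (no ¬q) f g y = refl

  -- The toggled bit keeps t from normalizing the right translations by elements outside K.
  t t⁻ : X → X
  t (i , y) = τ i , toggle (K? i) y
  t⁻ (i , y) = τ⁻ i , toggle (K? (τ⁻ i)) y

  t⁻t : ∀ x → t⁻ (t x) ≡ x
  t⁻t (i , y) = cong₂ _,_ (τ⁻τ i) (trans (cong (λ j → toggle (K? j) (toggle (K? i) y)) (τ⁻τ i)) (toggle-toggle (K? i) y))

  tt⁻ : ∀ x → t (t⁻ x) ≡ x
  tt⁻ (i , y) = cong₂ _,_ (ττ⁻ i) (toggle-toggle (K? (τ⁻ i)) y)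

  t-inj : ∀ {x y} → t x ≡ t y → x ≡ y
  t-inj {x} {y} e = trans (sym (t⁻t x)) (trans (cong t⁻ e) (t⁻t y))

  ρ-∘ : ∀ h g x → ρ h (ρ g x) ≡ ρ (g ∙ h) x
  ρ-∘ h g (i , y) = cong (_, y) (assoc i g h)

  ρ-e : ∀ x → ρ e x ≡ x
  ρ-e (i , y) = cong (_, y) (identityʳ i)

  ρρ⁻ : ∀ h x → ρ h (ρ (h ⁻¹) x) ≡ x
  ρρ⁻ h x = trans (ρ-∘ h (h ⁻¹) x) (trans (cong (λ g → ρ g x) (inverseˡ h)) (ρ-e x))

  ρ⁻ρ : ∀ h x → ρ (h ⁻¹) (ρ h x) ≡ x
  ρ⁻ρ h x = trans (ρ-∘ (h ⁻¹) h x) (trans (cong (λ g → ρ g x) (inverseʳ h)) (ρ-e x))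

  t-ρ : ∀ {b} → K b → ∀ x → t (ρ b x) ≡ ρ (τ b) (t x)
  t-ρ {b} b∈K (i , y) = cong₂ _,_ (τ-∙ i b∈K) (toggle-⇔ (K? (i ∙ b)) (K? i) (K-∙⁻ b∈K) (K-∙ b∈K) y)

  -- Evaluation at `(e , zero)` suffices: `t` fixes this point, and the bit on the other side
  -- reveals whether `g` lies in K.
  t-normal : ∀ {h g} → (∀ x → ρ h (t x) ≡ t (ρ g x)) → K g × h ≡ τ g
  t-normal {h} {g} f = bit (K? g) (trans (sym (toggle-⇔ (K? e) (yes K-e) (λ _ → K-e) (λ _ → K-e) zero)) (trans (cong proj₂ at-e) (toggle-⇔ (K? (e ∙ g)) (K? g) (subst K (identityˡ g)) (subst K (sym (identityˡ g))) zero))) ,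
      trans (sym (trans (cong (_∙ h) τ-e) (identityˡ h))) (trans (cong proj₁ at-e) (cong τ (identityˡ g)))
    where
    at-e : ρ h (t (e , zero)) ≡ t (ρ g (e , zero))
    at-e = f (e , zero)
    bit : (d : Dec (K g)) → zero ≡ toggle d zero → K g
    bit (yes p) _ = p
    bit (no _) ()

  -- The two translations account for the choice of representatives of the source and of the target.
  Arrow : (X → X) → (X → X) → Set
  Arrow f f′ = Σ[ h ∈ Fin n ] Σ[ g ∈ Fin n ] (∀ x → f′ x ≡ f (ρ h (t (ρ g x))))

  Raw : Set
  Raw = Z₃ × (X → X)

  infix 4 _≈_ _⟶_
  record _≈_ (x y : Raw) : Set where
    constructor _,_
    field
      same-layer : proj₁ x ≡ proj₁ y
      translate  : Σ[ h ∈ Fin n ] (∀ u → proj₂ y u ≡ proj₂ x (ρ h u))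
  open _≈_ public

  record _⟶_ (x y : Raw) : Set where
    constructor _,_
    field
      next-layer : proj₁ y ≡ next (proj₁ x)
      arrow      : Arrow (proj₂ x) (proj₂ y)
  open _⟶_ public

  ≈-pointwise : ∀ {s s′ f f′} → s ≡ s′ → (∀ x → f x ≡ f′ x) → (s , f) ≈ (s′ , f′)
  ≈-pointwise {f = f} e p = e , _ , λ x → trans (sym (p x)) (cong f (sym (ρ-e x)))

  ≈-refl : ∀ {x} → x ≈ x
  ≈-refl = ≈-pointwise refl (λ x → refl)

  ≈-sym : ∀ {x y} → x ≈ y → y ≈ x
  ≈-sym {_ , f} (e , h , p) = sym e , h ⁻¹ , λ x → trans (cong f (sym (ρρ⁻ h x))) (sym (p (ρ (h ⁻¹) x)))

  ≈-trans : ∀ {x y z} → x ≈ y → y ≈ z → x ≈ z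
  ≈-trans {_ , f} (e , h , p) (e′ , h′ , p′) = trans e e′ , h′ ∙ h , λ x → trans (p′ x) (trans (p (ρ h′ x)) (cong f (ρ-∘ h h′ x)))

  ⟶-resp : ∀ {x x′ y y′} → x ≈ x′ → y ≈ y′ → x ⟶ y → x′ ⟶ y′
  ⟶-resp {_ , f} {_ , f₁} {_ , f′} {_ , f′₁} (e , a , p) (e′ , b , p′) (l , h , g , r) = trans (sym e′) (trans l (cong next e)) , h ∙ (a ⁻¹) , b ∙ g , λ x →
    trans (p′ x) (trans (r (ρ b x)) (trans (cong f (sym (trans (cong (ρ a) (sym (ρ-∘ (a ⁻¹) h _))) (ρρ⁻ a _)))) (trans (sym (p _)) (cong (λ y → f₁ (ρ (h ∙ (a ⁻¹)) (t y))) (ρ-∘ g b x)))))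

  ⟶-anti : ∀ {x y} → x ⟶ y → ¬ (y ⟶ x)
  ⟶-anti a b = next-anti (next-layer a) (next-layer b)

  private
    all-X? : {P : X → Set} → (∀ x → Dec (P x)) → Dec (∀ x → P x)
    all-X? P? = map′ (λ f x → f (proj₁ x) (proj₂ x)) (λ f i y → f (i , y)) (Finₚ.all? λ i → Finₚ.all? λ y → P? (i , y))

    _≟ₓ_ : (x y : X) → Dec (x ≡ y)
    (i , y) ≟ₓ (i′ , y′) = map′ (λ e → cong₂ _,_ (proj₁ e) (proj₂ e)) (λ e → cong proj₁ e , cong proj₂ e) ((i Finₚ.≟ i′) ×-dec (y Finₚ.≟ y′))

    _≈?_ : ∀ x y → Dec (x ≈ y)
    (s , f) ≈? (s′ , f′) = map′ (λ e → proj₁ e , proj₂ e) (λ e → same-layer e , translate e) ((s Finₚ.≟ s′) ×-dec Finₚ.any? λ h → all-X? λ x → f′ x ≟ₓ f (ρ h x))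

    _⟶?_ : ∀ x y → Dec (x ⟶ y)
    (s , f) ⟶? (s′ , f′) = map′ (λ e → proj₁ e , proj₂ e) (λ e → next-layer e , arrow e) ((s′ Finₚ.≟ next s) ×-dec Finₚ.any? λ h → Finₚ.any? λ g → all-X? λ x → f′ x ≟ₓ f (ρ h (t (ρ g x))))

    functions : Σ[ fs ∈ List (Fin n → Fin 2 → X) ] Enumerates (λ f g → ∀ i y → f i y ≡ g i y) fs
    functions = enumerate-Π n (λ f g → ∀ y → f y ≡ g y) λ _ → enumerate-Π 2 _≡_ λ _ →
      List.cartesianProduct (List.allFin n) (List.allFin 2) ,
      λ x → Any.map (λ e → cong₂ _,_ (proj₁ e) (proj₂ e)) (enumerate-× _≡_ _≡_ (enumerate-Fin n) (enumerate-Fin 2) x)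

    raws : List Raw
    raws = List.cartesianProduct (List.allFin 3) (List.map (λ f x → f (proj₁ x) (proj₂ x)) (proj₁ functions))

    raws-cover : Enumerates _≈_ raws
    raws-cover (s , f) = Any.map (λ e → ≈-pointwise (proj₁ e) (proj₂ e)) (enumerate-× _≡_ (λ f g → ∀ x → f x ≡ g x) (enumerate-Fin 3)
      (λ f → Anyₚ.map⁺ (Any.map (λ p x → p (proj₁ x) (proj₂ x)) (proj₂ functions (λ i y → f (i , y))))) (s , f))

    _⌢_ : Raw → Raw → Set
    x ⌢ y = (x ⟶ y) ⊎ (y ⟶ x)

    module Cmp = Component {Raw} _≈_ _⌢_ (λ {x} → ≈-refl {x}) (λ {x} {y} → ≈-sym {x} {y}) (λ {x} {y} {z} → ≈-trans {x} {y} {z}) _≈?_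
      (λ x y → (x ⟶? y) ⊎-dec (y ⟶? x)) [ inj₂ , inj₁ ]′ (λ {x} → [ (λ a → next-irr _ (next-layer a)) , (λ a → next-irr _ (next-layer a)) ]′)
      (λ {x} {y} {y′} e → [ (λ a → inj₁ (⟶-resp {x} {x} {y} {y′} (≈-refl {x}) e a)) , (λ a → inj₂ (⟶-resp {y} {y′} {x} {x} e (≈-refl {x}) a)) ]′)
      raws raws-cover (zero , id)

    record Interface : Set₁ where
      field
        Γ         : Graph
        connected : Connected Γ
        root      : Graph.Vertex Γ
        rep       : Graph.Vertex Γ → Raw
        rep-root  : rep root ≈ (zero , id)
        rep-inj   : ∀ {z z′} → rep z ≈ rep z′ → z ≡ z′
        ~⇒        : ∀ {z z′} → Graph._~_ Γ z z′ → (rep z ⟶ rep z′) ⊎ (rep z′ ⟶ rep z)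
        ⇒~        : ∀ {z z′} → (rep z ⟶ rep z′) ⊎ (rep z′ ⟶ rep z) → Graph._~_ Γ z z′
        neighbour : ∀ z {y} → (rep z ⟶ y) ⊎ (y ⟶ rep z) → Σ[ z′ ∈ Graph.Vertex Γ ] rep z′ ≈ y

  opaque
    private
      interface : Interface
      interface = record
        { Γ = Cmp.component ; connected = Cmp.component-connected ; root = Cmp.root ; rep = Cmp.rep ; rep-root = Cmp.rep-root
        ; rep-inj = λ {z} {z′} → Cmp.rep-inj {z} {z′} ; ~⇒ = λ {z} {z′} → Cmp.~⇒⌢ {z} {z′} ; ⇒~ = λ {z} {z′} → Cmp.⌢⇒~ {z} {z′} ; neighbour = λ z {y} → Cmp.neighbour z {y} }

  open Interface interface public
  open Graph Γ using (Vertex; _~_)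

  private
    infixl 8 _·_
    _·_ = _^^_ Γ
    module Au = Group (Aut Γ)

  Bijective : (X → X) → Set
  Bijective f = Σ[ f⁻ ∈ (X → X) ] (∀ x → f⁻ (f x) ≡ x) × (∀ x → f (f⁻ x) ≡ x)

  layer : Vertex → Z₃
  layer z = proj₁ (rep z)

  frame : Vertex → X → X
  frame z = proj₂ (rep z)

  -- Raw vertices carry arbitrary self-maps, which are easily listed. The component starts at the
  -- identity, and arcs in either direction preserve invertibility.
  bijective : ∀ z → Bijective (frame z)
  bijective z = go (connected root z) from-root
    where
    from-root : Bijective (frame root)
    from-root with translate rep-root
    ... | h , p = ρ h , (λ x → trans (cong (ρ h) (trans (cong (frame root) (sym (ρρ⁻ h x))) (sym (p (ρ (h ⁻¹) x))))) (ρρ⁻ h x)) , (λ x → sym (p x))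
    forward : ∀ {f f′} → Arrow f f′ → Bijective f → Bijective f′
    forward {f} (h , g , r) (f⁻ , f⁻f , ff⁻) = (λ x → ρ (g ⁻¹) (t⁻ (ρ (h ⁻¹) (f⁻ x)))) ,
      (λ x → trans (cong (λ y → ρ (g ⁻¹) (t⁻ (ρ (h ⁻¹) y))) (trans (cong f⁻ (r x)) (f⁻f _))) (trans (cong (λ y → ρ (g ⁻¹) (t⁻ y)) (ρ⁻ρ h _)) (trans (cong (ρ (g ⁻¹)) (t⁻t _)) (ρ⁻ρ g x)))) ,
      (λ x → trans (r _) (trans (cong (λ y → f (ρ h (t y))) (ρρ⁻ g _)) (trans (cong (λ y → f (ρ h y)) (tt⁻ _)) (trans (cong f (ρρ⁻ h _)) (ff⁻ x)))))
    backward : ∀ {f f′} → Arrow f′ f → Bijective f → Bijective f′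
    backward {f} {f′} (h , g , r) (f⁻ , f⁻f , ff⁻) = (λ x → ρ h (t (ρ g (f⁻ x)))) ,
      (λ x → trans (cong (λ y → ρ h (t (ρ g (f⁻ y)))) (undo x)) (trans (cong (λ y → ρ h (t (ρ g y))) (f⁻f _)) (redo x))) ,
      (λ x → trans (sym (r _)) (ff⁻ x))
      where
      redo : ∀ x → ρ h (t (ρ g (ρ (g ⁻¹) (t⁻ (ρ (h ⁻¹) x))))) ≡ x
      redo x = trans (cong (λ y → ρ h (t y)) (ρρ⁻ g _)) (trans (cong (ρ h) (tt⁻ _)) (ρρ⁻ h x))
      undo : ∀ x → f′ x ≡ f (ρ (g ⁻¹) (t⁻ (ρ (h ⁻¹) x)))
      undo x = trans (cong f′ (sym (redo x))) (sym (r _))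
    go : ∀ {y} → Star _~_ y z → Bijective (frame y) → Bijective (frame z)
    go done b = b
    go (a ◅ s) b = go s ([ (λ x → forward (arrow x) b) , (λ x → backward (arrow x) b) ]′ (~⇒ a))

  frame-inj : ∀ z {x y} → frame z x ≡ frame z y → x ≡ y
  frame-inj z {x} {y} e = trans (sym (proj₁ (proj₂ (bijective z)) x)) (trans (cong (proj₁ (bijective z)) e) (proj₁ (proj₂ (bijective z)) y))

  Φ : Z₃ → (X → X) → Raw → Raw
  Φ r σ (s , f) = rot r s , λ x → σ (f x)

  Φ-≈ : ∀ r σ {x y} → x ≈ y → Φ r σ x ≈ Φ r σ y
  Φ-≈ r σ (e , h , p) = cong (rot r) e , h , λ x → cong σ (p x)

  Φ-⟶ : ∀ r σ {x y} → x ⟶ y → Φ r σ x ⟶ Φ r σ y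
  Φ-⟶ r σ {s , _} (e , h , g , p) = trans (cong (rot r) e) (rot-next r s) , h , g , λ x → cong σ (p x)

  -- Left multiplication commutes with what happens on the right and so respects equivalence and
  -- arcs everywhere. Walks are followed only to see that the image stays in the component.
  transfer : ∀ r σ → Bijective σ → ∀ z₁ z₂ → Φ r σ (rep z₁) ≈ rep z₂ → Σ[ α ∈ Automorphism Γ ] (∀ z → Φ r σ (rep z) ≈ rep (z · α))
  transfer r σ (σ⁻ , σ⁻σ , σσ⁻) z₁ z₂ e = automorphism Γ F.f G.f
      (λ z → rep-inj (≈-trans (≈-sym (G.f-rep (F.f z))) (≈-trans (Φ-≈ (rot⁻ r) σ⁻ (≈-sym (F.f-rep z))) (≈-pointwise (rot⁻-rot r _) (λ x → σ⁻σ _)))))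
      (λ z → rep-inj (≈-trans (≈-sym (F.f-rep (G.f z))) (≈-trans (Φ-≈ r σ (≈-sym (G.f-rep z))) (≈-pointwise (rot-rot⁻ r _) (λ x → σσ⁻ _)))))
      F.f-~ G.f-~ , F.f-rep
    where
    module Go (r : Z₃) (σ : X → X) (z₁ z₂ : Vertex) (e : Φ r σ (rep z₁) ≈ rep z₂) where
      edge : ∀ {y y′} w → Φ r σ (rep y) ≈ rep w → y ~ y′ → Σ[ w′ ∈ Vertex ] Φ r σ (rep y′) ≈ rep w′
      edge {y} {y′} w e a = let (w′ , e′) = neighbour w ([ (λ x → inj₁ (⟶-resp e ≈-refl (Φ-⟶ r σ x))) , (λ x → inj₂ (⟶-resp ≈-refl e (Φ-⟶ r σ x))) ]′ (~⇒ a)) in w′ , ≈-sym e′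
      go : ∀ {y z} → Star _~_ y z → ∀ w → Φ r σ (rep y) ≈ rep w → Σ[ w′ ∈ Vertex ] Φ r σ (rep z) ≈ rep w′
      go done w e = w , e
      go (a ◅ s) w e = let (w′ , e′) = edge w e a in go s w′ e′
      f : Vertex → Vertex
      f z = proj₁ (go (connected z₁ z) z₂ e)
      f-rep : ∀ z → Φ r σ (rep z) ≈ rep (f z)
      f-rep z = proj₂ (go (connected z₁ z) z₂ e)
      f-~ : ∀ {z z′} → z ~ z′ → f z ~ f z′
      f-~ {z} {z′} a = ⇒~ ([ (λ x → inj₁ (⟶-resp (f-rep z) (f-rep z′) (Φ-⟶ r σ x))) , (λ x → inj₂ (⟶-resp (f-rep z′) (f-rep z) (Φ-⟶ r σ x))) ]′ (~⇒ a))
    module F = Go r σ z₁ z₂ e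
    module G = Go (rot⁻ r) σ⁻ z₂ z₁ (≈-trans (Φ-≈ (rot⁻ r) σ⁻ (≈-sym e)) (≈-pointwise (rot⁻-rot r _) (λ x → σ⁻σ _)))

  Induced : Automorphism Γ → Set
  Induced α = Σ[ r ∈ Z₃ ] Σ[ σ ∈ (X → X) ] Bijective σ × (∀ z → Φ r σ (rep z) ≈ rep (z · α))

  ρ-bijective : ∀ h → Bijective (ρ h)
  ρ-bijective h = ρ (h ⁻¹) , ρ⁻ρ h , ρρ⁻ h

  coded : Group 0ℓ 0ℓ
  coded = finite-group n _∙_ e _⁻¹ assoc identityˡ identityʳ inverseˡ inverseʳ

  private
    act : ∀ h → Σ[ α ∈ Automorphism Γ ] (∀ z → Φ zero (ρ h) (rep z) ≈ rep (z · α))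
    act h = transfer zero (ρ h) (ρ-bijective h) root root
      (≈-trans (Φ-≈ zero (ρ h) rep-root) (≈-trans (≈-sym (refl , h , λ x → refl)) (≈-sym rep-root)))

    act-fix : ∀ h → root · proj₁ (act h) ≡ root
    act-fix h = rep-inj (≈-trans (≈-sym (proj₂ (act h) root)) (≈-trans (Φ-≈ zero (ρ h) rep-root) (≈-trans (≈-sym (refl , h , λ x → refl)) (≈-sym rep-root))))

    -- A group element acting trivially lies in K, and so do all its backward shifts.
    Trivially : Fin n → Set
    Trivially g = ∀ z → Φ zero (ρ g) (rep z) ≈ rep z

    above : Σ[ z ∈ Vertex ] rep z ≈ (suc zero , t)
    above = neighbour root (inj₁ (⟶-resp (≈-sym rep-root) ≈-refl (refl , e , e , λ x → trans (cong t (sym (ρ-e x))) (sym (ρ-e _)))))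

    t-bijective : Bijective t
    t-bijective = t⁻ , t⁻t , tt⁻

    climb = transfer (suc zero) t t-bijective root (proj₁ above) (≈-trans (Φ-≈ (suc zero) t rep-root) (≈-sym (proj₂ above)))

    -- Fixing the vertex of `t` means that `ρ g` passes through `t` as some `ρ g′`, whence
    -- `t-normal` applies. Triviality at the images under `climb`, left multiplication by `t`, then
    -- makes `g′` act trivially too.
    trivially-core : ∀ g → Trivially g → Σ[ g′ ∈ Fin n ] K g′ × τ g′ ≡ g × Trivially g′
    trivially-core g triv = g′ , proj₁ normal , sym (proj₂ normal) , trivial′
      where
      fixes-t : Φ zero (ρ g) (suc zero , t) ≈ (suc zero , t)
      fixes-t = ≈-trans (Φ-≈ zero (ρ g) (≈-sym (proj₂ above))) (≈-trans (triv (proj₁ above)) (proj₂ above))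
      g′ = proj₁ (translate fixes-t) ⁻¹
      commutes : ∀ x → ρ g (t x) ≡ t (ρ g′ x)
      commutes x = trans (cong (λ y → ρ g (t y)) (sym (ρρ⁻ _ x))) (sym (proj₂ (translate fixes-t) (ρ g′ x)))
      normal : K g′ × g ≡ τ g′
      normal = t-normal commutes
      trivial′ : Trivially g′
      trivial′ z = refl , proj₁ moved , λ x → t-inj (trans (proj₂ moved x) (commutes _))
        where
        moved = translate (≈-trans (Φ-≈ zero (ρ g) (proj₂ climb z)) (≈-trans (triv (z · proj₁ climb)) (≈-sym (proj₂ climb z))))

    act-inj : ∀ {h k} → proj₁ (act h) Au.≈ proj₁ (act k) → h ≡ k
    act-inj {h} {k} p = trans (sym (trans (assoc h (k ⁻¹) k) (trans (cong (h ∙_) (inverseˡ k)) (identityʳ h))))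
        (trans (cong (_∙ k) (core Trivially trivially-core (h ∙ (k ⁻¹)) trivial)) (identityˡ k))
      where
      trivial : Trivially (h ∙ (k ⁻¹))
      trivial z = ≈-trans (≈-pointwise refl (λ x → sym (ρ-∘ (k ⁻¹) h _)))
        (≈-trans (Φ-≈ zero (ρ (k ⁻¹)) (≈-trans (proj₂ (act h) z) (≈-trans (subst (λ y → rep (z · proj₁ (act h)) ≈ rep y) (p z) ≈-refl) (≈-sym (proj₂ (act k) z)))))
          (≈-pointwise refl (λ x → ρ⁻ρ k _)))

    -- The neighbours of a bottom vertex

    out in′ : Vertex → Fin n → Raw
    out z h = next (layer z) , λ x → frame z (ρ h (t x))
    in′ z h = rot (suc (suc zero)) (layer z) , λ x → frame z (ρ h (t⁻ x))

    out-arc : ∀ z h → rep z ⟶ out z h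
    out-arc z h = refl , h , e , λ x → cong (λ y → frame z (ρ h (t y))) (sym (ρ-e x))

    in-arc : ∀ z h → in′ z h ⟶ rep z
    in-arc z h = sym (rot⁻-rot (suc (suc zero)) (layer z)) , e , h ⁻¹ , λ x → sym (trans (cong (λ y → frame z (ρ h (t⁻ y))) (ρ-e _)) (trans (cong (λ y → frame z (ρ h y)) (t⁻t _)) (cong (frame z) (ρρ⁻ h x))))

    divide : ∀ h h₀ → (h ∙ (h₀ ⁻¹)) ∙ h₀ ≡ h
    divide h h₀ = trans (assoc h (h₀ ⁻¹) h₀) (trans (cong (h ∙_) (inverseˡ h₀)) (identityʳ h))

    -- By `t-ρ` a translation by an element of K′ moves past `t` and is absorbed by the target. So
    -- out-neighbours correspond to the two cosets of K′, and in-neighbours likewise to those of K.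
    out-coset : ∀ z y (a : rep z ⟶ y) h₀ → K′ (proj₁ (arrow a) ∙ (h₀ ⁻¹)) → out z h₀ ≈ y
    out-coset z y (l , h , g , p) h₀ b∈K′ = sym l , g ∙ τ⁻ b , λ x → trans (p x) (cong (frame z) (trans
        (trans (cong (λ h → ρ h (t (ρ g x))) (sym (divide h h₀))) (sym (ρ-∘ h₀ b _)))
        (cong (ρ h₀) (trans (cong (λ b → ρ b (t (ρ g x))) (sym (ττ⁻ b))) (trans (sym (t-ρ (τ-K⁻ (subst K′ (sym (ττ⁻ b)) b∈K′)) (ρ g x))) (cong t (ρ-∘ (τ⁻ b) g x)))))))
      where b = h ∙ (h₀ ⁻¹)

    in-coset : ∀ z y (a : y ⟶ rep z) h₀ → K ((proj₁ (proj₂ (arrow a)) ⁻¹) ∙ (h₀ ⁻¹)) → in′ z h₀ ≈ y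
    in-coset z (s , f) (l , h , g , p) h₀ b∈K = trans (cong (rot (suc (suc zero))) l) (rot⁻-rot (suc zero) s) , (h ⁻¹) ∙ τ b , λ x → trans (undo x) (cong (frame z) (trans
        (trans (cong (λ k → ρ k (t⁻ (ρ (h ⁻¹) x))) (sym (divide (g ⁻¹) h₀))) (sym (ρ-∘ h₀ b _)))
        (cong (ρ h₀) (trans (sym (t⁻t _)) (cong t⁻ (trans (t-ρ b∈K _) (trans (cong (ρ (τ b)) (tt⁻ _)) (ρ-∘ (τ b) (h ⁻¹) x))))))))
      where
      b = (g ⁻¹) ∙ (h₀ ⁻¹)
      undo : ∀ x → f x ≡ frame z (ρ (g ⁻¹) (t⁻ (ρ (h ⁻¹) x)))
      undo x = trans (cong f (sym (trans (cong (λ y → ρ h (t y)) (ρρ⁻ g _)) (trans (cong (ρ h) (tt⁻ _)) (ρρ⁻ h x))))) (sym (p _))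

    out-distinct : ∀ z → ¬ (out z e ≈ out z h∗)
    out-distinct z (_ , a , p) = h∗∉K′ (subst K′ (sym (proj₂ normal)) (τ-K (proj₁ normal)))
      where
      normal : K a × h∗ ≡ τ a
      normal = t-normal λ x → trans (frame-inj z (p x)) (ρ-e _)

    in-distinct : ∀ z → ¬ (in′ z e ≈ in′ z h∗)
    in-distinct z (_ , a , p) = h∗∉K (proj₁ (t-normal {a} {h∗} λ x → sym (trans (cong (λ y → t (ρ h∗ y)) (sym (t⁻t x))) (trans (cong t (trans (frame-inj z (p (t x))) (ρ-e _))) (tt⁻ _)))))

    e⁻¹≡e : e ⁻¹ ≡ e
    e⁻¹≡e = trans (sym (identityˡ (e ⁻¹))) (inverseʳ e)

    four : Vertex → Fin 4 → Raw
    four z zero = out z e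
    four z (suc zero) = out z h∗
    four z (suc (suc zero)) = in′ z e
    four z (suc (suc (suc zero))) = in′ z h∗

    next≢ : ∀ s → next s ≢ rot (suc (suc zero)) s
    next≢ s e = next-irr (next s) e

    four-inj : ∀ z i j → four z i ≈ four z j → i ≡ j
    four-inj z zero zero _ = refl
    four-inj z zero (suc zero) e = ⊥-elim (out-distinct z e)
    four-inj z zero (suc (suc zero)) e = ⊥-elim (next≢ _ (same-layer e))
    four-inj z zero (suc (suc (suc zero))) e = ⊥-elim (next≢ _ (same-layer e))
    four-inj z (suc zero) zero e = ⊥-elim (out-distinct z (≈-sym e))
    four-inj z (suc zero) (suc zero) _ = refl
    four-inj z (suc zero) (suc (suc zero)) e = ⊥-elim (next≢ _ (same-layer e))
    four-inj z (suc zero) (suc (suc (suc zero))) e = ⊥-elim (next≢ _ (same-layer e))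
    four-inj z (suc (suc zero)) zero e = ⊥-elim (next≢ _ (sym (same-layer e)))
    four-inj z (suc (suc zero)) (suc zero) e = ⊥-elim (next≢ _ (sym (same-layer e)))
    four-inj z (suc (suc zero)) (suc (suc zero)) _ = refl
    four-inj z (suc (suc zero)) (suc (suc (suc zero))) e = ⊥-elim (in-distinct z e)
    four-inj z (suc (suc (suc zero))) zero e = ⊥-elim (next≢ _ (sym (same-layer e)))
    four-inj z (suc (suc (suc zero))) (suc zero) e = ⊥-elim (next≢ _ (sym (same-layer e)))
    four-inj z (suc (suc (suc zero))) (suc (suc zero)) e = ⊥-elim (in-distinct z (≈-sym e))
    four-inj z (suc (suc (suc zero))) (suc (suc (suc zero))) _ = refl

    four-arc : ∀ z i → (rep z ⟶ four z i) ⊎ (four z i ⟶ rep z)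
    four-arc z zero = inj₁ (out-arc z e)
    four-arc z (suc zero) = inj₁ (out-arc z h∗)
    four-arc z (suc (suc zero)) = inj₂ (in-arc z e)
    four-arc z (suc (suc (suc zero))) = inj₂ (in-arc z h∗)

    four-all : ∀ z y → (rep z ⟶ y) ⊎ (y ⟶ rep z) → Σ[ i ∈ Fin 4 ] four z i ≈ y
    four-all z y (inj₁ a) = decide (K′? (proj₁ (arrow a)))
      where
      decide : Dec (K′ (proj₁ (arrow a))) → Σ[ i ∈ Fin 4 ] four z i ≈ y
      decide (yes k) = zero , out-coset z y a e (subst K′ (sym (trans (cong (proj₁ (arrow a) ∙_) e⁻¹≡e) (identityʳ _))) k)
      decide (no ¬k) = suc zero , out-coset z y a h∗ (K′-index ¬k h∗∉K′)
    four-all z y (inj₂ a) = decide (K? (proj₁ (proj₂ (arrow a)) ⁻¹))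
      where
      decide : Dec (K (proj₁ (proj₂ (arrow a)) ⁻¹)) → Σ[ i ∈ Fin 4 ] four z i ≈ y
      decide (yes k) = suc (suc zero) , in-coset z y a e (subst K (sym (trans (cong ((proj₁ (proj₂ (arrow a)) ⁻¹) ∙_) e⁻¹≡e) (identityʳ _))) k)
      decide (no ¬k) = suc (suc (suc zero)) , in-coset z y a h∗ (K-index ¬k h∗∉K)

    neighbours : ∀ z → Neighbours Γ z 4
    neighbours z = (λ i → proj₁ (w i)) , (λ {i} {j} e → four-inj z i j (≈-trans (≈-sym (proj₂ (w i))) (subst (λ y → rep y ≈ four z j) (sym e) (proj₂ (w j))))) ,
      (λ i → ⇒~ ([ (λ a → inj₁ (⟶-resp ≈-refl (≈-sym (proj₂ (w i))) a)) , (λ a → inj₂ (⟶-resp (≈-sym (proj₂ (w i))) ≈-refl a)) ]′ (four-arc z i))) ,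
      λ y a → let (i , e) = four-all z (rep y) (~⇒ a) in i , rep-inj (≈-trans (proj₂ (w i)) e)
      where
      w : ∀ i → Σ[ z′ ∈ Vertex ] rep z′ ≈ four z i
      w i = neighbour z (four-arc z i)

    outs : ∀ {z z₁ z₂} → rep z ⟶ rep z₁ → rep z ⟶ rep z₂ → Σ[ α ∈ Automorphism Γ ] Induced α × z · α ≡ z × z₁ · α ≡ z₂
    outs {z} {z₁} {z₂} (l₁ , h₁ , g₁ , p₁) (l₂ , h₂ , g₂ , p₂) = proj₁ tr , (zero , σ , σ-bijective , proj₂ tr) ,
        rep-inj (≈-trans (≈-sym (proj₂ tr z)) fixes) , rep-inj (≈-trans (≈-sym (proj₂ tr z₁)) (trans l₁ (sym l₂) , g₂ ∙ (g₁ ⁻¹) , moves))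
      where
      -- Conjugated by the frame of `z`, translation by `a` fixes `z` and turns the factor `ρ h₁`
      -- into `ρ h₂`.
      a = (h₁ ⁻¹) ∙ h₂
      f = frame z
      f⁻ = proj₁ (bijective z)
      f⁻f = proj₁ (proj₂ (bijective z))
      ff⁻ = proj₂ (proj₂ (bijective z))
      σ : X → X
      σ x = f (ρ a (f⁻ x))
      σ-bijective : Bijective σ
      σ-bijective = (λ x → f (ρ (a ⁻¹) (f⁻ x))) , (λ x → trans (cong (λ y → f (ρ (a ⁻¹) y)) (f⁻f _)) (trans (cong f (ρ⁻ρ a _)) (ff⁻ x))) ,
        (λ x → trans (cong (λ y → f (ρ a y)) (f⁻f _)) (trans (cong f (ρρ⁻ a _)) (ff⁻ x)))
      fixes : Φ zero σ (rep z) ≈ rep z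
      fixes = ≈-sym (refl , a , λ x → cong (λ y → f (ρ a y)) (f⁻f x))
      tr = transfer zero σ σ-bijective z z fixes
      moves : ∀ x → frame z₂ x ≡ σ (frame z₁ (ρ (g₂ ∙ (g₁ ⁻¹)) x))
      moves x = trans (p₂ x) (sym (trans (cong σ (p₁ _)) (trans (cong (λ y → f (ρ a y)) (f⁻f _))
        (cong f (trans (ρ-∘ a h₁ _) (cong₂ (λ k y → ρ k (t y)) (trans (sym (assoc h₁ (h₁ ⁻¹) h₂)) (trans (cong (_∙ h₂) (inverseʳ h₁)) (identityˡ h₂)))
          (trans (ρ-∘ g₁ _ x) (cong (λ k → ρ k x) (divide g₂ g₁)))))))))

  action : OrientedAction coded
  action = record
    { Γ = Γ
    ; connected = connected
    ; arc = λ z z′ → rep z ⟶ rep z′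
    ; arc⇒~ = λ a → ⇒~ (inj₁ a)
    ; ~⇒arc = ~⇒
    ; arc-anti = ⟶-anti
    ; 𝒢 = Induced
    ; 𝒢-∙ = λ { {α} {β} (r , σ , (σ⁻ , σ⁻σ , σσ⁻) , p) (r′ , σ′ , (σ′⁻ , σ′⁻σ′ , σ′σ′⁻) , p′) →
        proj₁ (rot-rot r r′) , (λ x → σ′ (σ x)) ,
        ((λ x → σ⁻ (σ′⁻ x)) , (λ x → trans (cong σ⁻ (σ′⁻σ′ _)) (σ⁻σ x)) , (λ x → trans (cong σ′ (σσ⁻ _)) (σ′σ′⁻ x))) ,
        λ z → ≈-trans (≈-pointwise (sym (proj₂ (rot-rot r r′) _)) (λ x → refl)) (≈-trans (Φ-≈ r′ σ′ (p z)) (p′ (z · α))) }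
    ; 𝒢-⁻¹ = λ { {α} (r , σ , (σ⁻ , σ⁻σ , σσ⁻) , p) → rot⁻ r , σ⁻ , (σ , σσ⁻ , σ⁻σ) ,
        λ z → ≈-trans (Φ-≈ (rot⁻ r) σ⁻ (≈-sym (subst (λ y → Φ r σ (rep (z · (α Au.⁻¹))) ≈ rep y) (Perm.inverseʳ (Automorphism.perm α)) (p (z · (α Au.⁻¹))))))
          (≈-pointwise (rot⁻-rot r _) (λ x → σ⁻σ _)) }
    ; 𝒢-arc = λ { (r , σ , _ , p) {z} {z′} a → ⟶-resp (p z) (p z′) (Φ-⟶ r σ a) }
    ; transitive = λ z z′ → let (f⁻ , f⁻f , ff⁻) = bijective z ; (g⁻ , g⁻g , gg⁻) = bijective z′ ; (r , er) = rot-transitive (layer z) (layer z′)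
                                σ = λ x → frame z′ (f⁻ x)
                                σ-bijective = (λ x → frame z (g⁻ x)) , (λ x → trans (cong (frame z) (g⁻g _)) (ff⁻ x)) , (λ x → trans (cong (frame z′) (f⁻f _)) (gg⁻ x))
                                maps = ≈-pointwise er (λ x → cong (frame z′) (f⁻f x))
                                (α , p) = transfer r σ σ-bijective z z′ maps in
        α , (r , σ , σ-bijective , p) , rep-inj (≈-trans (≈-sym (p z)) maps)
    ; outs = λ {z} {z₁} {z₂} → outs {z} {z₁} {z₂}
    ; base = root
    ; act = λ h → proj₁ (act h)
    ; act-𝒢 = λ h → zero , ρ h , ρ-bijective h , proj₂ (act h)
    ; act-fix = act-fix
    ; act-cong = λ { refl z → refl }
    ; act-∙ = λ h k z → rep-inj (≈-trans (≈-sym (proj₂ (act (h ∙ k)) z)) (≈-trans (≈-pointwise refl (λ x → sym (ρ-∘ k h _)))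
        (≈-trans (Φ-≈ zero (ρ k) (proj₂ (act h) z)) (proj₂ (act k) (z · proj₁ (act h))))))
    ; act-inj = act-inj
    ; act-sur = λ { α (r , σ , _ , p) fix → stabilizer α r σ p (≈-trans (Φ-≈ r σ (≈-sym rep-root)) (≈-trans (subst (λ y → Φ r σ (rep root) ≈ rep y) fix (p root)) rep-root)) }
    ; neighbours = neighbours
    }
    where
    stabilizer : ∀ α r σ → (∀ z → Φ r σ (rep z) ≈ rep (z · α)) → Φ r σ (zero , id) ≈ (zero , id) → Σ[ h ∈ Fin n ] α Au.≈ proj₁ (act h)
    stabilizer α zero σ p (_ , h , q) = h ⁻¹ , λ z → rep-inj (≈-trans (≈-sym (p z)) (≈-trans (≈-pointwise refl (λ x → translation (frame z x))) (proj₂ (act (h ⁻¹)) z)))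
      where
      translation : ∀ x → σ x ≡ ρ (h ⁻¹) x
      translation x = trans (cong σ (sym (ρρ⁻ h x))) (sym (q (ρ (h ⁻¹) x)))
    stabilizer α (suc zero) σ p (() , _)
    stabilizer α (suc (suc zero)) σ p (() , _)

  -- Cycles of the bottom graph

  private
    code : X → Fin (n * 2)
    code (i , y) = Fin.combine i y

    code-inj : ∀ {x y} → code x ≡ code y → x ≡ y
    code-inj {i , y} {i′ , y′} e = cong₂ _,_ (proj₁ (Finₚ.combine-injective i y i′ y′ e)) (proj₂ (Finₚ.combine-injective i y i′ y′ e))

    -- The second condition makes the length a multiple of 3, as the return to a layer requires. The
    -- least period is taken so that no vertex is repeated within it.
    Period : ℕ → Set
    Period l = (∀ x → iter t (suc l) x ≡ x) × (∀ s → iter next (suc l) s ≡ s)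

    period? : ∀ l → Dec (Period l)
    period? l = all-X? (λ x → iter t (suc l) x ≟ₓ x) ×-dec Finₚ.all? (λ s → iter next (suc l) s Finₚ.≟ s)

    next³ : ∀ s → iter next 3 s ≡ s
    next³ zero = refl
    next³ (suc zero) = refl
    next³ (suc (suc zero)) = refl

    some-period : Σ[ l ∈ ℕ ] Period l
    some-period = ℕ.pred (3 * N!) , (λ x → trans (cong (λ l → iter t l x) is-suc) (iter-* t N! (finite-order (n * 2) code code-inj t t-inj x) 3)) ,
        (λ s → trans (cong (λ l → iter next l s) (trans is-suc (ℕₚ.*-comm 3 N!))) (iter-* next 3 (next³ s) N!))
      where
      N! = (n * 2) !
      is-suc : suc (ℕ.pred (3 * N!)) ≡ 3 * N!
      is-suc = ℕₚ.suc-pred (3 * N!) {{ℕ.>-nonZero (ℕₚ.≤-trans (ℕₚ.1≤n! (n * 2)) (ℕₚ.m≤n*m N! 3))}}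

    opaque
      least-period : Σ[ l ∈ ℕ ] Period l × (∀ i → i < l → ¬ Period i)
      least-period = least Period period? (proj₁ some-period) (proj₂ some-period)

  κ : ℕ
  κ = proj₁ least-period

  private
    k : ℕ
    k = suc κ

    module Line (z : Vertex) (a : Fin n) where
      pos : ℕ → Raw
      pos i = iter next i (layer z) , λ x → frame z (ρ a (iter t i x))

      pos-arc : ∀ i → pos i ⟶ pos (suc i)
      pos-arc i = iter-suc next i (layer z) , e , e , λ x → cong (λ y → frame z (ρ a (iter t i y))) (trans (cong t (sym (ρ-e x))) (sym (ρ-e _)))

      vertex : ∀ i → Σ[ v ∈ Vertex ] rep v ≈ pos i
      vertex zero = z , (refl , a , λ x → refl)
      vertex (suc i) = neighbour (proj₁ (vertex i)) (inj₁ (⟶-resp (≈-sym (proj₂ (vertex i))) ≈-refl (pos-arc i)))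

      at : ℕ → Vertex
      at i = proj₁ (vertex i)

      arcs : ∀ i → rep (at i) ⟶ rep (at (suc i))
      arcs i = ⟶-resp (≈-sym (proj₂ (vertex i))) (≈-sym (proj₂ (vertex (suc i)))) (pos-arc i)

      Equal : ℕ → ℕ → Set
      Equal i j = iter next i (layer z) ≡ iter next j (layer z) × (∀ x → iter t i x ≡ iter t j x)

      -- A coincidence of vertices equates two powers of `t` up to a translation, which is trivial
      -- because `t` fixes `(e , zero)`.
      equal : ∀ i j → at i ≡ at j → Equal i j
      equal i j eq = same-layer pos≈ , λ x → trans (cong (iter t i) (sym (trans (cong (λ g → ρ g x) h≡e) (ρ-e x)))) (sym (slide x))
        where
        pos≈ : pos i ≈ pos j
        pos≈ = ≈-trans (≈-sym (proj₂ (vertex i))) (subst (λ v → rep v ≈ pos j) (sym eq) (proj₂ (vertex j)))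
        h = proj₁ (translate pos≈)
        slide : ∀ x → iter t j x ≡ iter t i (ρ h x)
        slide x = trans (sym (ρ⁻ρ a _)) (trans (cong (ρ (a ⁻¹)) (frame-inj z (proj₂ (translate pos≈) x))) (ρ⁻ρ a _))
        fixed : ∀ i → iter t i (e , zero) ≡ (e , zero)
        fixed zero = refl
        fixed (suc i) = trans (cong (iter t i) (cong₂ _,_ τ-e (toggle-⇔ (K? e) (yes K-e) (λ _ → K-e) (λ _ → K-e) zero))) (fixed i)
        h≡e : h ≡ e
        h≡e = trans (sym (identityˡ h)) (cong proj₁ (iter-inj t t-inj i (trans (sym (slide (e , zero))) (trans (fixed j) (sym (fixed i))))))

      unequal : ∀ i j → Equal i j → at i ≡ at j
      unequal i j (l , p) = rep-inj (≈-trans (proj₂ (vertex i)) (≈-trans (≈-pointwise l (λ x → cong (λ y → frame z (ρ a y)) (p x))) (≈-sym (proj₂ (vertex j)))))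

      next-commutes : ∀ d (s s′ : Z₃) → iter next d s ≡ s → iter next d s′ ≡ s′
      next-commutes d s s′ fix = let (r , er) = rot-transitive s s′ in
        trans (cong (iter next d) (sym er)) (trans (sym (iter-+ next (toℕ r) d s)) (trans (cong (λ l → iter next l s) (ℕₚ.+-comm (toℕ r) d)) (trans (iter-+ next d (toℕ r) s) (trans (cong (rot r) fix) er))))

      injective : ∀ {i j} → i ≤ j → j < k → at i ≡ at j → i ≡ j
      injective {i} {j} i≤j j<k eq = finish (j ∸ i) (ℕₚ.m∸n+n≡m i≤j) (ℕₚ.≤-<-trans (ℕₚ.m∸n≤m j i) j<k)
        where
        finish : ∀ d → d + i ≡ j → d < k → i ≡ j
        finish zero e _ = e
        finish (suc d) e (s≤s d<κ) = ⊥-elim (proj₂ (proj₂ least-period) d d<κ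
          ((λ x → iter-inj t t-inj i (trans (sym (iter-+ t (suc d) i x)) (trans (cong (λ l → iter t l x) e) (sym (proj₂ (equal i j eq) x))))) ,
           (λ s → next-commutes (suc d) (layer z) s (iter-inj next next-inj i (trans (sym (iter-+ next (suc d) i (layer z))) (trans (cong (λ l → iter next l (layer z)) e) (sym (proj₁ (equal i j eq)))))))))

      cycle : Cycle Γ κ
      cycle = record
        { at = at
        ; adj = λ i → ⇒~ (inj₁ (arcs i))
        ; per = λ i → unequal (i + k) i (trans (iter-+ next i k (layer z)) (proj₂ (proj₁ (proj₂ least-period)) _) , λ x → trans (iter-+ t i k x) (proj₁ (proj₁ (proj₂ least-period)) _))
        ; det = λ {i} {j} e → unequal (suc i) (suc j) (trans (iter-suc next i (layer z)) (trans (cong next (proj₁ (equal i j e))) (sym (iter-suc next j (layer z)))) , λ x → proj₂ (equal i j e) (t x))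
        ; norev = λ {i} {j} e f → ⟶-anti (arcs j) (subst₂ (λ u v → rep u ⟶ rep v) e f (arcs i))
        ; inj = λ {i} {j} i< j< e → [ (λ i≤j → injective i≤j j< e) , (λ j≤i → sym (injective j≤i i< (sym e))) ]′ (ℕₚ.≤-total i j) }

  -- Both closed walks follow powers of `t`, one after the translation by `h∗`. They leave `z` by
  -- different arcs because `h∗` is outside K′, and enter it by different arcs because `h∗` is
  -- outside K.
  crossing : Crossing Γ κ
  crossing z = P.cycle , Q.cycle , refl , refl , first , last
    where
    module P = Line z e
    module Q = Line z h∗
    first : Avoids Γ Q.cycle z (P.at 1)
    first i = (λ eq → out-distinct z (≈-trans (≈-pointwise refl (λ x → refl)) (≈-trans (≈-sym (proj₂ (P.vertex 1))) (≈-trans (subst (λ v → rep v ≈ rep (Q.at (suc i))) (proj₂ eq) ≈-refl)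
        (≈-trans (subst (λ v → rep (Q.at (suc i)) ≈ rep v) (Cycle.det Q.cycle {i} {0} (proj₁ eq)) ≈-refl) (proj₂ (Q.vertex 1))))))) ,
      (λ eq → ⟶-anti (P.arcs 0) (subst₂ (λ u v → rep u ⟶ rep v) (proj₁ eq) (proj₂ eq) (Q.arcs i)))
    last : Avoids Γ Q.cycle (P.at κ) z
    last i = (λ eq → h∗∉K (proj₁ (t-normal {proj₁ (back eq)} {h∗} (proj₂ (back eq))))) ,
      (λ eq → ⟶-anti (subst (λ v → rep (P.at κ) ⟶ rep v) (Cycle.per P.cycle 0) (P.arcs κ)) (subst₂ (λ u v → rep u ⟶ rep v) (proj₁ eq) (proj₂ eq) (Q.arcs i)))
      where
      back : Q.at i ≡ P.at κ × Q.at (suc i) ≡ z → Σ[ a ∈ Fin n ] (∀ x → ρ a (t x) ≡ t (ρ h∗ x))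
      back (eᵢ , e₀) = b ⁻¹ , λ x → sym (trans (cong (λ y → t (ρ h∗ y)) (sym (turns x))) (trans (cong t (swap (t x))) (last-step _)))
        where
        cyc = proj₁ (proj₂ least-period)
        turns : ∀ x → iter t i (t x) ≡ x
        turns x = proj₂ (Q.equal (suc i) 0 e₀) x
        pos≈ : Q.pos i ≈ P.pos κ
        pos≈ = ≈-trans (≈-sym (proj₂ (Q.vertex i))) (≈-trans (subst (λ v → rep (Q.at i) ≈ rep v) eᵢ ≈-refl) (proj₂ (P.vertex κ)))
        b = proj₁ (translate pos≈)
        swap : ∀ x → ρ h∗ (iter t i x) ≡ iter t κ (ρ (b ⁻¹) x)
        swap x = trans (cong (λ y → ρ h∗ (iter t i y)) (sym (ρρ⁻ b x))) (trans (sym (frame-inj z (proj₂ (translate pos≈) (ρ (b ⁻¹) x)))) (ρ-e _))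
        last-step : ∀ x → t (iter t κ x) ≡ x
        last-step x = trans (sym (iter-suc t κ x)) (proj₁ cyc x)

  realization : HalfArcTransitiveStabilizer coded
  realization = covering-graph action κ crossing n id λ x → x , refl
-- From a concentric sequence to a graph

module FromConcentric {c ℓ} (H : Group c ℓ) (hn : ℕ) (code : HasOrder H hn) (N′ : ℕ) (a : ℕ → Group.Carrier H)
  (sequence : IsConcentricSequence H (suc N′) a) where

  open Group H renaming (refl to ≈-refl; sym to ≈-sym; trans to ≈-trans)
  open IsConcentricSequence sequence

  private
    N = suc N′

    to : Carrier → Fin hn
    to = Inverse.to code

    from : Fin hn → Carrier
    from = Inverse.from code

    to-cong : ∀ {x y} → x ≈ y → to x ≡ to y
    to-cong = Inverse.to-cong code

    from-to : ∀ x → from (to x) ≈ x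
    from-to x = proj₂ (Inverse.inverse code) refl

    to-from : ∀ i → to (from i) ≡ i
    to-from i = proj₁ (Inverse.inverse code) ≈-refl

    to-inj : ∀ {x y} → to x ≡ to y → x ≈ y
    to-inj {x} {y} e = ≈-trans (≈-sym (from-to x)) (≈-trans (Inverse.from-cong code e) (from-to y))

    _≟_ : ∀ x y → Dec (x ≈ y)
    x ≟ y = map′ to-inj to-cong (to x Finₚ.≟ to y)

  open Orders H _≟_

  private
    Gen : ℕ → ℕ → Carrier → Set _
    Gen i j = Generated H (Segment H a i j)

    segment-⊆ : ∀ {i i′ j j′} → i′ ≤ i → j ≤ j′ → ∀ {x} → Gen i j x → Gen i′ j′ x
    segment-⊆ i′≤i j≤j′ = generated-⊆ H λ { (k , i≤k , k≤j , e) → gen (k , ℕₚ.≤-trans i′≤i i≤k , ℕₚ.≤-trans k≤j j≤j′ , e) }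

    empty-segment : ∀ {i j} → j < i → ∀ {x} → Gen i j x → x ≈ ε
    empty-segment j<i = generated-trivial H λ { (k , i≤k , k≤j , _) → ⊥-elim (ℕₚ.<⇒≱ j<i (ℕₚ.≤-trans i≤k k≤j)) }

    -- Unlike the field order, this covers the empty segments.
    order′ : ∀ i j l → 1 ≤ i → j ≤ N → i + l ≡ suc j → HasOrder (⟨_⟩ H (Segment H a i j)) (2 ^ l)
    order′ i j zero 1≤i j≤N e = record
      { to = λ _ → zero ; from = λ _ → ε , ε′ ; to-cong = λ _ → refl ; from-cong = λ _ → ≈-refl
      ; inverse = (λ { {zero} _ → refl }) , λ {x} _ → ≈-sym (empty-segment (ℕₚ.≤-reflexive (trans (sym e) (ℕₚ.+-identityʳ i))) (proj₂ x)) }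
    order′ i j (suc l) 1≤i j≤N e = subst (λ m → HasOrder (⟨_⟩ H (Segment H a i j)) (2 ^ m))
        (trans (ℕₚ.+-comm (j ∸ i) 1) (cong suc (trans (cong (_∸ i) (sym e′)) (ℕₚ.m+n∸m≡n i l)))) (order i j 1≤i (subst (i ≤_) e′ (ℕₚ.m≤m+n i l)) j≤N)
      where
      e′ : i + l ≡ j
      e′ = ℕₚ.suc-injective (trans (sym (ℕₚ.+-suc i l)) e)

    K K′ : Carrier → Set _
    K = Gen 1 N′
    K′ = Gen 2 N

    oK : HasOrder (⟨_⟩ H (Segment H a 1 N′)) (2 ^ N′)
    oK = order′ 1 N′ N′ ℕₚ.≤-refl (ℕₚ.n≤1+n N′) refl

    oK′ : HasOrder (⟨_⟩ H (Segment H a 2 N)) (2 ^ N′)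
    oK′ = order′ 2 N N′ (s≤s z≤n) ℕₚ.≤-refl refl

    oG : HasOrder (⟨_⟩ H (Segment H a 1 N)) (2 ^ N)
    oG = order′ 1 N N ℕₚ.≤-refl ℕₚ.≤-refl refl

    positive : ∀ l → 0 < 2 ^ l
    positive l = ℕₚ.m^n>0 2 l

    K? : ∀ x → Dec (K x)
    K? = member? oK

    K′? : ∀ x → Dec (K′ x)
    K′? = member? oK′

    K-index : ∀ {x y} → ¬ K x → ¬ K y → K (x ∙ y ⁻¹)
    K-index {x} {y} = index-two oK oG (positive N′) (segment-⊆ ℕₚ.≤-refl (ℕₚ.n≤1+n N′)) (generates x) (generates y)

    K′-index : ∀ {x y} → ¬ K′ x → ¬ K′ y → K′ (x ∙ y ⁻¹)
    K′-index {x} {y} = index-two oK′ oG (positive N′) (segment-⊆ (s≤s z≤n) ℕₚ.≤-refl) (generates x) (generates y)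

    d d′ : Carrier
    d = a N
    d′ = a 1

    d∉K : ¬ K d
    d∉K d∈K = strict oK oG (positive N′) (generated-⊆ H λ { (k , 1≤k , k≤N , e) → [ (λ k<N → gen (k , 1≤k , ℕₚ.≤-pred k<N , e)) ,
      (λ k≡N → resp (≈-sym (subst (λ l → _ ≈ a l) k≡N e)) d∈K) ]′ (ℕₚ.m≤n⇒m<n∨m≡n k≤N) })

    d′∉K′ : ¬ K′ d′
    d′∉K′ d′∈K′ = strict oK′ oG (positive N′) (generated-⊆ H λ { (k , 1≤k , k≤N , e) → [ (λ 1<k → gen (k , 1<k , k≤N , e)) ,
      (λ 1≡k → resp (≈-sym (subst (λ l → _ ≈ a l) (sym 1≡k) e)) d′∈K′) ]′ (ℕₚ.m≤n⇒m<n∨m≡n 1≤k) })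

    φ : Σ Carrier K → Σ Carrier K′
    φ = proj₁ shift

    module φ = IsGroupIsomorphism (proj₂ shift)

    φ-cong : ∀ {x y : Σ Carrier K} → proj₁ x ≈ proj₁ y → proj₁ (φ x) ≈ proj₁ (φ y)
    φ-cong {x} {y} e = φ.⟦⟧-cong {x} {y} e

    divide : ∀ {x} → ¬ K x → K (d ⁻¹ ∙ x)
    divide {x} x∉ = resp (∙-congˡ (GroupProperties.⁻¹-involutive H x)) (K-index (λ g → d∉K (unflip g)) (λ g → x∉ (unflip g)))
      where
      unflip : ∀ {x} → K (x ⁻¹) → K x
      unflip g = resp (GroupProperties.⁻¹-involutive H _) (inv g)

    divide′ : ∀ {x} → ¬ K′ x → K′ (d′ ⁻¹ ∙ x)
    divide′ {x} x∉ = resp (∙-congˡ (GroupProperties.⁻¹-involutive H x)) (K′-index (λ g → d′∉K′ (unflip g)) (λ g → x∉ (unflip g)))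
      where
      unflip : ∀ {x} → K′ (x ⁻¹) → K′ x
      unflip g = resp (GroupProperties.⁻¹-involutive H _) (inv g)

    times-back : ∀ {x y} → x ∙ (x ⁻¹ ∙ y) ≈ y
    times-back {x} {y} = ≈-trans (≈-sym (assoc x (x ⁻¹) y)) (≈-trans (∙-congʳ (inverseʳ x)) (identityˡ y))

    -- τ extends φ to a bijection of H compatible with right multiplication by K.
    Τ : ∀ x → Dec (K x) → Carrier
    Τ x (yes k) = proj₁ (φ (x , k))
    Τ x (no ¬k) = d′ ∙ proj₁ (φ (d ⁻¹ ∙ x , divide ¬k))

    τ : Carrier → Carrier
    τ x = Τ x (K? x)

    Τ-in : ∀ {x} (k : K x) c → Τ x c ≈ proj₁ (φ (x , k))
    Τ-in k (yes k′) = φ-cong ≈-refl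
    Τ-in k (no ¬k) = ⊥-elim (¬k k)

    Τ-out : ∀ {x} → ¬ K x → (k : K (d ⁻¹ ∙ x)) → ∀ c → Τ x c ≈ d′ ∙ proj₁ (φ (d ⁻¹ ∙ x , k))
    Τ-out ¬k k (yes k′) = ⊥-elim (¬k k′)
    Τ-out ¬k k (no _) = ∙-congˡ (φ-cong ≈-refl)

    τ-in : ∀ {x} (k : K x) → τ x ≈ proj₁ (φ (x , k))
    τ-in {x} k = Τ-in k (K? x)

    τ-out : ∀ {x} → ¬ K x → (k : K (d ⁻¹ ∙ x)) → τ x ≈ d′ ∙ proj₁ (φ (d ⁻¹ ∙ x , k))
    τ-out {x} ¬k k = Τ-out ¬k k (K? x)

    τ-cong : ∀ {x y} → x ≈ y → τ x ≈ τ y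
    τ-cong {x} {y} e = decide (K? x)
      where
      decide : Dec (K x) → τ x ≈ τ y
      decide (yes k) = ≈-trans (τ-in k) (≈-trans (φ-cong e) (≈-sym (τ-in (resp e k))))
      decide (no ¬k) = ≈-trans (τ-out ¬k (divide ¬k)) (≈-trans (∙-congˡ (φ-cong (∙-congˡ e))) (≈-sym (τ-out (λ k → ¬k (resp (≈-sym e) k)) (resp (∙-congˡ e) (divide ¬k)))))

    τ-K : ∀ {x} → K x → K′ (τ x)
    τ-K {x} k = resp (≈-sym (τ-in k)) (proj₂ (φ (x , k)))

    outside′ : ∀ {x} → K′ (d′ ∙ x) → K′ x → ⊥
    outside′ g k = d′∉K′ (resp cancelʳ (g ∙′ inv k))

    outside : ∀ {x} → K (d ∙ x) → K x → ⊥
    outside g k = d∉K (resp cancelʳ (g ∙′ inv k))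

    τ-K⁻ : ∀ {x} → K′ (τ x) → K x
    τ-K⁻ {x} k′ = decidable-stable (K? x) λ ¬k → outside′ (resp (τ-out ¬k (divide ¬k)) k′) (proj₂ (φ (_ , divide ¬k)))

    τ-∙ : ∀ x {b} → K b → τ (x ∙ b) ≈ τ x ∙ τ b
    τ-∙ x {b} b∈ = decide (K? x)
      where
      decide : Dec (K x) → τ (x ∙ b) ≈ τ x ∙ τ b
      decide (yes k) = ≈-trans (τ-in (k ∙′ b∈)) (≈-trans (φ.∙-homo (x , k) (b , b∈)) (∙-cong (≈-sym (τ-in k)) (≈-sym (τ-in b∈))))
      decide (no ¬k) = ≈-trans (τ-out (λ k → ¬k (resp cancelʳ (k ∙′ inv b∈))) (resp (assoc (d ⁻¹) x b) (divide ¬k ∙′ b∈)))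
        (≈-trans (∙-congˡ (≈-trans (φ-cong (≈-sym (assoc (d ⁻¹) x b))) (φ.∙-homo (d ⁻¹ ∙ x , divide ¬k) (b , b∈))))
          (≈-trans (≈-sym (assoc _ _ _)) (∙-cong (≈-sym (τ-out ¬k (divide ¬k))) (≈-sym (τ-in b∈)))))

    φ⁻ : Σ Carrier K′ → Σ Carrier K
    φ⁻ y = proj₁ (φ.surjective y)

    φφ⁻ : ∀ y → proj₁ (φ (φ⁻ y)) ≈ proj₁ y
    φφ⁻ y = proj₂ (φ.surjective y) {φ⁻ y} ≈-refl

    Τ⁻ : ∀ y → Dec (K′ y) → Carrier
    Τ⁻ y (yes k) = proj₁ (φ⁻ (y , k))
    Τ⁻ y (no ¬k) = d ∙ proj₁ (φ⁻ (d′ ⁻¹ ∙ y , divide′ ¬k))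

    τ⁻ : Carrier → Carrier
    τ⁻ y = Τ⁻ y (K′? y)

    ττ⁻ : ∀ y → τ (τ⁻ y) ≈ y
    ττ⁻ y = go (K′? y)
      where
      go : ∀ c → τ (Τ⁻ y c) ≈ y
      go (yes k) = ≈-trans (τ-in (proj₂ (φ⁻ (y , k)))) (φφ⁻ (y , k))
      go (no ¬k) = ≈-trans (τ-out (λ g → outside g (proj₂ x)) (resp (≈-sym cancelˡ) (proj₂ x)))
          (≈-trans (∙-congˡ (≈-trans (φ-cong cancelˡ) (φφ⁻ _))) times-back)
        where x = φ⁻ (d′ ⁻¹ ∙ y , divide′ ¬k)

    τ-inj : ∀ {x y} → τ x ≈ τ y → x ≈ y
    τ-inj {x} {y} e = decide (K? x) (K? y)
      where
      decide : Dec (K x) → Dec (K y) → x ≈ y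
      decide (yes k) (yes l) = φ.injective {x , k} {y , l} (≈-trans (≈-sym (τ-in k)) (≈-trans e (τ-in l)))
      decide (yes k) (no ¬l) = ⊥-elim (¬l (τ-K⁻ (resp e (τ-K k))))
      decide (no ¬k) (yes l) = ⊥-elim (¬k (τ-K⁻ (resp (≈-sym e) (τ-K l))))
      decide (no ¬k) (no ¬l) = ≈-trans (≈-sym times-back) (≈-trans (∙-congˡ (φ.injective {_ , divide ¬k} {_ , divide ¬l}
        (≈-trans (≈-sym cancelˡ) (≈-trans (∙-congˡ (≈-trans (≈-sym (τ-out ¬k (divide ¬k))) (≈-trans e (τ-out ¬l (divide ¬l))))) cancelˡ)))) times-back)

    τ-ε : τ ε ≈ ε
    τ-ε = ≈-trans (τ-in ε′) φ.ε-homo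

    -- A group is not the union of two proper subgroups.
    h∗ : Σ[ h ∈ Carrier ] ¬ K h × ¬ K′ h
    h∗ = decide (K′? d) (K? d′)
      where
      decide : Dec (K′ d) → Dec (K d′) → Σ[ h ∈ Carrier ] ¬ K h × ¬ K′ h
      decide (no ¬k) _ = d , d∉K , ¬k
      decide (yes _) (no ¬k) = d′ , ¬k , d′∉K′
      decide (yes k) (yes k′) = d′ ∙ d , (λ g → d∉K (resp cancelˡ (inv k′ ∙′ g))) , λ g → d′∉K′ (resp cancelʳ (g ∙′ inv k))

    φ-segment : ∀ i → 1 ≤ i → ∀ {x} → Gen i N′ x → (k : K x) → Gen (suc i) N (proj₁ (φ (x , k)))
    φ-segment i 1≤i (gen (l , i≤l , l≤N′ , e)) k = resp (≈-sym (≈-trans (φ-cong e) (shift-gen l (ℕₚ.≤-trans 1≤i i≤l) l≤N′))) (gen (suc l , s≤s i≤l , s≤s l≤N′ , ≈-refl))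
    φ-segment i 1≤i ε′ k = resp (≈-sym (≈-trans (φ-cong ≈-refl) φ.ε-homo)) ε′
    φ-segment i 1≤i (_∙′_ {x} {y} p q) k = resp (≈-sym (≈-trans (φ-cong ≈-refl) (φ.∙-homo (x , kx) (y , ky)))) (φ-segment i 1≤i p kx ∙′ φ-segment i 1≤i q ky)
      where
      kx = segment-⊆ 1≤i ℕₚ.≤-refl p
      ky = segment-⊆ 1≤i ℕₚ.≤-refl q
    φ-segment i 1≤i (inv {x} p) k = resp (≈-sym (≈-trans (φ-cong ≈-refl) (φ.⁻¹-homo (x , kx)))) (inv (φ-segment i 1≤i p kx))
      where kx = segment-⊆ 1≤i ℕₚ.≤-refl p
    φ-segment i 1≤i (resp {x} e p) k = resp (φ-cong e) (φ-segment i 1≤i p (segment-⊆ 1≤i ℕₚ.≤-refl p))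

    -- Otherwise aₙ would be a product of x and an element of K.
    inside : ∀ j l → suc (j + l) ≡ N → ∀ {x} → Gen (suc j) N x → K x → Gen (suc j) N′ x
    inside j l e {x} x∈ k = decidable-stable (member? small x) λ x∉ →
        d∉K (resp times-back (k ∙′ resp-flip (segment-⊆ (s≤s z≤n) ℕₚ.≤-refl (index-two small large (positive l) (segment-⊆ ℕₚ.≤-refl (ℕₚ.n≤1+n N′)) x∈ d∈ x∉ (λ g → d∉K (segment-⊆ (s≤s z≤n) ℕₚ.≤-refl g))))))
      where
      small : HasOrder (⟨_⟩ H (Segment H a (suc j) N′)) (2 ^ l)
      small = order′ (suc j) N′ l (s≤s z≤n) (ℕₚ.n≤1+n N′) e
      large : HasOrder (⟨_⟩ H (Segment H a (suc j) N)) (2 ^ suc l)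
      large = order′ (suc j) N (suc l) (s≤s z≤n) ℕₚ.≤-refl (cong suc (trans (ℕₚ.+-suc j l) e))
      d∈ : Gen (suc j) N d
      d∈ = gen (N , subst (suc j ≤_) e (s≤s (ℕₚ.m≤m+n j l)) , ℕₚ.≤-refl , ≈-refl)
      resp-flip : K (x ∙ d ⁻¹) → K (x ⁻¹ ∙ d)
      resp-flip g = resp (≈-trans (∙-congˡ (≈-trans (∙-congʳ (≈-trans (GroupProperties.⁻¹-anti-homo-∙ H x (d ⁻¹)) (∙-congʳ (GroupProperties.⁻¹-involutive H d)))) (≈-trans (assoc d (x ⁻¹) x) (≈-trans (∙-congˡ (inverseˡ x)) (identityʳ d))))) ≈-refl)
        (inv k ∙′ (inv g ∙′ k))

    -- H may live in any universe; the truth values of the decision procedures on codes bring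
    -- membership down to `Set`.
    Kᶜ K′ᶜ : Fin hn → Set
    Kᶜ i = True (K? (from i))
    K′ᶜ i = True (K′? (from i))

    τᶜ τ⁻ᶜ : Fin hn → Fin hn
    τᶜ i = to (τ (from i))
    τ⁻ᶜ i = to (τ⁻ (from i))

    infixl 7 _∙ᶜ_
    _∙ᶜ_ : Fin hn → Fin hn → Fin hn
    i ∙ᶜ j = to (from i ∙ from j)

    infix 8 _⁻ᶜ
    _⁻ᶜ : Fin hn → Fin hn
    i ⁻ᶜ = to (from i ⁻¹)

    -- Each round pulls an element back into K, where `inside` removes the last generator from its
    -- segment; shifting forward then removes the first one instead. After N rounds the segment is
    -- empty.
    core : (P : Fin hn → Set) → (∀ g → P g → Σ[ g′ ∈ Fin hn ] Kᶜ g′ × τᶜ g′ ≡ g × P g′) → ∀ g → P g → g ≡ to ε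
    core P step g Pg = trans (sym (to-from g)) (to-cong (empty-segment ℕₚ.≤-refl (descend N ℕₚ.≤-refl g Pg)))
      where
      descend : ∀ j → j ≤ N → ∀ g → P g → Gen (suc j) N (from g)
      descend zero _ g Pg = generates (from g)
      descend (suc j) j<N g Pg = let (g′ , k , e , Pg′) = step g Pg in
        resp (≈-trans (≈-sym (τ-in (toWitness k))) (to-inj (trans e (sym (to-from g)))))
          (φ-segment (suc j) (s≤s z≤n) (inside j (N ∸ suc j) (ℕₚ.m+[n∸m]≡n j<N) (descend j (ℕₚ.<⇒≤ j<N) g′ Pg′) (toWitness k)) (toWitness k))

    assocᶜ : ∀ x y z → x ∙ᶜ y ∙ᶜ z ≡ x ∙ᶜ (y ∙ᶜ z)
    assocᶜ = λ x y z → to-cong (≈-trans (∙-congʳ (from-to _)) (≈-trans (assoc _ _ _) (∙-congˡ (≈-sym (from-to _)))))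

    identityˡᶜ : ∀ x → to ε ∙ᶜ x ≡ x
    identityˡᶜ = λ x → trans (to-cong (≈-trans (∙-congʳ (from-to ε)) (identityˡ _))) (to-from x)

    identityʳᶜ : ∀ x → x ∙ᶜ to ε ≡ x
    identityʳᶜ = λ x → trans (to-cong (≈-trans (∙-congˡ (from-to ε)) (identityʳ _))) (to-from x)

    inverseˡᶜ : ∀ x → x ⁻ᶜ ∙ᶜ x ≡ to ε
    inverseˡᶜ = λ x → to-cong (≈-trans (∙-congʳ (from-to _)) (inverseˡ _))

    inverseʳᶜ : ∀ x → x ∙ᶜ x ⁻ᶜ ≡ to ε
    inverseʳᶜ = λ x → to-cong (≈-trans (∙-congˡ (from-to _)) (inverseʳ _))

    coded : Group 0ℓ 0ℓ
    coded = finite-group hn _∙ᶜ_ (to ε) _⁻ᶜ assocᶜ identityˡᶜ identityʳᶜ inverseˡᶜ inverseʳᶜ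

    realization : HalfArcTransitiveStabilizer coded
    realization = Bottom.realization hn _∙ᶜ_ (to ε) _⁻ᶜ assocᶜ identityˡᶜ identityʳᶜ inverseˡᶜ inverseʳᶜ
      Kᶜ K′ᶜ (λ x → map′ fromWitness toWitness (K? (from x))) (λ x → map′ fromWitness toWitness (K′? (from x)))
      (fromWitness (resp (≈-sym (from-to ε)) ε′))
      (λ b x → fromWitness (resp (≈-sym (from-to _)) (toWitness x ∙′ toWitness b)))
      (λ b xb → fromWitness (resp cancelʳ (resp (from-to _) (toWitness xb) ∙′ inv (toWitness b))))
      (λ x y → fromWitness (resp (≈-sym (≈-trans (from-to _) (∙-congˡ (from-to _)))) (K-index (x ∘ fromWitness) (y ∘ fromWitness))))
      (λ x y → fromWitness (resp (≈-sym (≈-trans (from-to _) (∙-congˡ (from-to _)))) (K′-index (x ∘ fromWitness) (y ∘ fromWitness))))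
      τᶜ τ⁻ᶜ
      (λ x → trans (to-cong (τ-inj (≈-trans (ττ⁻ _) (from-to _)))) (to-from x))
      (λ x → trans (to-cong (≈-trans (τ-cong (from-to _)) (ττ⁻ _))) (to-from x))
      (to-cong (≈-trans (τ-cong (from-to ε)) τ-ε))
      (λ x b → to-cong (≈-trans (τ-cong (from-to _)) (≈-trans (τ-∙ _ (toWitness b)) (∙-cong (≈-sym (from-to _)) (≈-sym (from-to _))))))
      (λ x → fromWitness (resp (≈-sym (from-to _)) (τ-K (toWitness x))))
      (λ x → fromWitness (τ-K⁻ (resp (from-to _) (toWitness x))))
      (to (proj₁ h∗)) (λ g → proj₁ (proj₂ h∗) (resp (from-to _) (toWitness g))) (λ g → proj₂ (proj₂ h∗) (resp (from-to _) (toWitness g)))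
      core

  graph : HalfArcTransitiveStabilizer H
  graph = along {G = H} {H = coded} to (isGroupIsomorphism H coded to to-cong
    (λ x y → to-cong (∙-cong (≈-sym (from-to x)) (≈-sym (from-to y)))) to-inj (λ i → from i , to-from i)) realization

realize : ∀ {c ℓ} (H : Group c ℓ) → Finite H → ¬ Trivial H → Concentric H →
  HalfArcTransitiveStabilizer H
realize H (hn , code) nontrivial (suc N′ , a , sequence) = FromConcentric.graph H hn code N′ a sequence
realize H finite nontrivial (zero , a , sequence) = ⊥-elim (nontrivial λ x →
  generated-trivial H (λ { (k , 1≤k , k≤0 , _) → ⊥-elim (ℕₚ.<⇒≱ 1≤k k≤0) }) (IsConcentricSequence.generates sequence x))

-- The orientation of a half-arc-transitive graph

exactly-⊎ : ∀ {n} {P Q R : Fin n → Set} {d e} → Exactly P d → Exactly Q e → (∀ {x} → P x → R x) → (∀ {x} → Q x → R x) →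
  (∀ {x} → R x → P x ⊎ Q x) → (∀ {x} → P x → ¬ Q x) → Exactly R (d + e)
exactly-⊎ {n} {P} {Q} {R} {d} {e} (f , f-inj , f∈ , f-all) (g , g-inj , g∈ , g-all) P⊆R Q⊆R R⊆ disjoint =
    h ∘ Fin.splitAt d , (λ {i} {j} eq → trans (sym (Finₚ.join-splitAt d e i)) (trans (cong (Fin.join d e) (h-inj (Fin.splitAt d i) (Fin.splitAt d j) eq)) (Finₚ.join-splitAt d e j))) ,
    (λ i → h∈ (Fin.splitAt d i)) , λ x r → find x (R⊆ r)
  where
  h : Fin d ⊎ Fin e → Fin n
  h = [ f , g ]′
  h-inj : ∀ a b → h a ≡ h b → a ≡ b
  h-inj (inj₁ i) (inj₁ j) eq = cong inj₁ (f-inj eq)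
  h-inj (inj₁ i) (inj₂ j) eq = ⊥-elim (disjoint (f∈ i) (subst Q (sym eq) (g∈ j)))
  h-inj (inj₂ i) (inj₁ j) eq = ⊥-elim (disjoint (f∈ j) (subst Q eq (g∈ i)))
  h-inj (inj₂ i) (inj₂ j) eq = cong inj₂ (g-inj eq)
  h∈ : ∀ a → R (h a)
  h∈ (inj₁ i) = P⊆R (f∈ i)
  h∈ (inj₂ i) = Q⊆R (g∈ i)
  find : ∀ x → P x ⊎ Q x → Σ[ i ∈ Fin (d + e) ] h (Fin.splitAt d i) ≡ x
  find x (inj₁ p) = let (i , eq) = f-all x p in Fin.join d e (inj₁ i) , trans (cong h (Finₚ.splitAt-join d e (inj₁ i))) eq
  find x (inj₂ q) = let (i , eq) = g-all x q in Fin.join d e (inj₂ i) , trans (cong h (Finₚ.splitAt-join d e (inj₂ i))) eq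

-- An arc is recoded from its place among the arcs leaving its source to its place among those
-- entering its target.
double-count : ∀ {n} {A : Fin n → Fin n → Set} {d e} → (∀ u → Exactly (A u) d) → (∀ w → Exactly (λ u → A u w) e) → n * d ≤ n * e
double-count {n} {A} {d} {e} out inc = Finₚ.injective⇒≤ {f = f} f-inj
  where
  turn : Fin n × Fin d → Fin n × Fin e
  turn (u , j) = proj₁ (out u) j , proj₁ (proj₂ (proj₂ (proj₂ (inc (proj₁ (out u) j)))) u (proj₁ (proj₂ (proj₂ (out u))) j))
  source : Fin n × Fin e → Fin n
  source (w , k) = proj₁ (inc w) k
  source-turn : ∀ x → source (turn x) ≡ proj₁ x
  source-turn (u , j) = proj₂ (proj₂ (proj₂ (proj₂ (inc (proj₁ (out u) j)))) u (proj₁ (proj₂ (proj₂ (out u))) j))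
  turn-inj : ∀ x y → turn x ≡ turn y → x ≡ y
  turn-inj (u , j) (u′ , j′) eq = same (trans (sym (source-turn (u , j))) (trans (cong source eq) (source-turn (u′ , j′)))) (cong proj₁ eq)
    where
    same : u ≡ u′ → proj₁ (out u) j ≡ proj₁ (out u′) j′ → (u , j) ≡ (u′ , j′)
    same refl eq = cong (u ,_) (proj₁ (proj₂ (out u)) eq)
  f : Fin (n * d) → Fin (n * e)
  f i = let (w , k) = turn (Fin.remQuot {n} d i) in Fin.combine w k
  f-inj : ∀ {i j} → f i ≡ f j → i ≡ j
  f-inj {i} {j} eq = let (e₁ , e₂) = Finₚ.combine-injective _ _ _ _ eq in
    trans (sym (Finₚ.combine-remQuot {n} d i)) (trans (cong (λ x → Fin.combine (proj₁ x) (proj₂ x)) (turn-inj _ _ (cong₂ _,_ e₁ e₂))) (Finₚ.combine-remQuot {n} d j))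

module Orientation (Γ : Graph) (connected : Connected Γ) (tetravalent : Tetravalent Γ) (vertex-transitive : VertexTransitive Γ)
  (edge-transitive : EdgeTransitive Γ) (half : ¬ ArcTransitive Γ) (v : Graph.Vertex Γ) where

  open Graph Γ
  private
    module A = Group (Aut Γ)
    infixl 8 _·_
    _·_ = _^^_ Γ

  undo : ∀ α {u w} → u · α ≡ w → w · (α A.⁻¹) ≡ u
  undo α {u} e = trans (cong (_· (α A.⁻¹)) (sym e)) (A.inverseʳ α u)

  private
    first : Neighbours Γ v 4
    first = degree⇒neighbours Γ v (tetravalent v)

  w : Vertex
  w = proj₁ first zero

  private
    v~w : v ~ w
    v~w = proj₁ (proj₂ (proj₂ first)) zero

  infix 4 _⟶_
  _⟶_ : Vertex → Vertex → Set
  x ⟶ y = Σ[ α ∈ Automorphism Γ ] v · α ≡ x × w · α ≡ y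

  v⟶w : v ⟶ w
  v⟶w = A.ε , refl , refl

  ⟶-· : ∀ α {x y} → x ⟶ y → x · α ⟶ y · α
  ⟶-· α (β , e , e′) = β A.∙ α , cong (_· α) e , cong (_· α) e′

  ⟶-~ : ∀ {x y} → x ⟶ y → x ~ y
  ⟶-~ (α , e , e′) = subst₂ _~_ e e′ (Equivalence.to (Automorphism.preserve α v w) v~w)

  ~-⟶ : ∀ {x y} → x ~ y → (x ⟶ y) ⊎ (y ⟶ x)
  ~-⟶ x~y with edge-transitive v~w x~y
  ... | α , inj₁ e = inj₁ (α , e)
  ... | α , inj₂ e = inj₂ (α , e)

  -- An arc occurring in both directions yields an automorphism reversing v ⟶ w, and then all edges can be reversed.
  ⟶-anti : ∀ {x y} → x ⟶ y → ¬ (y ⟶ x)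
  ⟶-anti {x} {y} (α , e₁ , e₂) (β , e₃ , e₄) = half λ p~q r~s → join (both p~q) (both r~s)
    where
    ρ = β A.∙ (α A.⁻¹)
    vρ : v · ρ ≡ w
    vρ = trans (cong (_· (α A.⁻¹)) e₃) (undo α e₂)
    wρ : w · ρ ≡ v
    wρ = trans (cong (_· (α A.⁻¹)) e₄) (undo α e₁)
    both : ∀ {p q} → p ~ q → p ⟶ q
    both p~q = [ id , (λ { (γ , e , e′) → ρ A.∙ γ , trans (cong (_· γ) vρ) e′ , trans (cong (_· γ) wρ) e }) ]′ (~-⟶ p~q)
    join : ∀ {p q r s} → p ⟶ q → r ⟶ s → Σ[ γ ∈ Automorphism Γ ] p · γ ≡ r × q · γ ≡ s
    join (γ , e , e′) (δ , f , f′) = (γ A.⁻¹) A.∙ δ , trans (cong (_· δ) (undo γ e)) f , trans (cong (_· δ) (undo γ e′)) f′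

  _⟶?_ : ∀ x y → Dec (x ⟶ y)
  x ⟶? y with x ~? y
  ... | no ¬x~y = no (¬x~y ∘ ⟶-~)
  ... | yes x~y with ~-⟶ x~y
  ...   | inj₁ a = yes a
  ...   | inj₂ a = no (⟶-anti a)

  private
    transport : ∀ {P : Vertex → Vertex → Set} → (∀ α {x y} → P x y → P (x · α) (y · α)) → ∀ {d x} y → Exactly (P x) d → Exactly (P y) d
    transport {P} P-· {d} {x} y (f , f-inj , f∈ , f-all) = let (α , e) = vertex-transitive x y in
      (λ i → f i · α) , (λ eq → f-inj (^^-inj Γ α eq)) , (λ i → subst (λ z → P z (f i · α)) e (P-· α (f∈ i))) ,
      λ z p → let (i , eq) = f-all (z · (α A.⁻¹)) (subst (λ u → P u (z · (α A.⁻¹))) (undo α e) (P-· (α A.⁻¹) p)) in i , trans (cong (_· α) eq) (A.inverseˡ α z)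

    d⁺ d⁻ : ℕ
    d⁺ = Subset.size (subset (v ⟶_) (v ⟶?_))
    d⁻ = Subset.size (subset (_⟶ v) (_⟶? v))

    outs : ∀ u → Exactly (u ⟶_) d⁺
    outs u = transport {_⟶_} ⟶-· u (exactly (v ⟶?_))

    ins : ∀ u → Exactly (_⟶ u) d⁻
    ins u = transport {λ x y → y ⟶ x} (λ α → ⟶-· α) u (exactly (_⟶? v))

    sum≡4 : d⁺ + d⁻ ≡ 4
    sum≡4 = ℕₚ.≤-antisym (exactly-≤ all first id) (exactly-≤ first all id)
      where
      all : Exactly (v ~_) (d⁺ + d⁻)
      all = exactly-⊎ (outs v) (ins v) ⟶-~ (~-sym ∘ ⟶-~) ~-⟶ ⟶-anti

    balanced : d⁺ ≡ d⁻
    balanced = ℕₚ.≤-antisym (ℕₚ.*-cancelˡ-≤ size {{Finₚ.nonZeroIndex v}} (double-count outs ins))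
      (ℕₚ.*-cancelˡ-≤ size {{Finₚ.nonZeroIndex v}} (double-count ins outs))

    halve : ∀ d → d + d ≡ 4 → d ≡ 2
    halve (suc (suc zero)) _ = refl
    halve (suc zero) ()
    halve (suc (suc (suc d))) e with trans (sym (ℕₚ.+-comm d (suc (suc (suc d))))) (ℕₚ.suc-injective (ℕₚ.suc-injective (ℕₚ.suc-injective e)))
    ... | ()

    two : ∀ u → Exactly (u ⟶_) 2
    two u = subst (Exactly (u ⟶_)) (halve d⁺ (trans (cong (ℕ._+_ d⁺) balanced) sum≡4)) (outs u)

    fin2 : ∀ {i j k : Fin 2} → j ≢ i → k ≢ i → j ≡ k
    fin2 {zero} {zero} {_} p q = ⊥-elim (p refl)
    fin2 {zero} {suc zero} {zero} p q = ⊥-elim (q refl)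
    fin2 {zero} {suc zero} {suc zero} p q = refl
    fin2 {suc zero} {zero} {zero} p q = refl
    fin2 {suc zero} {zero} {suc zero} p q = ⊥-elim (q refl)
    fin2 {suc zero} {suc zero} p q = ⊥-elim (p refl)

  at-most-two : ∀ {u x y z} → u ⟶ x → u ⟶ y → u ⟶ z → y ≢ x → z ≢ x → y ≡ z
  at-most-two {u} {x} {y} {z} p q r y≢x z≢x = let (f , _ , _ , all) = two u ; (i , ei) = all x p ; (j , ej) = all y q ; (k , ek) = all z r in
    trans (sym ej) (trans (cong f (fin2 {i} (λ e → y≢x (trans (sym ej) (trans (cong f e) ei))) (λ e → z≢x (trans (sym ek) (trans (cong f e) ei))))) ek)

  other : Σ[ x ∈ Vertex ] (v ⟶ x) × x ≢ w
  other = choose (f zero Finₚ.≟ w)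
    where
    f = proj₁ (two v)
    choose : Dec (f zero ≡ w) → Σ[ x ∈ Vertex ] (v ⟶ x) × x ≢ w
    choose (no ≢w) = f zero , proj₁ (proj₂ (proj₂ (two v))) zero , ≢w
    choose (yes ≡w) = f (suc zero) , proj₁ (proj₂ (proj₂ (two v))) (suc zero) , λ e → Finₚ.0≢1+n {1} {zero} (proj₁ (proj₂ (two v)) (trans ≡w (sym e)))

  ⟶-outs : ∀ {u x y} → u ⟶ x → u ⟶ y → Σ[ α ∈ Automorphism Γ ] u · α ≡ u × x · α ≡ y
  ⟶-outs (α , e , e′) (β , f , f′) = (α A.⁻¹) A.∙ β , trans (cong (_· β) (undo α e)) f , trans (cong (_· β) (undo α e′)) f′

  private
    -- The arc x ⟶ y lies on the closed directed walk traced by an automorphism taking x to y.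
    back : ∀ {x y} → x ⟶ y → Star _⟶_ y x
    back {x} {y} a = let (γ , e) = vertex-transitive x y in
      subst (Star _⟶_ y) (finite-order size id id (_· γ) (^^-inj Γ γ) x)
        (subst (λ k → Star _⟶_ y (iter (_· γ) k x)) (ℕₚ.suc-pred (size !) {{ℕ.>-nonZero (ℕₚ.1≤n! size)}})
          (subst (λ z → Star _⟶_ y (iter (_· γ) (ℕ.pred (size !)) z)) (sym e) (along-γ γ (subst (_⟶ y · γ) e (⟶-· γ a)) (ℕ.pred (size !)))))
      where
      along-γ : ∀ γ {z} → z ⟶ z · γ → ∀ k → Star _⟶_ z (iter (_· γ) k z)
      along-γ γ a zero = done
      along-γ γ a (suc k) = a ◅ along-γ γ (⟶-· γ a) k

  strongly-connected : ∀ x y → Star _⟶_ x y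
  strongly-connected x y = directed (connected x y)
    where
    directed : ∀ {x y} → Star _~_ x y → Star _⟶_ x y
    directed done = done
    directed (x~y ◅ p) = [ _◅ done , back ]′ (~-⟶ x~y) ◅◅ directed p

-- From a graph to a concentric sequence

module FromGraph {c ℓ} (H : Group c ℓ) (hn : ℕ) (code : HasOrder H hn) (Γ : Graph) (connected : Connected Γ) (tetravalent : Tetravalent Γ)
  (vertex-transitive : VertexTransitive Γ) (edge-transitive : EdgeTransitive Γ) (half : ¬ ArcTransitive Γ) (v : Graph.Vertex Γ)
  (f : Group.Carrier H → Group.Carrier (Stabilizer Γ v))
  (f-iso : IsGroupIsomorphism (Group.rawGroup H) (Group.rawGroup (Stabilizer Γ v)) f) where

  open Group H renaming (refl to ≈-refl; sym to ≈-sym; trans to ≈-trans)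
  open Graph Γ using (Vertex; size)
  open Orientation Γ connected tetravalent vertex-transitive edge-transitive half v
  private
    module A = Group (Aut Γ)
    module f = IsGroupIsomorphism f-iso
    infixl 8 _·_
    _·_ = _^^_ Γ

    F : Carrier → Automorphism Γ
    F x = proj₁ (f x)

    F-∙ : ∀ x y u → u · F (x ∙ y) ≡ u · F x · F y
    F-∙ = f.∙-homo

    -- The inverse of `f` with the default `ε` off the stabilizer, so that `pull` applies before
    -- membership is known.
    pull′ : ∀ α → Dec (v · α ≡ v) → Carrier
    pull′ α (yes e) = proj₁ (f.surjective (α , e))
    pull′ α (no _) = ε

    pull : Automorphism Γ → Carrier
    pull α = pull′ α (v · α Finₚ.≟ v)

    F-pull : ∀ α → v · α ≡ v → ∀ u → u · F (pull α) ≡ u · α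
    F-pull α e = go (v · α Finₚ.≟ v)
      where
      go : ∀ d u → u · F (pull′ α d) ≡ u · α
      go (yes e) = proj₂ (f.surjective (α , e)) ≈-refl
      go (no ¬e) = ⊥-elim (¬e e)

    g : Automorphism Γ
    g = proj₁ (vertex-transitive v w)

    vg : v · g ≡ w
    vg = proj₂ (vertex-transitive v w)

    T : ℕ → Vertex
    T i = iter (_· g) i v

    -- Q p i is the vertex v^(g^(i-p)).
    Q : ℕ → ℕ → Vertex
    Q p i = iter (_· (g A.⁻¹)) p (T i)

    Q-arc : ∀ p i → Q p i ⟶ Q p (suc i)
    Q-arc p i = backward p (forward i (subst (v ⟶_) (sym vg) v⟶w))
      where
      forward : ∀ i {z} → z ⟶ z · g → iter (_· g) i z ⟶ iter (_· g) (suc i) z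
      forward zero a = a
      forward (suc i) a = forward i (⟶-· g a)
      backward : ∀ p {x y} → x ⟶ y → iter (_· (g A.⁻¹)) p x ⟶ iter (_· (g A.⁻¹)) p y
      backward zero a = a
      backward (suc p) a = backward p (⟶-· (g A.⁻¹) a)

    Q-suc : ∀ p i → Q (suc p) (suc i) ≡ Q p i
    Q-suc p i = cong (iter (_· (g A.⁻¹)) p) (undo g (sym (iter-suc (_· g) i v)))

    Q-+ : ∀ j p i → Q (j + p) (j + i) ≡ Q p i
    Q-+ zero p i = refl
    Q-+ (suc j) p i = trans (Q-suc (j + p) (j + i)) (Q-+ j p i)

    Q-base : ∀ p → Q p p ≡ v
    Q-base zero = refl
    Q-base (suc p) = trans (Q-suc p p) (Q-base p)

    Q-back : ∀ p i → Q p i · (g A.⁻¹) ≡ Q (suc p) i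
    Q-back p i = sym (iter-suc (_· (g A.⁻¹)) p (T i))

    Q-forth : ∀ p i → Q (suc p) i · g ≡ Q p i
    Q-forth p i = trans (cong (_· g) (sym (Q-back p i))) (A.inverseˡ g (Q p i))

    Fix : ℕ → ℕ → Automorphism Γ → Set
    Fix p m α = ∀ i → i ≤ m → Q p i · α ≡ Q p i

    fix? : ∀ p m α → Dec (Fix p m α)
    fix? p m α = map′ (λ h i i≤m → subst (λ j → Q p j · α ≡ Q p j) (Finₚ.toℕ-fromℕ< (s≤s i≤m)) (h (fromℕ< (s≤s i≤m))))
      (λ h i → h (toℕ i) (ℕₚ.≤-pred (Finₚ.toℕ<n i))) (Finₚ.all? {n = suc m} λ i → Q p (toℕ i) · α Finₚ.≟ Q p (toℕ i))

    fix-suc : ∀ {p m α} → Fix p m α → Q p (suc m) · α ≡ Q p (suc m) → Fix p (suc m) α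
    fix-suc fx e i i≤ = [ (λ i< → fx i (ℕₚ.≤-pred i<)) , (λ { refl → e }) ]′ (ℕₚ.m≤n⇒m<n∨m≡n i≤)

    fix-base : ∀ {p m α} → p ≤ m → Fix p m α → v · α ≡ v
    fix-base {p} {m} {α} p≤m fx = subst (λ u → u · α ≡ u) (Q-base p) (fx p p≤m)

    fix-cong : ∀ {p m} α β → (∀ u → u · α ≡ u · β) → Fix p m α → Fix p m β
    fix-cong α β e fx i i≤m = trans (sym (e _)) (fx i i≤m)

    -- Ranging over codes of H makes this decidable, as the search for the least failure requires.
    -- No automorphism is lost, since all those in question fix `T 0`, which is `v`.
    Swap : ℕ → Set
    Swap j = Σ[ k ∈ Fin hn ] Fix 0 j (F (Inverse.from code k)) × T (suc j) · F (Inverse.from code k) ≢ T (suc j)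

    swap? : ∀ j → Dec (Swap j)
    swap? j = Finₚ.any? λ k → fix? 0 j (F (Inverse.from code k)) ×-dec ¬? (T (suc j) · F (Inverse.from code k) Finₚ.≟ T (suc j))

    swap-0 : Swap 0
    swap-0 = let (x , v⟶x , x≢w) = other ; (α , e , e′) = ⟶-outs v⟶w v⟶x ; k = Inverse.to code (pull α)
                 same : ∀ u → u · F (Inverse.from code k) ≡ u · α
                 same u = trans (f.⟦⟧-cong (proj₂ (Inverse.inverse code) refl) u) (F-pull α e u) in
      k , (λ { zero _ → trans (same v) e }) , λ eq → x≢w (trans (sym e′) (trans (cong (_· α) (sym vg)) (trans (sym (same (v · g))) (trans eq vg))))

    -- Witnesses for different indices differ: the one for the larger index fixes the vertex that
    -- the one for the smaller index moves. H has only `hn` elements.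
    swaps-stop : Σ[ j ∈ ℕ ] ¬ Swap j
    swaps-stop = decide (Finₚ.all? {n = suc hn} λ j → swap? (toℕ j))
      where
      decide : Dec (∀ (j : Fin (suc hn)) → Swap (toℕ j)) → Σ[ j ∈ ℕ ] ¬ Swap j
      decide (no ¬all) = let (j , ¬s) = Finₚ.¬∀⟶∃¬ (suc hn) (λ j → Swap (toℕ j)) (λ j → swap? (toℕ j)) ¬all in toℕ j , ¬s
      decide (yes all) = let (i , j , i<j , e) = Finₚ.pigeonhole (ℕₚ.n<1+n hn) (λ j → proj₁ (all j)) in
        ⊥-elim (proj₂ (proj₂ (all i)) (subst (λ k → T (suc (toℕ i)) · F (Inverse.from code k) ≡ T (suc (toℕ i))) (sym e) (proj₁ (proj₂ (all j)) (suc (toℕ i)) i<j)))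

    F-ε : ∀ u → u · F ε ≡ u
    F-ε = f.ε-homo

  nontrivial : ¬ Trivial H
  nontrivial trivial = let (k , _ , moves) = swap-0 in moves (trans (f.⟦⟧-cong (trivial (Inverse.from code k)) (T 1)) (F-ε (T 1)))

  module Length (n′ : ℕ) (no-swap : ¬ Swap (suc n′)) (swaps : ∀ j → j < suc n′ → Swap j) where
    private
      n = suc n′

      still : ∀ α → Fix 0 n α → T (suc n) · α ≡ T (suc n)
      still α fx = decidable-stable (T (suc n) · α Finₚ.≟ T (suc n)) λ moves → no-swap
          (k , fix-cong {0} {n} α (F (Inverse.from code k)) (λ u → sym (same u)) fx , λ e → moves (trans (sym (same _)) e))
        where
        k = Inverse.to code (pull α)
        same : ∀ u → u · F (Inverse.from code k) ≡ u · α
        same u = trans (f.⟦⟧-cong (proj₂ (Inverse.inverse code) refl) u) (F-pull α (fix-base {0} {n} {α} z≤n fx) u)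

      -- Transitivity and rigidity on directed walks

      data Trail (β : Automorphism Γ) : ℕ → Vertex → Set where
        start : ∀ {x} → x · β ≡ x → Trail β 0 x
        step  : ∀ {j x y} → Trail β j x → x ⟶ y → y · β ≡ y → Trail β (suc j) y

      last-fixed : ∀ {β j x} → Trail β j x → x · β ≡ x
      last-fixed (start e) = e
      last-fixed (step _ _ e) = e

      forget : ∀ {β j x} → Trail β (suc j) x → Trail β j x
      forget (step (start _) _ e) = start e
      forget (step t@(step _ _ _) a e) = step (forget t) a e

      Carried : Automorphism Γ → ℕ → Vertex → Set
      Carried β j x = Σ[ α ∈ Automorphism Γ ] T j · α ≡ x × (∀ i → i ≤ j → T i · α · β ≡ T i · α)

      -- An automorphism fitting the shorter trail may send the next vertex to the wrong one of two
      -- out-neighbours; a swap, which fixes the earlier vertices, corrects this.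
      carry : ∀ {β j x} → j ≤ n → Trail β j x → Carried β j x
      carry {β} {_} {x} _ (start e) = let (α , eq) = vertex-transitive v x in α , eq , λ { zero _ → subst (λ u → u · β ≡ u) (sym eq) e }
      carry {β} {_} {y} j<n (step {j} {x} t a e) = extend (carry (ℕₚ.<⇒≤ j<n) t) (swaps j j<n)
        where
        close : ∀ α → (∀ i → i ≤ j → T i · α · β ≡ T i · α) → T (suc j) · α ≡ y → Carried β (suc j) y
        close α fx eq = α , eq , λ i i≤ → [ (λ i< → fx i (ℕₚ.≤-pred i<)) , (λ { refl → subst (λ u → u · β ≡ u) (sym eq) e }) ]′ (ℕₚ.m≤n⇒m<n∨m≡n i≤)
        extend : Carried β j x → Swap j → Carried β (suc j) y
        extend (α , eq , fx) (k , s-fix , s-moves) = choose (T (suc j) · α Finₚ.≟ y)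
          where
          σ = F (Inverse.from code k)
          choose : Dec (T (suc j) · α ≡ y) → Carried β (suc j) y
          choose (yes eq′) = close α fx eq′
          choose (no ≢y) = close (σ A.∙ α) (λ i i≤j → subst (λ u → u · α · β ≡ u · α) (sym (s-fix i i≤j)) (fx i i≤j))
            (at-most-two (subst (_⟶ T (suc j) · α) eq (⟶-· α (Q-arc 0 j)))
              (subst (_⟶ T (suc j) · σ · α) (trans (cong (_· α) (s-fix j ℕₚ.≤-refl)) eq) (⟶-· α (⟶-· σ (Q-arc 0 j)))) a
              (λ e → s-moves (^^-inj Γ α e)) (λ e → ≢y (sym e)))

      -- By `carry` the trail is an image of `T 0`, ..., `T n`, so by `still` the image of
      -- `T (suc n)` is fixed as well. As `x` has only two out-neighbours, the other one must be
      -- fixed too.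
      advance : ∀ {β x y} → x ⟶ y → Trail β n x → Trail β n y
      advance {β} {x} {y} a t = forget (step t a (next-fixed (carry ℕₚ.≤-refl t)))
        where
        next-fixed : Carried β n x → y · β ≡ y
        next-fixed (α , eq , fx) = choose (y Finₚ.≟ z)
          where
          z = T (suc n) · α
          γ = (α A.∙ β) A.∙ (α A.⁻¹)
          zβ : z · β ≡ z
          zβ = trans (sym (A.inverseˡ α (z · β))) (cong (_· α) (still γ λ i i≤n → undo α (sym (fx i i≤n))))
          x⟶z : x ⟶ z
          x⟶z = subst (_⟶ z) eq (⟶-· α (Q-arc 0 n))
          choose : Dec (y ≡ z) → y · β ≡ y
          choose (yes y≡z) = subst (λ u → u · β ≡ u) (sym y≡z) zβ
          choose (no y≢z) = at-most-two x⟶z (subst (_⟶ y · β) (last-fixed t) (⟶-· β a)) a (λ e → y≢z (^^-inj Γ β (trans e (sym zβ)))) y≢z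

      trail : ∀ {p β} j → Fix p j β → Trail β j (Q p j)
      trail zero fx = start (fx 0 z≤n)
      trail {p} (suc j) fx = step (trail {p} j λ i i≤j → fx i (ℕₚ.m≤n⇒m≤1+n i≤j)) (Q-arc p j) (fx (suc j) ℕₚ.≤-refl)

      rigid : ∀ {p β} → Fix p n β → ∀ u → u · β ≡ u
      rigid {p} {β} fx u = last-fixed (walk (strongly-connected (Q p n) u) (trail {p} n fx))
        where
        walk : ∀ {x y} → Star _⟶_ x y → Trail β n x → Trail β n y
        walk done t = t
        walk (a ◅ s) t = walk s (advance a t)

      -- The conjugate generators and the stabilizers they generate

      conj conj⁻ : Automorphism Γ → Automorphism Γ
      conj α = (g A.∙ α) A.∙ (g A.⁻¹)
      conj⁻ α = ((g A.⁻¹) A.∙ α) A.∙ g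

      conj-fix : ∀ {p α i} → Q p i · α ≡ Q p i → Q (suc p) i · conj α ≡ Q (suc p) i
      conj-fix {p} {α} {i} e = trans (cong (_· (g A.⁻¹)) (trans (cong (_· α) (Q-forth p i)) e)) (Q-back p i)

      conj⁻-fix : ∀ {p α i} → Q (suc p) i · α ≡ Q (suc p) i → Q p i · conj⁻ α ≡ Q p i
      conj⁻-fix {p} {α} {i} e = trans (cong (_· g) (trans (cong (_· α) (Q-back p i)) e)) (Q-forth p i)

      conj-conj⁻ : ∀ α u → u · conj (conj⁻ α) ≡ u · α
      conj-conj⁻ α u = trans (A.inverseʳ g _) (cong (_· α) (A.inverseʳ g u))

      b : ℕ → Automorphism Γ
      b zero = F (Inverse.from code (proj₁ (swaps n′ ℕₚ.≤-refl)))
      b (suc k) = conj (b k)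

      b-fix : ∀ k i → i < n → Q k i · b k ≡ Q k i
      b-fix zero i i<n = proj₁ (proj₂ (swaps n′ ℕₚ.≤-refl)) i (ℕₚ.≤-pred i<n)
      b-fix (suc k) i i<n = conj-fix {k} {b k} {i} (b-fix k i i<n)

      b-move : ∀ k → Q k n · b k ≢ Q k n
      b-move zero e = proj₂ (proj₂ (swaps n′ ℕₚ.≤-refl)) e
      b-move (suc k) e = b-move k (^^-inj Γ (g A.⁻¹) (trans (cong (λ u → u · b k · (g A.⁻¹)) (sym (Q-forth k n))) (trans e (sym (Q-back k n)))))

      a : ℕ → Carrier
      a k = pull (b (k ∸ 1))

      F-a : ∀ k → k < n → ∀ u → u · F (a (suc k)) ≡ u · b k
      F-a k k<n = F-pull (b k) (subst (λ u → u · b k ≡ u) (Q-base k) (b-fix k k k<n))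

      Gen : ℕ → ℕ → Carrier → Set _
      Gen i j = Generated H (Segment H a i j)

      a-fix : ∀ p j m l → j < l → l + m ≡ n → p ≤ m → Fix p m (F (a (suc (j + p))))
      a-fix p j m l j<l e p≤m i i≤m = trans (F-a (j + p) (bound p≤m) (Q p i))
          (trans (cong (_· b (j + p)) (sym (Q-+ j p i))) (trans (b-fix (j + p) (j + i) (bound i≤m)) (Q-+ j p i)))
        where
        bound : ∀ {i} → i ≤ m → j + i < n
        bound {i} i≤m = subst (ℕ._<_ (j + i)) e (ℕₚ.+-mono-<-≤ j<l i≤m)

      gen⇒fix : ∀ p l m → l + m ≡ n → p ≤ m → ∀ {x} → Gen (suc p) (p + l) x → Fix p m (F x)
      gen⇒fix p l m e p≤m {x} (gen (suc k , s≤s p≤k , k< , x≈)) = fix-cong {p} {m} (F (a (suc k))) (F x) (λ u → f.⟦⟧-cong (≈-sym x≈) u)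
        (subst (λ k → Fix p m (F (a (suc k)))) (ℕₚ.m∸n+n≡m p≤k) (a-fix p (k ∸ p) m l (ℕₚ.+-cancelˡ-< p (k ∸ p) l (subst (_< p + l) (sym (ℕₚ.m+[n∸m]≡n p≤k)) k<)) e p≤m))
      gen⇒fix p l m e p≤m ε′ i _ = F-ε (Q p i)
      gen⇒fix p l m e p≤m (_∙′_ {x} {y} s t) i i≤m = trans (F-∙ x y (Q p i)) (trans (cong (_· F y) (gen⇒fix p l m e p≤m s i i≤m)) (gen⇒fix p l m e p≤m t i i≤m))
      gen⇒fix p l m e p≤m (inv {x} s) i i≤m = trans (f.⁻¹-homo x (Q p i)) (undo (F x) (gen⇒fix p l m e p≤m s i i≤m))
      gen⇒fix p l m e p≤m (resp {x} {y} x≈y s) = fix-cong {p} {m} (F x) (F y) (λ u → f.⟦⟧-cong x≈y u) (gen⇒fix p l m e p≤m s)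

      to-inj : ∀ {x y} → Inverse.to code x ≡ Inverse.to code y → x ≈ y
      to-inj {x} {y} e = ≈-trans (≈-sym (proj₂ (Inverse.inverse code) refl)) (≈-trans (Inverse.from-cong code e) (proj₂ (Inverse.inverse code) refl))

    open Orders H (λ x y → map′ to-inj (Inverse.to-cong code) (Inverse.to code x Finₚ.≟ Inverse.to code y))

    private
      Described : ℕ → ℕ → ℕ → Set _
      Described p l m = (∀ {x} → Fix p m (F x) → Gen (suc p) (p + l) x) × HasOrder (⟨_⟩ H (Segment H a (suc p) (p + l))) (2 ^ l)

      -- The stabilizer of Q p 0, …, Q p m acts on the two out-neighbours of Q p m, with kernel the stabilizer of one vertex more.
      describe : ∀ l p m → l + m ≡ n → p ≤ m → Described p l m
      describe zero p m refl p≤m = (λ fx → resp (≈-sym (collapse fx)) ε′) ,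
          hasOrder {k = 1} (λ _ → ε) (λ _ → ε′) (λ { {zero} {zero} _ → refl }) (λ s → zero , ≈-sym (collapse (gen⇒fix p 0 n refl p≤m s)))
        where
        collapse : ∀ {x} → Fix p n (F x) → x ≈ ε
        collapse {x} fx = f.injective λ u → trans (rigid {p} {F x} fx u) (sym (F-ε u))
      describe (suc l) p m e p≤m = (λ fx → [ ⊆ , (λ s → resp (≈-trans (assoc _ _ _) (≈-trans (∙-congˡ (inverseˡ d)) (identityʳ _))) (⊆ s ∙′ d∈)) ]′ (split fx)) ,
          double smaller-order ⊆ d∈ (λ s → d-moves (gen⇒fix p l (suc m) e′ p≤1+m s (suc m) ℕₚ.≤-refl)) (λ s → split (gen⇒fix p (suc l) m e p≤m s))
        where
        e′ : l + suc m ≡ n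
        e′ = trans (ℕₚ.+-suc l m) e
        p≤1+m = ℕₚ.m≤n⇒m≤1+n p≤m
        smaller = proj₁ (describe l p (suc m) e′ p≤1+m)
        smaller-order = proj₂ (describe l p (suc m) e′ p≤1+m)
        d : Carrier
        -- This generator fixes `Q p 0`, ..., `Q p m` but moves `Q p (suc m)`: it moves
        -- `Q (l + p) n`, which is the same vertex because n = l + (m + 1).
        d = a (suc (l + p))
        ⊆ : ∀ {x} → Gen (suc p) (p + l) x → Gen (suc p) (p + suc l) x
        ⊆ = generated-⊆ H λ { (k , p<k , k≤ , x≈) → gen (k , p<k , ℕₚ.≤-trans k≤ (ℕₚ.+-monoʳ-≤ p (ℕₚ.n≤1+n l)) , x≈) }
        d∈ : Gen (suc p) (p + suc l) d
        d∈ = gen (suc (l + p) , s≤s (ℕₚ.m≤n+m p l) , ℕₚ.≤-reflexive (ℕₚ.+-comm (suc l) p) , ≈-refl)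
        d-fix : Fix p m (F d)
        d-fix = a-fix p l m (suc l) ℕₚ.≤-refl e p≤m
        y = Q p (suc m)
        d-moves : y · F d ≢ y
        d-moves eq = b-move (l + p) (subst (λ i → Q (l + p) i · b (l + p) ≡ Q (l + p) i) e′
          (subst (λ u → u · b (l + p) ≡ u) (sym (Q-+ l p (suc m))) (trans (sym (F-a (l + p) (subst (suc (l + p) ≤_) e (s≤s (ℕₚ.+-monoʳ-≤ l p≤m))) y)) eq)))
        split : ∀ {x} → Fix p m (F x) → Gen (suc p) (p + l) x ⊎ Gen (suc p) (p + l) (x ∙ d ⁻¹)
        split {x} fx = choose (y · F x Finₚ.≟ y)
          where
          out : ∀ α → Fix p m α → Q p m ⟶ y · α
          out α fx = subst (_⟶ y · α) (fx m ℕₚ.≤-refl) (⟶-· α (Q-arc p m))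
          quotient : ∀ u → u · F (x ∙ d ⁻¹) ≡ u · F x · (F d A.⁻¹)
          quotient u = trans (F-∙ x (d ⁻¹) u) (f.⁻¹-homo d (u · F x))
          choose : Dec (y · F x ≡ y) → Gen (suc p) (p + l) x ⊎ Gen (suc p) (p + l) (x ∙ d ⁻¹)
          choose (yes eq) = inj₁ (smaller (fix-suc {p} {m} {F x} fx eq))
          choose (no moves) = inj₂ (smaller (fix-suc {p} {m} {F (x ∙ d ⁻¹)}
            (λ i i≤m → trans (quotient _) (trans (cong (_· (F d A.⁻¹)) (fx i i≤m)) (undo (F d) (d-fix i i≤m))))
            (trans (quotient y) (undo (F d) (sym (at-most-two (Q-arc p m) (out (F x) fx) (out (F d) d-fix) moves d-moves))))))

      order : ∀ i j → 1 ≤ i → i ≤ j → j ≤ n → HasOrder (⟨_⟩ H (Segment H a i j)) (2 ^ (j ∸ i + 1))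
      order (suc p) j _ p<j j≤n = subst₂ (λ j l → HasOrder (⟨_⟩ H (Segment H a (suc p) j)) (2 ^ l)) p+l≡j (ℕₚ.+-comm 1 (j ∸ suc p))
          (proj₂ (describe l p (n ∸ l) (ℕₚ.m+[n∸m]≡n (ℕₚ.≤-trans (ℕₚ.m≤n+m l p) p+l≤n)) (ℕₚ.m+n≤o⇒m≤o∸n p p+l≤n)))
        where
        l = suc (j ∸ suc p)
        p+l≡j : p + l ≡ j
        p+l≡j = trans (ℕₚ.+-suc p (j ∸ suc p)) (ℕₚ.m+[n∸m]≡n p<j)
        p+l≤n : p + l ≤ n
        p+l≤n = subst (_≤ n) (sym p+l≡j) j≤n

      n′+1 : n′ + 1 ≡ n
      n′+1 = ℕₚ.+-comm n′ 1

      lower : ∀ {x} → Gen 1 n′ x → Fix 0 1 (F x)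
      lower = gen⇒fix 0 n′ 1 n′+1 z≤n

      conj-base : ∀ {x} → Gen 1 n′ x → v · conj (F x) ≡ v
      conj-base {x} s = fix-base {1} {1} {conj (F x)} ℕₚ.≤-refl λ i i≤1 → conj-fix {0} {F x} {i} (lower s i i≤1)

      φ : Σ Carrier (Gen 1 n′) → Σ Carrier (Gen 2 n)
      φ (x , s) = pull (conj (F x)) , proj₁ (describe n′ 1 1 n′+1 ℕₚ.≤-refl)
        (fix-cong {1} {1} (conj (F x)) (F (pull (conj (F x)))) (λ u → sym (F-pull (conj (F x)) (conj-base s) u)) λ i i≤1 → conj-fix {0} {F x} {i} (lower s i i≤1))

      F-φ : ∀ x u → u · F (proj₁ (φ x)) ≡ u · conj (F (proj₁ x))
      F-φ (x , s) = F-pull (conj (F x)) (conj-base s)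

    sequence : IsConcentricSequence H n a
    sequence = record { generates = generates ; order = order ; shift = φ , φ-iso ; shift-gen = shift-gen }
      where
      generates : ∀ x → Gen 1 n x
      generates x = proj₁ (describe n 0 0 (ℕₚ.+-identityʳ n) z≤n) λ { zero _ → proj₂ (f x) }
      φ-iso : IsGroupIsomorphism (Group.rawGroup (⟨_⟩ H (Segment H a 1 n′))) (Group.rawGroup (⟨_⟩ H (Segment H a 2 n))) φ
      φ-iso = isGroupIsomorphism (⟨_⟩ H (Segment H a 1 n′)) (⟨_⟩ H (Segment H a 2 n)) φ
        (λ {x} {y} e → f.injective λ u → trans (F-φ x u) (trans (cong (_· (g A.⁻¹)) (f.⟦⟧-cong e (u · g))) (sym (F-φ y u))))
        (λ x y → f.injective λ u → trans (F-φ (proj₁ x ∙ proj₁ y , proj₂ x ∙′ proj₂ y) u) (trans (cong (_· (g A.⁻¹)) (F-∙ (proj₁ x) (proj₁ y) (u · g)))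
          (trans (sym (cong (λ z → z · F (proj₁ y) · (g A.⁻¹)) (A.inverseˡ g (u · g · F (proj₁ x)))))
            (sym (trans (F-∙ (proj₁ (φ x)) (proj₁ (φ y)) u) (trans (F-φ y _) (cong (λ z → z · conj (F (proj₁ y))) (F-φ x u))))))))
        (λ {x} {y} e → f.injective λ u → ^^-inj Γ (g A.⁻¹) (trans (cong (λ z → z · F (proj₁ x) · (g A.⁻¹)) (sym (A.inverseˡ g u)))
          (trans (sym (F-φ x (u · (g A.⁻¹)))) (trans (f.⟦⟧-cong e _) (trans (F-φ y (u · (g A.⁻¹))) (cong (λ z → z · F (proj₁ y) · (g A.⁻¹)) (A.inverseˡ g u)))))))
        surjective
        where
        surjective : ∀ y → Σ[ x ∈ Σ Carrier (Gen 1 n′) ] proj₁ (φ x) ≈ proj₁ y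
        surjective (y , s) = (pull (conj⁻ (F y)) , member) ,
            f.injective λ u → trans (F-φ (_ , member) u) (trans (cong (_· (g A.⁻¹)) (F-pull (conj⁻ (F y)) base (u · g))) (conj-conj⁻ (F y) u))
          where
          fx : Fix 0 1 (conj⁻ (F y))
          fx i i≤1 = conj⁻-fix {0} {F y} {i} (gen⇒fix 1 n′ 1 n′+1 ℕₚ.≤-refl s i i≤1)
          base : v · conj⁻ (F y) ≡ v
          base = fx 0 z≤n
          member : Gen 1 n′ (pull (conj⁻ (F y)))
          member = proj₁ (describe n′ 0 1 n′+1 z≤n) (fix-cong {0} {1} (conj⁻ (F y)) (F (pull (conj⁻ (F y)))) (λ u → sym (F-pull (conj⁻ (F y)) base u)) fx)
      shift-gen : ∀ i (1≤i : 1 ≤ i) (i≤n′ : i ≤ n′) → proj₁ (φ (a i , gen (i , 1≤i , i≤n′ , ≈-refl))) ≈ a (suc i)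
      shift-gen (suc i) 1≤i i≤n′ = f.injective λ u → trans (F-φ (a (suc i) , gen (suc i , 1≤i , i≤n′ , ≈-refl)) u)
        (trans (cong (_· (g A.⁻¹)) (F-a i (ℕₚ.m≤n⇒m≤1+n i≤n′) (u · g))) (sym (F-a (suc i) (s≤s i≤n′) u)))

  concentric : Concentric H
  concentric = let (j , ¬s) = swaps-stop ; (n , no-swap , below) = least (λ j → ¬ Swap j) (λ j → ¬? (swap? j)) j ¬s in
    positive n no-swap λ i i<n → decidable-stable (swap? i) (below i i<n)
    where
    positive : ∀ n → ¬ Swap n → (∀ i → i < n → Swap i) → Concentric H
    positive zero no-swap _ = ⊥-elim (no-swap swap-0)
    positive (suc n′) no-swap swaps = suc n′ , _ , Length.sequence n′ no-swap swaps

theorem1p2 : ∀ {c ℓ} (H : Group c ℓ) → Finite H →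
    (Σ[ Γ ∈ Graph ] Σ[ v ∈ Graph.Vertex Γ ]
      (Connected Γ × Tetravalent Γ × HalfArcTransitive Γ × H ≅ Stabilizer Γ v))
    ⇔ (¬ Trivial H × Concentric H)
theorem1p2 H (hn , code) = mk⇔
  (λ { (Γ , v , connected , tetravalent , (vt , et , half) , f , f-iso) →
    FromGraph.nontrivial H hn code Γ connected tetravalent vt et half v f f-iso , FromGraph.concentric H hn code Γ connected tetravalent vt et half v f f-iso })
  (λ { (nontrivial , concentric) → realize H (hn , code) nontrivial concentric })
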